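{- Swap Bribery for $k$-approval, on instances with $n$ votes and $m$ candidates, can be solved with a randomized algorithm in $2^{2(\log n+\log k)nk}\,O(m^{k+1})$ expected time. The derandomized version of the algorithm is a deterministic algorithm solving the problem with running time $2^{O((\log n+\log k)nk)}\,O(m^{k+1}\log m)$.
   Context: Elections. An election consists of a set $C=\{c_1,\dots,c_m\}$ of candidates and votes $V=\{v_1,\dots,v_n\}$; each vote is a strict linear order over $C$ (several voters may have the same order), and $\mathrm{rank}(c,v)$ is the position of $c$ in $v$ (position $1$ is best). In $k$-approval, a candidate $c$ receives one point from $v$ if $\mathrm{rank}(c,v)\le k$ and zero points otherwise; the winners are all candidates with the highest total number of points (ties are allowed, so there may be several winners). Swaps. A swap in a vote $v$ is a triple $(v,a,b)$ with $a,b\in C$, $a\ne b$. It is admissible in $v$ if $\mathrm{rank}(a,v)=\mathrm{rank}(b,v)-1$; applying it exchanges the positions of $a$ and $b$ in $v$. A set $\Gamma$ of swaps is admissible in $v$ if its elements can be applied to $v$ one after the other in some order, each being admissible in the vote obtained so far; the resulting vote is $v^{\Gamma}$. This extends vote by vote to several votes, the resulting votes being denoted $V^{\Gamma}$. Swap Bribery for an election system $\mathcal{E}$: given an $\mathcal{E}$-election $(C,V)$, a preferred candidate $p\in C$, a cost function assigning to each possible swap in each vote a non-negative integer, and a budget $\beta\in\mathbb{N}$, decide whether there is an admissible set $\Gamma$ of swaps of total cost at most $\beta$ such that $p$ is a winner in the $\mathcal{E}$-election $(C,V^{\Gamma})$. Logarithms are to base $2$; arithmetic operations on costs are counted as single steps.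 -}

module Defs where

open import Algebra.Properties.Monoid.Sum
open import Data.Bool using (Bool; true; false; if_then_else_)
open import Data.Empty using (⊥)
open import Data.Fin using (Fin; toℕ)
open import Data.Fin.Permutation using (Permutation′; _⟨$⟩ʳ_; _⟨$⟩ˡ_; transpose; _∘ₚ_)
open import Data.List using (List; []; _∷_; _++_; map; concat; tabulate)
open import Data.List.Relation.Binary.Permutation.Propositional using (_↭_)
open import Data.List.Relation.Unary.Unique.Propositional using (Unique)
open import Data.Nat using (ℕ; zero; suc; _+_; _*_; _∸_; _^_; _≤_; _≤?_; _≟_)
open import Data.Nat.ListAction using () renaming (sum to sumᴸ)
open import Data.Nat.Properties using (+-0-monoid)
open import Data.Product using (Σ; ∃; _×_; _,_; proj₁; proj₂)
open import Data.Unit using (⊤)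
open import Data.Vec using (Vec; []; _∷_)
open import Function using (_⇔_; _∘_)
open import Relation.Binary.PropositionalEquality using (_≡_; _≢_)
open import Relation.Nullary using (does)

∑ : ∀ {n} → (Fin n → ℕ) → ℕ
∑ = sum +-0-monoid

------------------------------------------------------------------------
-- Elections

-- A strict linear order on the candidates Fin m, given by the bijection
-- sending each candidate (ʳ) to its position, counted from 0.
Vote : ℕ → Set
Vote m = Permutation′ m

rank : ∀ {m} → Fin m → Vote m → ℕ
rank c v = suc (toℕ (v ⟨$⟩ʳ c))

points : ∀ {m} → ℕ → Fin m → Vote m → ℕ
points k c v = if does (rank c v ≤? k) then 1 else 0

score : ∀ {n m} → ℕ → (Fin n → Vote m) → Fin m → ℕ
score k V c = ∑ λ i → points k c (V i)

Winner : ∀ {n m} → ℕ → (Fin n → Vote m) → Fin m → Set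
Winner k V p = ∀ c → score k V c ≤ score k V p

------------------------------------------------------------------------
-- Swaps

-- A swap (a , b) within a given vote.  Admissibility forces a ≢ b.
Swap : ℕ → Set
Swap m = Fin m × Fin m

Admissible : ∀ {m} → Swap m → Vote m → Set
Admissible (a , b) v = suc (rank a v) ≡ rank b v

applySwap : ∀ {m} → Swap m → Vote m → Vote m
applySwap (a , b) v = transpose a b ∘ₚ v

infix 4 _—[_]→_ _—⟨_⟩→_

data _—[_]→_ {m : ℕ} : Vote m → List (Swap m) → Vote m → Set where
  done : ∀ {v} → v —[ [] ]→ v
  next : ∀ {v w s ss} → Admissible s v → applySwap s v —[ ss ]→ w →
         v —[ s ∷ ss ]→ w

-- Finite sets of swaps: lists without repetition, whose order is ignored.
SwapSet : ℕ → Set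
SwapSet m = Σ (List (Swap m)) Unique

-- v —⟨ Γ ⟩→ w : Γ is admissible in v and w is v^Γ.
_—⟨_⟩→_ : ∀ {m} → Vote m → SwapSet m → Vote m → Set
v —⟨ Γ ⟩→ w = ∃ λ ss → ss ↭ proj₁ Γ × v —[ ss ]→ w

------------------------------------------------------------------------
-- Swap Bribery for k-approval

-- An instance with n votes and m candidates.  The values cost i a a do not
-- belong to any swap and are irrelevant.
record Instance (n m : ℕ) : Set where
  field
    votes : Fin n → Vote m
    p     : Fin m
    cost  : Fin n → Fin m → Fin m → ℕ
    β     : ℕ

module _ {n m : ℕ} (I : Instance n m) where
  open Instance I

  totalCost : (Fin n → SwapSet m) → ℕ
  totalCost Γ = ∑ λ i → sumᴸ (map (λ (a , b) → cost i a b) (proj₁ (Γ i)))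

  SwapBribery : ℕ → Set
  SwapBribery k =
    ∃ λ (Γ : Fin n → SwapSet m) → ∃ λ (W : Fin n → Vote m) →
      (∀ i → votes i —⟨ Γ i ⟩→ W i) × totalCost Γ ≤ β × Winner k W p

------------------------------------------------------------------------
-- Random access machines

-- A program is a fixed finite text, run on an infinite array of natural
-- numbers with indirect addressing.  Every command, and every evaluation of
-- a test, takes one step; expressions have a size fixed by the program, so
-- this differs from counting their operations only by a constant factor.
-- Multiplication is deliberately not an elementary operation: with unbounded
-- cells and unit cost it would make the machine unreasonably powerful.

Memory : Set
Memory = ℕ → ℕ

infixl 6 _⊕_ _⊖_

data Expr : Set where
  lit     : ℕ → Expr
  M[_]    : Expr → Expr
  _⊕_ _⊖_ : Expr → Expr → Expr

infix  5 M[_]≔_ M[_]≔coin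
infixr 4 _⨾_

data Program : Set where
  skip      : Program
  M[_]≔_    : Expr → Expr → Program
  M[_]≔coin : Expr → Program
  _⨾_       : Program → Program → Program
  ifnz      : Expr → Program → Program → Program
  whilenz   : Expr → Program → Program

Deterministic : Program → Set
Deterministic skip          = ⊤
Deterministic (M[ _ ]≔ _)   = ⊤
Deterministic M[ _ ]≔coin   = ⊥
Deterministic (P ⨾ Q)       = Deterministic P × Deterministic Q
Deterministic (ifnz _ P Q)  = Deterministic P × Deterministic Q
Deterministic (whilenz _ P) = Deterministic P

-- Subtraction is truncated at 0, so that x ⊖ y tests x > y.
eval : Expr → Memory → ℕ
eval (lit x)  μ = x
eval M[ e ]   μ = μ (eval e μ)
eval (e ⊕ f)  μ = eval e μ + eval f μ
eval (e ⊖ f)  μ = eval e μ ∸ eval f μ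

write : ℕ → ℕ → Memory → Memory
write a x μ j = if does (j ≟ a) then x else μ j

-- The programs still to be run, in order, and the current memory.
Config : Set
Config = List Program × Memory

-- The Boolean is a fresh fair coin, tossed at every step and ignored unless
-- the step is a coin assignment.
step : Bool → Config → Config
step c ([] , μ)                 = [] , μ
step c (skip ∷ K , μ)           = K , μ
step c ((M[ e ]≔ f) ∷ K , μ)    = K , write (eval e μ) (eval f μ) μ
step c (M[ e ]≔coin ∷ K , μ)    = K , write (eval e μ) (if c then 1 else 0) μ
step c ((P ⨾ Q) ∷ K , μ)        = P ∷ Q ∷ K , μ
step c (ifnz e P Q ∷ K , μ) with eval e μ
... | zero                      = Q ∷ K , μ
... | suc _                     = P ∷ K , μ
step c (whilenz e P ∷ K , μ) with eval e μ
... | zero                      = K , μ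
... | suc _                     = P ∷ whilenz e P ∷ K , μ

run : ∀ {t} → Vec Bool t → Config → Config
run []       s = s
run (c ∷ cs) s = run cs (step c s)

Halted : Config → Set
Halted (K , _) = K ≡ []

Accepting : Config → Set
Accepting (_ , μ) = μ 0 ≢ 0

-- The number of steps made before halting, cut off at t.
steps : ∀ {t} → Vec Bool t → Config → ℕ
steps []       s             = 0
steps (c ∷ cs) ([] , μ)      = 0
steps (c ∷ cs) (P ∷ K , μ)   = suc (steps cs (step c (P ∷ K , μ)))

∑coins : ∀ t → (Vec Bool t → ℕ) → ℕ
∑coins zero    f = f []
∑coins (suc t) f = ∑coins t (f ∘ (true ∷_)) + ∑coins t (f ∘ (false ∷_))

------------------------------------------------------------------------
-- Solving Swap Bribery on a machine

-- Each vote is listed from its best to its worst candidate.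
encode : ∀ {n m} → ℕ → Instance n m → List ℕ
encode {n} {m} k I =
  n ∷ m ∷ k ∷ toℕ p ∷ β ∷
  concat (tabulate λ i → tabulate λ r → toℕ (votes i ⟨$⟩ˡ r)) ++
  concat (tabulate λ i → concat (tabulate λ a → tabulate λ b → cost i a b))
  where open Instance I

load : List ℕ → Memory
load []       _       = 0
load (x ∷ xs) zero    = x
load (x ∷ xs) (suc j) = load xs j

module _ (P : Program) (k : ℕ) {n m : ℕ} (I : Instance n m) where

  start : Config
  start = P ∷ [] , load (encode k I)

  -- The answer is right whenever the program halts, whatever the coins.
  Correct : Set
  Correct = ∀ {t} (cs : Vec Bool t) → Halted (run cs start) →
            Accepting (run cs start) ⇔ SwapBribery I k

  HaltsWithin : ℕ → Set
  HaltsWithin t = ∀ (cs : Vec Bool t) → Halted (run cs start)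

  -- With T the running time, this says E[min(T , t)] ≤ B for all t, that is,
  -- E[T] ≤ B by monotone convergence; in particular the program halts with
  -- probability 1.  Each of the 2 ^ t coin sequences has probability 1 / 2 ^ t.
  ExpectedTime≤ : ℕ → Set
  ExpectedTime≤ B = ∀ t → ∑coins t (λ cs → steps cs start) ≤ B * 2 ^ t

-- 2^((log x + log y) · e) for real logarithms to base 2 and x , y ≥ 1.
2^[log_+log_]·_ : ℕ → ℕ → ℕ → ℕ
2^[log x +log y ]· e = (x * y) ^ e

-- One deterministic program of expected, and in fact worst-case, running time
-- 2^(nk) poly(nk) (nk)^(nk) m^(k+1) serves for both halves; the first two
-- factors are O((nk)^(nk)).
--
-- Making a set S of k candidates the approved ones in a vote costs exactly the
-- total cost of the pairs (a , b) with a ranked above b, a ∉ S and b ∈ S: each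
-- such pair must be swapped, and bubbling S to the top swaps no other.  So one
-- k-set per vote must be chosen, cheaply and with p winning.
--
-- The nk incidences (vote , candidate) of a solution are found one by one.
-- Among the candidates D = {p} ∪ {candidates found so far}, all but the last
-- have been assigned to all their votes.  If the last one is to be assigned to
-- a further vote, that vote is guessed.  Otherwise let i be any vote with fewer
-- than k candidates and S its cheapest k-set meeting D in exactly the
-- candidates assigned to i; S is found by enumerating all m^k tuples.  If some
-- member of S outside D is used by the solution in another vote, then the
-- member and a vote are guessed.  If not, S can replace the set of i in the
-- solution: a candidate outside D then has score at most 1, which p attains.
-- So every step is a guess of a vote (n choices) and of a member of S or "the
-- last candidate" (k + 1 choices), and (n (k + 1))^(nk) guesses suffice.

module Submission where

open import Defs
open import Data.Bool using (Bool; true; false; if_then_else_)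
open import Data.Empty using (⊥; ⊥-elim)
open import Data.Fin as Fin using (Fin; toℕ; fromℕ<; #_)
import Data.Fin.Properties as Fin
open import Data.Fin.Permutation using (_⟨$⟩ʳ_; _⟨$⟩ˡ_; inverseˡ; inverseʳ; flip)
open import Data.List using (List; []; _∷_; _++_; map; concat; tabulate; length; replicate)
open import Data.List.Properties using (length-++; length-tabulate)
open import Data.List.Relation.Binary.Permutation.Propositional using (↭-refl)
open import Data.List.Relation.Binary.Permutation.Propositional.Properties using (map⁺)
open import Data.List.Relation.Unary.All as All using (All; []; _∷_)
open import Data.List.Relation.Unary.AllPairs using ([]; _∷_)
open import Data.List.Relation.Unary.Unique.Propositional using (Unique)
open import Data.Nat
open import Data.Nat.Divisibility using (divides-refl; m∣m*n; n∣m*n)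
open import Data.Nat.DivMod
open import Data.Nat.ListAction using () renaming (sum to sumᴸ)
open import Data.Nat.ListAction.Properties using (sum-↭)
open import Data.Nat.Logarithm using (⌊log₂_⌋; ⌊log₂⌋-mono-≤; ⌊log₂[2^n]⌋≡n)
open import Data.Nat.Properties
open import Data.Nat.Solver using (module +-*-Solver)
open import Data.Product using (Σ; ∃; _×_; _,_; proj₁; proj₂)
open import Data.Sum using (_⊎_; inj₁; inj₂)
open import Data.Unit using (⊤; tt)
open import Data.Vec using (Vec; []; _∷_; lookup)
open import Function using (_∘_; id; _⇔_; mk⇔; Equivalence)
open import Relation.Binary.Definitions using (tri<; tri≈; tri>)
open import Relation.Binary.PropositionalEquality hiding (J)
open import Relation.Nullary using (does; yes; no; contradiction; ¬_; Dec)
open import Relation.Nullary.Decidable using (True; dec-true; dec-false; _×-dec_; ¬?)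
open import Algebra.Properties.CommutativeMonoid.Sum +-0-commutativeMonoid using (∑-comm; sum-permute)
open import Algebra.Properties.CommutativeSemigroup *-commutativeSemigroup using (interchange)
open import Algebra.Properties.CommutativeSemigroup +-commutativeSemigroup using () renaming (interchange to +-interchange)
open Equivalence using (to; from)

-- Machine runs

-- What shapes the development is the exponent k + 1 of m. The machine can neither multiply nor
-- divide, so reading a single digit in base m already takes time of order m; as all m^k tuples are
-- scanned, the work per tuple may contain just this one factor m, up to powers of n k. Hence the
-- cost of a k-set is not summed over pairs of positions, and the final check never runs through all
-- candidates. Counting steps of machine code by hand would be hopeless. The algorithm is therefore
-- written in a small language whose loop bounds are fixed before the search; its compiler is proved
-- correct once, and the running time becomes a monomial whose degrees in m, m^k, n^(nk) and (k +
-- 1)^(nk) are found by evaluation. The degree in n k may be anything, since it is absorbed later.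
-- Accepting is safe for any guesses, because the final check tests an actual choice of k-sets; the
-- exchange argument serves to show that some guesses are accepted.

walk : ℕ → Config → Config
walk zero    s = s
walk (suc t) s = walk t (step true s)

walk-+ : ∀ a b s → walk (a + b) s ≡ walk b (walk a s)
walk-+ zero    b s = refl
walk-+ (suc a) b s = walk-+ a b (step true s)

walk-halted : ∀ t μ → walk t ([] , μ) ≡ ([] , μ)
walk-halted zero    μ = refl
walk-halted (suc t) μ = walk-halted t μ

step-det : ∀ c K μ → All Deterministic K → step c (K , μ) ≡ step true (K , μ)
step-det c [] μ _ = refl
step-det c (skip ∷ K) μ _ = refl
step-det c ((M[ e ]≔ f) ∷ K) μ _ = refl
step-det c (M[ e ]≔coin ∷ K) μ (() ∷ _)
step-det c ((P ⨾ Q) ∷ K) μ _ = refl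
step-det c (ifnz e P Q ∷ K) μ _ with eval e μ
... | zero  = refl
... | suc _ = refl
step-det c (whilenz e P ∷ K) μ _ with eval e μ
... | zero  = refl
... | suc _ = refl

step-preserves : ∀ K μ → All Deterministic K → All Deterministic (proj₁ (step true (K , μ)))
step-preserves [] μ d = d
step-preserves (skip ∷ K) μ (_ ∷ d) = d
step-preserves ((M[ e ]≔ f) ∷ K) μ (_ ∷ d) = d
step-preserves (M[ e ]≔coin ∷ K) μ (() ∷ _)
step-preserves ((P ⨾ Q) ∷ K) μ ((p , q) ∷ d) = p ∷ q ∷ d
step-preserves (ifnz e P Q ∷ K) μ ((p , q) ∷ d) with eval e μ
... | zero  = q ∷ d
... | suc _ = p ∷ d
step-preserves (whilenz e P ∷ K) μ (p ∷ d) with eval e μ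
... | zero  = d
... | suc _ = p ∷ p ∷ d

-- Coins are read only by a coin assignment, which a deterministic program lacks; so it suffices to
-- follow the run in which every coin is `true`.
run-walk : ∀ {t} (cs : Vec Bool t) K μ → All Deterministic K → run cs (K , μ) ≡ walk t (K , μ)
run-walk []       K μ d = refl
run-walk (c ∷ cs) K μ d rewrite step-det c K μ d =
  run-walk cs _ _ (step-preserves K μ d)

walk-steps : ∀ {t} (cs : Vec Bool t) K μ T ν → All Deterministic K →
             walk T (K , μ) ≡ ([] , ν) → steps cs (K , μ) ≤ T
walk-steps [] K μ T ν d eq = z≤n
walk-steps (c ∷ cs) [] μ T ν d eq = z≤n
walk-steps (c ∷ cs) (P ∷ K) μ zero ν d ()
walk-steps (c ∷ cs) (P ∷ K) μ (suc T) ν d eq rewrite step-det c (P ∷ K) μ d =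
  s≤s (walk-steps cs _ _ T ν (step-preserves (P ∷ K) μ d) eq)

-- A Hoare triple with a time bound. `runs` holds for every continuation `K`, which lets triples be
-- chained under sequencing and inside loops.
record Exec (P : Program) (μ : Memory) (T : ℕ) (Q : Memory → Set) : Set where
  constructor exec
  field
    time  : ℕ
    final : Memory
    bound : time ≤ T
    runs  : ∀ K → walk time (P ∷ K , μ) ≡ (K , final)
    post  : Q final

exec-assign : ∀ {e f μ} {Q : Memory → Set} → Q (write (eval e μ) (eval f μ) μ) →
              Exec (M[ e ]≔ f) μ 1 Q
exec-assign q = exec 1 _ ≤-refl (λ K → refl) q

exec-seq : ∀ {P P′ μ T T′ Q} {Q′ : Memory → Set} → Exec P μ T Q →
           (∀ ν → Q ν → Exec P′ ν T′ Q′) → Exec (P ⨾ P′) μ (suc (T + T′)) Q′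
exec-seq {P} {P′} {μ} (exec t ν b r q) f with f ν q
... | exec t′ ν′ b′ r′ q′ = exec (suc (t + t′)) ν′ (s≤s (+-mono-≤ b b′))
  (λ K → trans (walk-+ t t′ (P ∷ P′ ∷ K , μ)) (trans (cong (walk t′) (r (P′ ∷ K))) (r′ K))) q′

exec-mono : ∀ {P μ T T′} {Q Q′ : Memory → Set} → T ≤ T′ → (∀ ν → Q ν → Q′ ν) →
            Exec P μ T Q → Exec P μ T′ Q′
exec-mono le f (exec t ν b r q) = exec t ν (≤-trans b le) r (f ν q)

step-if0 : ∀ e P Q K μ → eval e μ ≡ 0 → step true (ifnz e P Q ∷ K , μ) ≡ (Q ∷ K , μ)
step-if0 e P Q K μ eq rewrite eq = refl

step-if1 : ∀ e P Q K μ {x} → eval e μ ≡ suc x → step true (ifnz e P Q ∷ K , μ) ≡ (P ∷ K , μ)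
step-if1 e P Q K μ eq rewrite eq = refl

step-while0 : ∀ e P K μ → eval e μ ≡ 0 → step true (whilenz e P ∷ K , μ) ≡ (K , μ)
step-while0 e P K μ eq rewrite eq = refl

step-while1 : ∀ e P K μ {x} → eval e μ ≡ suc x →
              step true (whilenz e P ∷ K , μ) ≡ (P ∷ whilenz e P ∷ K , μ)
step-while1 e P K μ eq rewrite eq = refl

exec-if0 : ∀ {e P P′ μ T} {Q : Memory → Set} → eval e μ ≡ 0 → Exec P′ μ T Q →
           Exec (ifnz e P P′) μ (suc T) Q
exec-if0 {e} {P} {P′} {μ} eq (exec t ν b r q) = exec (suc t) ν (s≤s b)
  (λ K → trans (cong (walk t) (step-if0 e P P′ K μ eq)) (r K)) q

exec-if1 : ∀ {e P P′ μ T x} {Q : Memory → Set} → eval e μ ≡ suc x → Exec P μ T Q →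
           Exec (ifnz e P P′) μ (suc T) Q
exec-if1 {e} {P} {P′} {μ} eq (exec t ν b r q) = exec (suc t) ν (s≤s b)
  (λ K → trans (cong (walk t) (step-if1 e P P′ K μ eq)) (r K)) q

-- The invariant is indexed by the rounds made so far, and their number `L` is known in advance.
-- Each round pays one extra step for its test; the final `+ 1` is the failing test.
exec-while : ∀ {e P μ T} (Inv : ℕ → Memory → Set) L →
  (∀ i ν → i < L → Inv i ν → (∃ λ x → eval e ν ≡ suc x) × Exec P ν T (Inv (suc i))) →
  (∀ ν → Inv L ν → eval e ν ≡ 0) → Inv 0 μ →
  Exec (whilenz e P) μ (L * suc T + 1) (Inv L)
exec-while {e} {P} {μ} Inv zero body end inv =
  exec 1 μ ≤-refl (λ K → step-while0 e P K μ (end μ inv)) inv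
exec-while {e} {P} {μ} {T} Inv (suc L) body end inv with body 0 μ z<s inv
... | (x , eq) , exec t ν b r q
  with exec-while {e} {P} {ν} {T} (Inv ∘ suc) L (λ i ν′ lt → body (suc i) ν′ (s≤s lt)) end q
... | exec t′ ν′ b′ r′ q′ = exec (suc t + t′) ν′
  (≤-trans (+-mono-≤ (s≤s b) b′) (≤-reflexive (sym (+-assoc (suc T) (L * suc T) 1))))
  (λ K → trans (cong (walk (t + t′)) (step-while1 e P K μ eq))
         (trans (walk-+ t t′ (P ∷ whilenz e P ∷ K , μ))
         (trans (cong (walk t′) (r (whilenz e P ∷ K))) (r′ K)))) q′

write-same : ∀ a x μ {j} → j ≡ a → write a x μ j ≡ x
write-same a x μ refl rewrite dec-true (a ≟ a) refl = refl

write-other : ∀ a x μ {j} → j ≢ a → write a x μ j ≡ μ j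
write-other a x μ {j} ne rewrite dec-false (j ≟ a) ne = refl

-- The frame condition of compiled code: evaluating a term into a register touches no cell below
-- that register.
Same : ℕ → Memory → Memory → Set
Same a μ ν = ∀ j → j < a → ν j ≡ μ j

same-trans : ∀ {a μ ν ξ} → Same a μ ν → Same a ν ξ → Same a μ ξ
same-trans s s′ j lt = trans (s′ j lt) (s j lt)

same-≤ : ∀ {a b μ ν} → a ≤ b → Same b μ ν → Same a μ ν
same-≤ le s j lt = s j (<-≤-trans lt le)

same-write : ∀ {a b x} μ → a ≤ b → Same a μ (write b x μ)
same-write {a} {b} {x} μ le j lt = write-other b x μ (<⇒≢ (<-≤-trans lt le))

fold : ∀ {A : Set} → (ℕ → A → A) → A → ℕ → A
fold f a zero    = a
fold f a (suc i) = f i (fold f a i)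

-- A language of bounded loops and its compiler

data Glob : Set where
  gn gm gk gk1 gN gR gL gJ gnm gmm : Glob

-- The order matters: from register 3 on, each loop bound is computed from bounds with smaller
-- register numbers.
reg : Glob → ℕ
reg gn = 0
reg gm = 1
reg gk = 2
reg gk1 = 3
reg gN = 4
reg gR = 5
reg gL = 6
reg gJ = 7
reg gnm = 8
reg gmm = 9

reg<10 : ∀ g → reg g < 10
reg<10 gn = s≤s z≤n
reg<10 gm = s≤s (s≤s z≤n)
reg<10 gk = m≤m+n 3 7
reg<10 gk1 = m≤m+n 4 6
reg<10 gN = m≤m+n 5 5
reg<10 gR = m≤m+n 6 4
reg<10 gL = m≤m+n 7 3
reg<10 gJ = m≤m+n 8 2
reg<10 gnm = m≤m+n 9 1
reg<10 gmm = m≤m+n 10 0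

infixl 6 _⊞_ _⊟_

-- All loops run over the globals, so the running time of a term depends on
-- these alone.  In iter g p q f h r, the loop over i < g computes two
-- accumulators a, b from p, q by a ↦ f, b ↦ h, and r is the result; f and h see
-- a, b, i in front of the other variables, r sees a, b.
data Tm : ℕ → Set where
  var     : ∀ {d} → Fin d → Tm d
  nat     : ∀ {d} → ℕ → Tm d
  glob    : ∀ {d} → Glob → Tm d
  inp     : ∀ {d} → Tm d → Tm d
  _⊞_ _⊟_ : ∀ {d} → Tm d → Tm d → Tm d
  cond    : ∀ {d} → Tm d → Tm d → Tm d → Tm d
  call    : ∀ {d e} → Tm e → Vec (Tm d) e → Tm d
  iter    : ∀ {d} → Glob → Tm d → Tm d → Tm (3 + d) → Tm (3 + d) → Tm (2 + d) → Tm d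

ifz : {A : Set} → ℕ → A → A → A
ifz zero    a b = a
ifz (suc _) a b = b

module Sem (X : ℕ → ℕ) (G : Glob → ℕ) where
  ⟦_⟧  : ∀ {d} → Tm d → Vec ℕ d → ℕ
  ⟦_⟧* : ∀ {d e} → Vec (Tm d) e → Vec ℕ d → Vec ℕ e
  ⟦ var i ⟧ ρ = lookup ρ i
  ⟦ nat x ⟧ ρ = x
  ⟦ glob g ⟧ ρ = G g
  ⟦ inp s ⟧ ρ = X (⟦ s ⟧ ρ)
  ⟦ s ⊞ t ⟧ ρ = ⟦ s ⟧ ρ + ⟦ t ⟧ ρ
  ⟦ s ⊟ t ⟧ ρ = ⟦ s ⟧ ρ ∸ ⟦ t ⟧ ρ
  ⟦ cond c s t ⟧ ρ = ifz (⟦ c ⟧ ρ) (⟦ t ⟧ ρ) (⟦ s ⟧ ρ)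
  ⟦ call f ts ⟧ ρ = ⟦ f ⟧ (⟦ ts ⟧* ρ)
  ⟦ iter g p q f h r ⟧ ρ = ⟦ r ⟧ (proj₁ s ∷ proj₂ s ∷ ρ)
    where
    s : ℕ × ℕ
    s = fold (λ i ab → ⟦ f ⟧ (proj₁ ab ∷ proj₂ ab ∷ i ∷ ρ) , ⟦ h ⟧ (proj₁ ab ∷ proj₂ ab ∷ i ∷ ρ))
             (⟦ p ⟧ ρ , ⟦ q ⟧ ρ) (G g)
  ⟦ [] ⟧* ρ = []
  ⟦ t ∷ ts ⟧* ρ = ⟦ t ⟧ ρ ∷ ⟦ ts ⟧* ρ

module Cost (G : Glob → ℕ) where
  cost  : ∀ {d} → Tm d → ℕ
  cost* : ∀ {d e} → Vec (Tm d) e → ℕ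
  cost (var i) = 1
  cost (nat x) = 1
  cost (glob g) = 1
  cost (inp s) = cost s + 3
  cost (s ⊞ t) = cost s + (cost t + 3)
  cost (s ⊟ t) = cost s + (cost t + 3)
  cost (cond c s t) = cost c + (cost s + cost t + 2)
  cost (call f ts) = cost* ts + (cost f + 3)
  cost (iter g p q f h r) =
    cost p + (cost q + (G g * (cost f + (cost h + 8)) + (cost r + 8)))
  cost* [] = 1
  cost* (t ∷ ts) = cost t + (cost* ts + 1)

-- Cell 0 points to the registers, which lie behind the input.
addr : ℕ → Expr
addr r = M[ lit 0 ] ⊕ lit r

rd : ℕ → Expr
rd r = M[ addr r ]

infix 5 r[_]≔_
r[_]≔_ : ℕ → Expr → Program
r[ r ]≔ e = M[ addr r ]≔ e

infixr 5 _◂_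
_◂_ : ∀ {d} {A : Set} → A → (Fin d → A) → Fin (suc d) → A
(a ◂ f) Fin.zero    = a
(a ◂ f) (Fin.suc i) = f i

-- A stack discipline: the value goes to register x, the registers from x on are scratch, and `η`
-- locates the variables, always below x. A call puts its arguments into x, x + 1, ... and runs the
-- callee above them with these as its only variables.
compile  : ∀ {d} → (Fin d → ℕ) → ℕ → Tm d → Program
compile* : ∀ {d e} → (Fin d → ℕ) → ℕ → Vec (Tm d) e → Program
compile η x (var i) = r[ x ]≔ rd (η i)
compile η x (nat v) = r[ x ]≔ lit v
compile η x (glob g) = r[ x ]≔ rd (reg g)
compile η x (inp s) = compile η x s ⨾
  ifnz (M[ lit 0 ] ⊖ (lit 3 ⊕ rd x)) (r[ x ]≔ M[ lit 3 ⊕ rd x ]) (r[ x ]≔ lit 0)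
compile η x (s ⊞ t) = compile η x s ⨾ compile η (suc x) t ⨾ r[ x ]≔ rd x ⊕ rd (suc x)
compile η x (s ⊟ t) = compile η x s ⨾ compile η (suc x) t ⨾ r[ x ]≔ rd x ⊖ rd (suc x)
compile η x (cond c s t) = compile η x c ⨾ ifnz (rd x) (compile η x s) (compile η x t)
compile {d} η x (call {e = e} f ts) = compile* η x ts ⨾
  compile (λ i → x + Fin.toℕ i) (x + e) f ⨾ r[ x ]≔ rd (x + e)
compile η x (iter g p q f h r) =
  compile η x p ⨾ compile η (1 + x) q ⨾ r[ 2 + x ]≔ lit 0 ⨾
  whilenz (rd (reg g) ⊖ rd (2 + x))
    (compile η₃ (3 + x) f ⨾ compile η₃ (4 + x) h ⨾
     r[ x ]≔ rd (3 + x) ⨾ r[ 1 + x ]≔ rd (4 + x) ⨾ r[ 2 + x ]≔ rd (2 + x) ⊕ lit 1) ⨾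
  compile (x ◂ 1 + x ◂ η) (2 + x) r ⨾ r[ x ]≔ rd (2 + x)
  where η₃ = x ◂ 1 + x ◂ 2 + x ◂ η
compile* η x [] = skip
compile* η x (t ∷ ts) = compile η x t ⨾ compile* η (suc x) ts

compile-det  : ∀ {d} η x (t : Tm d) → Deterministic (compile η x t)
compile*-det : ∀ {d e} η x (ts : Vec (Tm d) e) → Deterministic (compile* η x ts)
compile-det η x (var i) = tt
compile-det η x (nat v) = tt
compile-det η x (glob g) = tt
compile-det η x (inp s) = compile-det η x s , tt , tt
compile-det η x (s ⊞ t) = compile-det η x s , compile-det η _ t , tt
compile-det η x (s ⊟ t) = compile-det η x s , compile-det η _ t , tt
compile-det η x (cond c s t) = compile-det η x c , compile-det η x s , compile-det η x t
compile-det η x (call f ts) = compile*-det η x ts , compile-det _ _ f , tt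
compile-det η x (iter g p q f h r) = compile-det η x p , compile-det η _ q , tt ,
  (compile-det _ _ f , compile-det _ _ h , tt , tt , tt) , compile-det _ _ r , tt
compile*-det η x [] = tt
compile*-det η x (t ∷ ts) = compile-det η x t , compile*-det η _ ts

-- X is the input from cell 3 on, as cells 0 to 2 are reused.
module Correctness (X : ℕ → ℕ) (G : Glob → ℕ) (base : ℕ) (base>0 : 0 < base)
                   (outside : ∀ j → base ≤ 3 + j → X j ≡ 0) where
  open Sem X G
  open Cost G

  -- All that a compiled term relies on lies below cell base + x (`fresh`, `large`), hence survives
  -- any code that writes only from there on.
  record Ok {d} (η : Fin d → ℕ) (x : ℕ) (ρ : Vec ℕ d) (μ : Memory) : Set where
    field
      pointer : μ 0 ≡ base
      input   : ∀ j → 3 + j < base → μ (3 + j) ≡ X j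
      globals : ∀ g → μ (base + reg g) ≡ G g
      locals  : ∀ i → μ (base + η i) ≡ lookup ρ i
      fresh   : ∀ i → η i < x
      large   : 10 ≤ x
  open Ok

  ok-same : ∀ {d η x ρ μ ν} → Ok {d} η x ρ μ → Same (base + x) μ ν → Ok η x ρ ν
  ok-same {x = x} o s = record
    { pointer = trans (s 0 (<-≤-trans base>0 (m≤m+n base x))) (pointer o)
    ; input   = λ j lt → trans (s (3 + j) (<-≤-trans lt (m≤m+n base x))) (input o j lt)
    ; globals = λ g → trans (s _ (+-monoʳ-< base (<-≤-trans (reg<10 g) (large o)))) (globals o g)
    ; locals  = λ i → trans (s _ (+-monoʳ-< base (fresh o i))) (locals o i)
    ; fresh   = fresh o
    ; large   = large o }

  ok-suc : ∀ {d η x ρ μ} → Ok {d} η x ρ μ → Ok η (suc x) ρ μ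
  ok-suc o = record
    { pointer = pointer o ; input = input o ; globals = globals o ; locals = locals o
    ; fresh = λ i → m≤n⇒m≤1+n (fresh o i) ; large = m≤n⇒m≤1+n (large o) }

  ok-push : ∀ {d η x ρ μ v} → Ok {d} η x ρ μ → ∀ {r} → r < x → μ (base + r) ≡ v →
            Ok (r ◂ η) x (v ∷ ρ) μ
  ok-push o lt eq = record
    { pointer = pointer o ; input = input o ; globals = globals o
    ; locals = λ { Fin.zero → eq ; (Fin.suc i) → locals o i }
    ; fresh = λ { Fin.zero → lt ; (Fin.suc i) → fresh o i } ; large = large o }

  Result : ℕ → ℕ → Memory → Memory → Set
  Result x v μ ν = Same (base + x) μ ν × ν (base + x) ≡ v

  Result* : ∀ {e} → ℕ → Vec ℕ e → Memory → Memory → Set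
  Result* x vs μ ν = Same (base + x) μ ν × (∀ i → ν (base + (x + Fin.toℕ i)) ≡ lookup vs i)

  rd-eq : ∀ {d η x ρ μ v} r → Ok {d} η x ρ μ → μ (base + r) ≡ v → eval (rd r) μ ≡ v
  rd-eq {μ = μ} r o eq = trans (cong (λ a → μ (a + r)) (pointer o)) eq

  set : ∀ {d η x ρ μ v} r {e} {Q : Memory → Set} → Ok {d} η x ρ μ → eval e μ ≡ v →
        Q (write (base + r) v μ) → Exec (r[ r ]≔ e) μ 1 Q
  set {μ = μ} {v} r {e} {Q} o eq q = exec-assign
    (subst₂ (λ a w → Q (write (a + r) w μ)) (sym (pointer o)) (sym eq) q)

  set-result : ∀ {d η x ρ μ v e} → Ok {d} η x ρ μ → eval e μ ≡ v →
               Exec (r[ x ]≔ e) μ 1 (Result x v μ)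
  set-result {x = x} {μ = μ} {v} o eq = set x {Q = Result x v μ} o eq
    (same-write μ ≤-refl , write-same (base + x) v μ refl)

  +suc : ∀ x → base + x < base + suc x
  +suc x = +-monoʳ-< base (n<1+n x)

  below : ∀ c x → base + x ≤ base + (c + x)
  below c x = +-monoʳ-≤ base (m≤n+m x c)

  binary : ∀ {d η x ρ μ P Q e v w u} → Ok {d} η x ρ μ → ∀ {S T} →
           Exec P μ S (Result x v μ) →
           (∀ ν → Ok η (suc x) ρ ν → Exec Q ν T (Result (suc x) w ν)) →
           (∀ ν → eval (rd x) ν ≡ v → eval (rd (suc x)) ν ≡ w → eval e ν ≡ u) →
           Exec (P ⨾ Q ⨾ r[ x ]≔ e) μ (S + (T + 3)) (Result x u μ)
  binary {x = x} {μ = μ} {P} {Q} {e} o {S} {T} p q comb =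
    exec-mono (≤-reflexive lem) (λ _ → id)
      (exec-seq p λ ν (s , a) → exec-seq (q ν (ok-suc (ok-same o s)))
        λ ξ (s′ , b) → exec-mono ≤-refl
          (λ _ (s″ , c) → same-trans s (same-trans (same-≤ (below 1 x) s′) s″) , c)
          (let o′ = ok-same (ok-same o s) (same-≤ (below 1 x) s′) in
           set-result {e = e} o′ (comb ξ (rd-eq x o′ (trans (s′ _ (+suc x)) a)) (rd-eq (suc x) o′ b))))
    where
    lem : suc (S + suc (T + 1)) ≡ S + (T + 3)
    lem = trans (cong suc (+-suc S (T + 1))) (sym (trans (cong (S +_) (trans (+-suc T 2) (cong suc (+-suc T 1))))
            (trans (+-suc S _) (cong suc (+-suc S _)))))

  compile-ok  : ∀ {d η x ρ μ} (t : Tm d) → Ok η x ρ μ →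
                Exec (compile η x t) μ (cost t) (Result x (⟦ t ⟧ ρ) μ)
  compile*-ok : ∀ {d e η x ρ μ} (ts : Vec (Tm d) e) → Ok η x ρ μ →
                Exec (compile* η x ts) μ (cost* ts) (Result* x (⟦ ts ⟧* ρ) μ)

  compile-ok {η = η} (var i) o = set-result o (rd-eq (η i) o (locals o i))
  compile-ok (nat v) o = set-result {e = lit v} o refl
  compile-ok (glob g) o = set-result o (rd-eq (reg g) o (globals o g))
  compile-ok {η = η} {x} {ρ} {μ} (inp s) o =
    exec-mono (≤-reflexive (sym (+-suc (cost s) 2))) (λ _ → id)
      (exec-seq (compile-ok s o) λ ν (sm , a) → reading ν sm a (ok-same o sm))
    where
    v = ⟦ s ⟧ ρ
    guard = M[ lit 0 ] ⊖ (lit 3 ⊕ rd x)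
    guard-eq : ∀ ν → Ok η x ρ ν → ν (base + x) ≡ v → eval guard ν ≡ base ∸ (3 + v)
    guard-eq ν o′ a = cong₂ (λ p q → p ∸ (3 + q)) (pointer o′) (rd-eq x o′ a)
    reading : ∀ ν → Same (base + x) μ ν → ν (base + x) ≡ v → Ok η x ρ ν →
              Exec (ifnz guard (r[ x ]≔ M[ lit 3 ⊕ rd x ]) (r[ x ]≔ lit 0)) ν 2
                   (Result x (X v) μ)
    -- From `base` on the machine would read its own registers, so the guard answers 0 there, in
    -- agreement with `outside`.
    reading ν sm a o′ with (3 + v) <? base
    ... | yes lt = exec-if1 (trans (guard-eq ν o′ a)
            (sym (suc-pred (base ∸ (3 + v)) {{>-nonZero (m<n⇒0<n∸m lt)}})))
          (exec-mono ≤-refl (λ _ (s′ , b) → same-trans sm s′ , b)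
            (set-result {e = M[ lit 3 ⊕ rd x ]} o′
              (trans (cong (λ a → ν (3 + a)) (rd-eq x o′ a)) (input o′ v lt))))
    ... | no ge = exec-if0 (trans (guard-eq ν o′ a) (m≤n⇒m∸n≡0 (≮⇒≥ ge)))
          (exec-mono ≤-refl (λ _ (s′ , b) → same-trans sm s′ , b)
            (set-result {e = lit 0} o′ (sym (outside v (≮⇒≥ ge)))))
  compile-ok (s ⊞ t) o = binary o (compile-ok s o) (λ ν → compile-ok t) (λ ν → cong₂ _+_)
  compile-ok (s ⊟ t) o = binary o (compile-ok s o) (λ ν → compile-ok t) (λ ν → cong₂ _∸_)
  compile-ok {η = η} {x} {ρ} {μ} (cond c s t) o =
    exec-mono (≤-trans (≤-reflexive (sym (+-suc (cost c) _)))
                (+-monoʳ-≤ (cost c) (≤-reflexive (sym (+-comm _ 2))))) (λ _ → id)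
      (exec-seq (compile-ok c o) λ ν (sm , a) → branch ν sm (ok-same o sm) _ refl a)
    where
    branch : ∀ ν → Same (base + x) μ ν → Ok η x ρ ν → ∀ v → v ≡ ⟦ c ⟧ ρ → ν (base + x) ≡ v →
             Exec (ifnz (rd x) (compile η x s) (compile η x t)) ν (suc (cost s + cost t))
                  (Result x (⟦ cond c s t ⟧ ρ) μ)
    branch ν sm o′ zero veq a rewrite sym veq = exec-if0 (rd-eq x o′ a)
      (exec-mono (m≤n+m _ (cost s)) (λ _ (s′ , b) → same-trans sm s′ , b) (compile-ok t o′))
    branch ν sm o′ (suc v) veq a rewrite sym veq = exec-if1 (rd-eq x o′ a)
      (exec-mono (m≤m+n _ (cost t)) (λ _ (s′ , b) → same-trans sm s′ , b) (compile-ok s o′))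
  compile-ok {η = η} {x} {ρ} {μ} (call {e = e} f ts) o =
    exec-mono (≤-reflexive lem) (λ _ → id)
      (exec-seq (compile*-ok ts o) λ ν (s , a) →
        let o₁ = ok-same o s
            of : Ok (λ i → x + Fin.toℕ i) (x + e) (⟦ ts ⟧* ρ) ν
            of = record { pointer = pointer o₁ ; input = input o₁ ; globals = globals o₁ ; locals = a
                        ; fresh = λ i → +-monoʳ-< x (Fin.toℕ<n i) ; large = ≤-trans (large o) (m≤m+n x e) }
        in exec-seq (compile-ok f of) λ ξ (s′ , b) →
        let s″ = same-≤ (+-monoʳ-≤ base (m≤m+n x e)) s′
            o₂ = ok-same o₁ s″
        in exec-mono ≤-refl (λ _ (s‴ , c) → same-trans s (same-trans s″ s‴) , c)
             (set-result o₂ (rd-eq (x + e) o₂ b)))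
    where
    lem : suc (cost* ts + suc (cost f + 1)) ≡ cost* ts + (cost f + 3)
    lem = trans (sym (+-suc (cost* ts) _)) (cong (cost* ts +_)
            (sym (trans (+-suc (cost f) 2) (cong suc (+-suc (cost f) 1)))))
  compile-ok {η = η} {x} {ρ} {μ} (iter g p q f h r) o =
    exec-mono (≤-reflexive lem) (λ _ → id)
    (exec-seq (compile-ok p o) λ μ₁ (s₁ , a₁) →
     let o₁ = ok-suc (ok-same o s₁) in
     exec-seq (compile-ok q o₁) λ μ₂ (s₂ , b₂) →
     let o₂ = ok-suc (ok-same o₁ s₂)
         a₂ = trans (s₂ _ (+suc x)) a₁
         t₂ = same-trans s₁ (same-≤ (below 1 x) s₂) in
     exec-seq (set-result {e = lit 0} o₂ refl) λ μ₃ (s₃ , c₃) →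
     exec-seq (exec-while Inv (G g) body stop
                (same-trans t₂ (same-≤ (below 2 x) s₃) ,
                 trans (s₃ _ (+-monoʳ-< base (m≤n+m (suc x) 1))) a₂ ,
                 trans (s₃ _ (+suc (suc x))) b₂ , c₃)) λ μ₄ (s₄ , a₄ , b₄ , c₄) →
     let o₄ = ok-suc (ok-suc (ok-same o s₄))
         oᵣ = ok-push (ok-push o₄ (n<1+n (suc x)) b₄) (m≤n+m (suc x) 1) a₄ in
     exec-seq (compile-ok r oᵣ) λ μ₅ (s₅ , d₅) →
     let t₅ = same-trans s₄ (same-≤ (below 2 x) s₅)
         o₅ = ok-same o t₅ in
     exec-mono ≤-refl (λ _ (s₆ , e₆) → same-trans t₅ s₆ , e₆)
       (set-result o₅ (rd-eq (2 + x) o₅ d₅)))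
    where
    η₃ : Fin _ → ℕ
    η₃ = x ◂ 1 + x ◂ 2 + x ◂ η
    st : ℕ → ℕ × ℕ
    st = fold (λ i ab → ⟦ f ⟧ (proj₁ ab ∷ proj₂ ab ∷ i ∷ ρ) , ⟦ h ⟧ (proj₁ ab ∷ proj₂ ab ∷ i ∷ ρ))
              (⟦ p ⟧ ρ , ⟦ q ⟧ ρ)
    T : ℕ
    T = cost f + (cost h + 7)
    lem : suc (cost p + suc (cost q + suc (1 + suc ((G g * suc T + 1) + suc (cost r + 1))))) ≡
          cost p + (cost q + (G g * (cost f + (cost h + 8)) + (cost r + 8)))
    lem rewrite sym (+-suc (cost f) (cost h + 7)) | sym (+-suc (cost h) 7) =
      solve 4 (λ a b c d → con 1 :+ (a :+ (con 1 :+ (b :+ (con 1 :+ (con 1 :+ (con 1 :+ ((c :+ con 1) :+ (con 1 :+ (d :+ con 1)))))))))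
                        := a :+ (b :+ (c :+ (d :+ con 8)))) refl (cost p) (cost q) _ (cost r)
      where open +-*-Solver
    -- Registers x, 1 + x and 2 + x hold the two accumulators and the counter. Both new accumulator
    -- values are computed above them before either is overwritten.
    Inv : ℕ → Memory → Set
    Inv i ν = Same (base + x) μ ν × ν (base + x) ≡ proj₁ (st i) ×
              ν (base + suc x) ≡ proj₂ (st i) × ν (base + (2 + x)) ≡ i
    cond-eq : ∀ i ν → Inv i ν → eval (rd (reg g) ⊖ rd (2 + x)) ν ≡ G g ∸ i
    cond-eq i ν (s , _ , _ , c) = let o′ = ok-same o s in
      cong₂ _∸_ (rd-eq (reg g) o′ (globals o′ g)) (rd-eq (2 + x) o′ c)
    stop : ∀ ν → Inv (G g) ν → eval (rd (reg g) ⊖ rd (2 + x)) ν ≡ 0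
    stop ν iv = trans (cond-eq (G g) ν iv) (n∸n≡0 (G g))
    body : ∀ i ν → i < G g → Inv i ν →
           (∃ λ y → eval (rd (reg g) ⊖ rd (2 + x)) ν ≡ suc y) ×
           Exec (compile η₃ (3 + x) f ⨾ compile η₃ (4 + x) h ⨾
                 r[ x ]≔ rd (3 + x) ⨾ r[ 1 + x ]≔ rd (4 + x) ⨾ r[ 2 + x ]≔ rd (2 + x) ⊕ lit 1)
                ν T (Inv (suc i))
    body i ν lt iv@(s , a , b , c) =
      (_ , trans (cond-eq i ν iv) (sym (suc-pred (G g ∸ i) {{>-nonZero (m<n⇒0<n∸m lt)}}))) ,
      exec-mono (≤-reflexive lem′) (λ _ → id)
      (exec-seq (compile-ok f o₃) λ ν₁ (s₁ , a₁) →
       let o₄ = ok-suc (ok-same o₃ s₁) in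
       exec-seq (compile-ok h o₄) λ ν₂ (s₂ , b₂) →
       let t₂ = same-trans s₁ (same-≤ (below 1 (3 + x)) s₂)
           o₅ = ok-same o₃ t₂
           a₂ = trans (s₂ _ (+suc (3 + x))) a₁
           c₂ = trans (t₂ _ (+suc (2 + x))) c in
       exec-seq (set x {Q = λ ξ → ξ ≡ write (base + x) (proj₁ (st (suc i))) ν₂} o₅ (rd-eq (3 + x) o₅ a₂) refl)
       λ { ν₃ refl →
       let u₃ = same-write {a = base + x} {b = base + x} {x = proj₁ (st (suc i))} ν₂ ≤-refl
           o₆ = ok-same (ok-same o (same-trans s (same-≤ (below 3 x) t₂))) u₃
           ne : ∀ {j k} → j ≢ k → base + j ≢ base + k
           ne j≢k eq = j≢k (+-cancelˡ-≡ base _ _ eq)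
           up : ∀ c → suc c + x ≢ x
           up c = m≢1+n+m x ∘ sym
       in
       exec-seq (set (suc x) {Q = λ ξ → ξ ≡ write (base + suc x) (proj₂ (st (suc i))) ν₃} o₆
                  (rd-eq (4 + x) o₆ (trans (write-other _ _ ν₂ (ne (up 3))) b₂)) refl)
       λ { ν₄ refl →
       let u₄ = same-write {a = base + x} {b = base + suc x} {x = proj₂ (st (suc i))} ν₃ (below 1 x)
           o₇ = ok-same o₆ u₄
           c₄ = trans (write-other _ _ ν₃ (ne (up 0 ∘ suc-injective))) (trans (write-other _ _ ν₂ (ne (up 1))) c₂)
       in
       set (2 + x) {Q = Inv (suc i)} o₇
         (trans (cong (_+ 1) (rd-eq (2 + x) o₇ c₄)) (+-comm i 1))
         ( same-trans s (same-trans (same-≤ (below 3 x) t₂) (same-trans u₃ (same-trans u₄ (same-write ν₄ (below 2 x)))))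
         , trans (write-other _ _ ν₄ (ne (up 1 ∘ sym))) (trans (write-other _ _ ν₃ (ne (up 0 ∘ sym))) (write-same (base + x) _ ν₂ refl))
         , trans (write-other _ _ ν₄ (ne (up 0 ∘ sym ∘ suc-injective))) (write-same (base + suc x) _ ν₃ refl)
         , write-same (base + (2 + x)) _ ν₄ refl) } })
      where
      oν = ok-suc (ok-suc (ok-suc (ok-same o s)))
      o₃ : Ok η₃ (3 + x) (proj₁ (st i) ∷ proj₂ (st i) ∷ i ∷ ρ) ν
      o₃ = ok-push (ok-push (ok-push oν (n<1+n (2 + x)) c) (m≤n+m (2 + x) 1) b) (m≤n+m (1 + x) 2) a
      lem′ : suc (cost f + suc (cost h + suc (1 + suc (1 + 1)))) ≡ T
      lem′ = solve 2 (λ a b → con 1 :+ (a :+ (con 1 :+ (b :+ con 5))) := a :+ (b :+ con 7)) refl (cost f) (cost h)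
        where open +-*-Solver
  compile*-ok {x = x} [] o = exec 1 _ ≤-refl (λ K → refl) ((λ j lt → refl) , λ ())
  compile*-ok {x = x} {ρ} {μ} (t ∷ ts) o =
    exec-mono (≤-reflexive (trans (sym (+-suc (cost t) _)) (cong (cost t +_) (+-comm 1 _)))) (λ _ → id)
      (exec-seq (compile-ok t o) λ ν (s , a) →
       exec-mono ≤-refl (λ ξ (s′ , b) →
         same-trans s (same-≤ (below 1 x) s′) ,
         λ { Fin.zero → trans (cong (λ y → ξ (base + y)) (+-identityʳ x)) (trans (s′ _ (+suc x)) a)
           ; (Fin.suc i) → trans (cong (λ y → ξ (base + y)) (+-suc x (Fin.toℕ i))) (b i) })
         (compile*-ok ts (ok-suc (ok-same o s))))

-- Bounds on costs

-- coef · N^degN · m^degm · R^degR · L^degL · J^degJ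
record Bound : Set where
  constructor bnd
  field coef degN degm degR degL degJ : ℕ
open Bound

infixl 6 _⊕ᵇ_
infixl 7 _⊗ᵇ_

-- A sum takes the larger of each pair of degrees: all five quantities are positive, so raising a
-- degree never lowers a monomial.
_⊕ᵇ_ _⊗ᵇ_ : Bound → Bound → Bound
bnd c a b r l j ⊕ᵇ bnd c′ a′ b′ r′ l′ j′ =
  bnd (c + c′) (a ⊔ a′) (b ⊔ b′) (r ⊔ r′) (l ⊔ l′) (j ⊔ j′)
bnd c a b r l j ⊗ᵇ bnd c′ a′ b′ r′ l′ j′ =
  bnd (c * c′) (a + a′) (b + b′) (r + r′) (l + l′) (j + j′)

const : ℕ → Bound
const c = bnd c 0 0 0 0 0

-- n, k and k + 1 are coarsely bounded by multiples of N = n k, whose degree is absorbed in the end;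
-- m, m^k and the two numbers of guesses are kept exact.
globBound : Glob → Bound
globBound gn  = bnd 1 1 0 0 0 0
globBound gm  = bnd 1 0 1 0 0 0
globBound gk  = bnd 1 1 0 0 0 0
globBound gk1 = bnd 2 1 0 0 0 0
globBound gN  = bnd 1 1 0 0 0 0
globBound gR  = bnd 1 0 0 1 0 0
globBound gL  = bnd 1 0 0 0 1 0
globBound gJ  = bnd 1 0 0 0 0 1
globBound gnm = bnd 1 1 1 0 0 0
globBound gmm = bnd 1 0 2 0 0 0

costBound  : ∀ {d} → Tm d → Bound
costBound* : ∀ {d e} → Vec (Tm d) e → Bound
costBound (var i) = const 1
costBound (nat x) = const 1
costBound (glob g) = const 1
costBound (inp s) = costBound s ⊕ᵇ const 3
costBound (s ⊞ t) = costBound s ⊕ᵇ (costBound t ⊕ᵇ const 3)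
costBound (s ⊟ t) = costBound s ⊕ᵇ (costBound t ⊕ᵇ const 3)
costBound (cond c s t) = costBound c ⊕ᵇ (costBound s ⊕ᵇ costBound t ⊕ᵇ const 2)
costBound (call f ts) = costBound* ts ⊕ᵇ (costBound f ⊕ᵇ const 3)
costBound (iter g p q f h r) = costBound p ⊕ᵇ (costBound q ⊕ᵇ
  (globBound g ⊗ᵇ (costBound f ⊕ᵇ (costBound h ⊕ᵇ const 8)) ⊕ᵇ (costBound r ⊕ᵇ const 8)))
costBound* [] = const 1
costBound* (t ∷ ts) = costBound t ⊕ᵇ (costBound* ts ⊕ᵇ const 1)

module Monomials (N m R L J : ℕ) {{_ : NonZero N}} {{_ : NonZero m}} {{_ : NonZero R}}
                 {{_ : NonZero L}} {{_ : NonZero J}} where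

  monomial : ℕ → ℕ → ℕ → ℕ → ℕ → ℕ
  monomial a b r l j = N ^ a * (m ^ b * (R ^ r * (L ^ l * J ^ j)))

  value : Bound → ℕ
  value (bnd c a b r l j) = c * monomial a b r l j

  monomial-mono : ∀ {a b r l j a′ b′ r′ l′ j′} → a ≤ a′ → b ≤ b′ → r ≤ r′ → l ≤ l′ → j ≤ j′ →
                  monomial a b r l j ≤ monomial a′ b′ r′ l′ j′
  monomial-mono p q s t u = *-mono-≤ (^-monoʳ-≤ N p) (*-mono-≤ (^-monoʳ-≤ m q)
    (*-mono-≤ (^-monoʳ-≤ R s) (*-mono-≤ (^-monoʳ-≤ L t) (^-monoʳ-≤ J u))))

  monomial-+ : ∀ a b r l j a′ b′ r′ l′ j′ → monomial a b r l j * monomial a′ b′ r′ l′ j′ ≡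
               monomial (a + a′) (b + b′) (r + r′) (l + l′) (j + j′)
  monomial-+ a b r l j a′ b′ r′ l′ j′
    rewrite ^-distribˡ-+-* N a a′ | ^-distribˡ-+-* m b b′ | ^-distribˡ-+-* R r r′
          | ^-distribˡ-+-* L l l′ | ^-distribˡ-+-* J j j′ =
    trans (interchange (N ^ a) _ (N ^ a′) _) (cong (N ^ a * N ^ a′ *_)
    (trans (interchange (m ^ b) _ (m ^ b′) _) (cong (m ^ b * m ^ b′ *_)
    (trans (interchange (R ^ r) _ (R ^ r′) _) (cong (R ^ r * R ^ r′ *_)
    (interchange (L ^ l) _ (L ^ l′) _))))))

  value-⊕ : ∀ x y → value x + value y ≤ value (x ⊕ᵇ y)
  value-⊕ (bnd c a b r l j) (bnd c′ a′ b′ r′ l′ j′) = begin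
    c * monomial a b r l j + c′ * monomial a′ b′ r′ l′ j′
      ≤⟨ +-mono-≤ (*-monoʳ-≤ c (monomial-mono (m≤m⊔n a a′) (m≤m⊔n b b′) (m≤m⊔n r r′) (m≤m⊔n l l′) (m≤m⊔n j j′)))
                  (*-monoʳ-≤ c′ (monomial-mono (m≤n⊔m a a′) (m≤n⊔m b b′) (m≤n⊔m r r′) (m≤n⊔m l l′) (m≤n⊔m j j′))) ⟩
    c * M + c′ * M
      ≡⟨ *-distribʳ-+ M c c′ ⟨
    (c + c′) * M ∎
    where
    open ≤-Reasoning
    M = monomial (a ⊔ a′) (b ⊔ b′) (r ⊔ r′) (l ⊔ l′) (j ⊔ j′)

  value-⊗ : ∀ x y → value x * value y ≡ value (x ⊗ᵇ y)
  value-⊗ (bnd c a b r l j) (bnd c′ a′ b′ r′ l′ j′) =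
    trans (interchange c _ c′ _) (cong (c * c′ *_) (monomial-+ a b r l j a′ b′ r′ l′ j′))

  -- A record instead of a plain inequality: the bound x stays visible to unification, which could
  -- not recover it from `value x`.
  record _≼_ (p : ℕ) (x : Bound) : Set where
    constructor ≼-intro
    field ≼-elim : p ≤ value x
  open _≼_ public

  ≼-const : ∀ c → c ≼ const c
  ≼-const c = ≼-intro (≤-reflexive (sym (*-identityʳ c)))

  infixr 5 _≼+_
  _≼+_ : ∀ {p q x y} → p ≼ x → q ≼ y → (p + q) ≼ (x ⊕ᵇ y)
  _≼+_ {x = x} {y} (≼-intro u) (≼-intro v) = ≼-intro (≤-trans (+-mono-≤ u v) (value-⊕ x y))

  _≼*_ : ∀ {p q x y} → p ≼ x → q ≼ y → (p * q) ≼ (x ⊗ᵇ y)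
  _≼*_ {x = x} {y} (≼-intro u) (≼-intro v) =
    ≼-intro (≤-trans (*-mono-≤ u v) (≤-reflexive (value-⊗ x y)))

  module _ (G : Glob → ℕ) (G≼ : ∀ g → G g ≼ globBound g) where
    open Cost G

    cost≼  : ∀ {d} (t : Tm d) → cost t ≼ costBound t
    cost*≼ : ∀ {d e} (ts : Vec (Tm d) e) → cost* ts ≼ costBound* ts
    cost≼ (var i) = ≼-const 1
    cost≼ (nat x) = ≼-const 1
    cost≼ (glob g) = ≼-const 1
    cost≼ (inp s) = cost≼ s ≼+ ≼-const 3
    cost≼ (s ⊞ t) = cost≼ s ≼+ cost≼ t ≼+ ≼-const 3
    cost≼ (s ⊟ t) = cost≼ s ≼+ cost≼ t ≼+ ≼-const 3
    cost≼ (cond c s t) = cost≼ c ≼+ ((cost≼ s ≼+ cost≼ t) ≼+ ≼-const 2)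
    cost≼ (call f ts) = cost*≼ ts ≼+ cost≼ f ≼+ ≼-const 3
    cost≼ (iter g p q f h r) = cost≼ p ≼+ cost≼ q ≼+
      ((G≼ g ≼* (cost≼ f ≼+ cost≼ h ≼+ ≼-const 8)) ≼+ (cost≼ r ≼+ ≼-const 8))
    cost*≼ [] = ≼-const 1
    cost*≼ (t ∷ ts) = cost≼ t ≼+ cost*≼ ts ≼+ ≼-const 1

-- The algorithm

arg : ∀ i {d} {i<d : True (i <? d)} → Tm d
arg i {i<d = i<d} = var (#_ i {m<n = i<d})

sumT allT anyT : ∀ {d} → Glob → Tm (3 + d) → Tm d
sumT g b = iter g (nat 0) (nat 0) (arg 0 ⊞ b) (nat 0) (arg 0)
allT g b = iter g (nat 1) (nat 0) (cond b (arg 0) (nat 0)) (nat 0) (arg 0)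
anyT g b = iter g (nat 0) (nat 0) (cond b (nat 1) (arg 0)) (nat 0) (arg 0)

andT orT impT ltT leT eqT : ∀ {d} → Tm d → Tm d → Tm d
andT s t = cond s t (nat 0)
orT s t = cond s (nat 1) t
impT s t = cond s t (nat 1)
ltT s t = t ⊟ s
leT s t = nat 1 ⊞ t ⊟ s
eqT s t = nat 1 ⊟ ((s ⊟ t) ⊞ (t ⊟ s))

notT : ∀ {d} → Tm d → Tm d
notT s = nat 1 ⊟ s

opaque
  mulT : Glob → Tm 1
  mulT g = sumT g (arg 3)

  powT : Glob → Glob → Tm 1
  powT b J = iter J (nat 1) (nat 0) (cond (ltT (arg 2) (arg 3)) (call (mulT b) (arg 0 ∷ [])) (arg 0)) (nat 0) (arg 0)

  -- At most b subtractions are made, which is right for dividends below b * P and costs a single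
  -- loop over b.
  remT quoT : Glob → Tm 2
  remT b = iter b (arg 0) (nat 0) (cond (leT (arg 4) (arg 0)) (arg 0 ⊟ arg 4) (arg 0)) (nat 0) (arg 0)
  quoT b = iter b (arg 0) (nat 0) (cond (leT (arg 4) (arg 0)) (arg 0 ⊟ arg 4) (arg 0))
                                (cond (leT (arg 4) (arg 0)) (nat 1 ⊞ arg 1) (arg 1)) (arg 1)

  -- From the top digit downwards, so that each remainder needs few subtractions.
  truncT : Glob → Glob → Tm 2
  truncT b J = iter J (arg 0) (nat 0)
    (cond (ltT (arg 4) (glob J ⊟ nat 1 ⊟ arg 2))
      (call (remT b) (arg 0 ∷ call (powT b J) (glob J ⊟ nat 1 ⊟ arg 2 ∷ []) ∷ [])) (arg 0)) (nat 0) (arg 0)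

  digT : Glob → Glob → Tm 2
  digT b J = call (quoT b) (call (truncT b J) (arg 0 ∷ arg 1 ∷ []) ∷ call (powT b J) (arg 1 ∷ []) ∷ [])

  -- Unlike in `mulT`, both factors are known only during the run, the first one being at most the
  -- loop bound; later rounds add 0.
  timesT : Glob → Tm 2
  timesT g = sumT g (cond (ltT (arg 2) (arg 3)) (arg 4) (nat 0))

posT LT YT JT : Tm 2
posT = digT gm gk
LT   = digT gn gN
YT   = digT gm gN
JT   = digT gk1 gN

opaque
  candT : Tm 2
  -- Index 0 of the input is cell 3, so p, the budget and the votes start at indices 0, 1 and 2.
  candT = inp (nat 2 ⊞ call (timesT gn) (arg 0 ∷ glob gm ∷ []) ⊞ arg 1)

-- As a * m is not available in constant time, the multiples of m are tabulated
-- behind the input.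
opaque
  costT : Tm 3
  costT = inp (nat 2 ⊞ glob gnm ⊞ call (timesT gn) (arg 0 ∷ glob gmm ∷ [])
               ⊞ inp (nat 2 ⊞ glob gnm ⊞ call (timesT gn) (glob gn ∷ glob gmm ∷ []) ⊞ arg 1) ⊞ arg 2)

opaque
  upT : Tm 3
  upT = sumT gm (cond (ltT (arg 2) (arg 4)) (call costT (arg 3 ∷ call candT (arg 3 ∷ arg 2 ∷ []) ∷ arg 5 ∷ [])) (nat 0))

opaque
  upAtT : Tm 2
  upAtT = call upT (arg 0 ∷ arg 1 ∷ call candT (arg 0 ∷ arg 1 ∷ []) ∷ [])

opaque
  pairT : Tm 3
  pairT = cond (ltT (arg 1) (arg 2))
    (call costT (arg 0 ∷ call candT (arg 0 ∷ arg 1 ∷ []) ∷ call candT (arg 0 ∷ arg 2 ∷ []) ∷ [])) (nat 0)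

opaque
  -- A direct sum over pairs of positions would nest two loops over m. Lifting every member past
  -- everything above it, minus the costs within the set, needs one such loop beside loops over k.
  phiT : Tm 2
  phiT = sumT gk (call upAtT (arg 3 ∷ call posT (arg 4 ∷ arg 2 ∷ []) ∷ []))
    ⊟ sumT gk (sumT gk (call pairT (arg 6 ∷ call posT (arg 7 ∷ arg 2 ∷ []) ∷ call posT (arg 7 ∷ arg 5 ∷ []) ∷ [])))

-- From here on, i and l are votes, c is a candidate and x codes, in base m, a
-- k-tuple of positions in a vote.  The u-th incidence found so far, u < t,
-- consists of digit u of sL (base n) and digit u of sY (base m).
opaque
  elemT : Tm 3
  elemT = anyT gk (eqT (call candT (arg 3 ∷ call posT (arg 4 ∷ arg 2 ∷ []) ∷ [])) (arg 5))

opaque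
  distinctT : Tm 1
  distinctT = allT gk (allT gk (orT (eqT (arg 5) (arg 2))
    (notT (eqT (call posT (arg 6 ∷ arg 5 ∷ [])) (call posT (arg 6 ∷ arg 2 ∷ []))))))

opaque
  entryT : Tm 5
  entryT = anyT gN (andT (ltT (arg 2) (arg 7)) (andT (eqT (call LT (arg 5 ∷ arg 2 ∷ [])) (arg 3))
                                                 (eqT (call YT (arg 6 ∷ arg 2 ∷ [])) (arg 4))))

opaque
  knownT : Tm 3
  knownT = orT (eqT (arg 0) (inp (nat 0)))
    (anyT gN (andT (ltT (arg 2) (arg 5)) (eqT (call YT (arg 4 ∷ arg 2 ∷ [])) (arg 3))))

opaque
  extendsT : Tm 5
  extendsT = allT gN (impT (andT (ltT (arg 2) (arg 7)) (eqT (call LT (arg 5 ∷ arg 2 ∷ [])) (arg 3)))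
                           (call elemT (arg 3 ∷ arg 4 ∷ call YT (arg 6 ∷ arg 2 ∷ []) ∷ [])))

opaque
  allowedT : Tm 5
  allowedT = impT (call knownT (arg 1 ∷ arg 3 ∷ arg 4 ∷ [])) (call entryT (arg 0 ∷ arg 1 ∷ arg 2 ∷ arg 3 ∷ arg 4 ∷ []))

opaque
  validT : Tm 5
  validT = andT (call distinctT (arg 1 ∷ []))
    (andT (call extendsT (arg 0 ∷ arg 1 ∷ arg 2 ∷ arg 3 ∷ arg 4 ∷ []))
      (allT gk (call allowedT (arg 3 ∷ call candT (arg 3 ∷ call posT (arg 4 ∷ arg 2 ∷ []) ∷ []) ∷ arg 5 ∷ arg 6 ∷ arg 7 ∷ []))))

opaque
  bestT : Tm 4
  bestT = iter gR (nat 0) (nat 0)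
    (cond (call validT (arg 3 ∷ arg 2 ∷ arg 4 ∷ arg 5 ∷ arg 6 ∷ []))
      -- The initial incumbent 0 need not be valid, so the first valid tuple replaces it whatever
      -- its cost.
      (cond (call validT (arg 3 ∷ arg 0 ∷ arg 4 ∷ arg 5 ∷ arg 6 ∷ []))
        (cond (ltT (call phiT (arg 3 ∷ arg 2 ∷ [])) (call phiT (arg 3 ∷ arg 0 ∷ []))) (arg 2) (arg 0))
        (arg 2))
      (arg 0))
    (nat 0) (arg 0)

opaque
  cntT : Tm 3
  cntT = sumT gN (cond (ltT (arg 2) (arg 5)) (eqT (call LT (arg 4 ∷ arg 2 ∷ [])) (arg 3)) (nat 0))

opaque
  curT : Tm 2
  curT = iter gn (nat 0) (nat 0)
    (cond (ltT (call cntT (arg 2 ∷ arg 3 ∷ arg 4 ∷ [])) (glob gk)) (arg 2) (arg 0)) (nat 0) (arg 0)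

opaque
  chosenT : Tm 5
  chosenT = call candT (arg 0 ∷ call posT (call bestT (arg 0 ∷ arg 1 ∷ arg 2 ∷ arg 3 ∷ []) ∷ arg 4 ∷ []) ∷ [])

opaque
  lastT : Tm 2
  lastT = cond (arg 1) (call YT (arg 0 ∷ arg 1 ⊟ nat 1 ∷ [])) (inp (nat 0))

opaque
  -- A guess j < k names a member of the cheapest set; the one further value j = k stands for the
  -- last candidate, whence digits in base k + 1.
  pickT : Tm 4
  pickT = cond (ltT (arg 3) (glob gk))
    (call chosenT (call curT (arg 0 ∷ arg 2 ∷ []) ∷ arg 0 ∷ arg 1 ∷ arg 2 ∷ arg 3 ∷ []))
    (call lastT (arg 1 ∷ arg 2 ∷ []))

opaque
  scoreT : Tm 3
  scoreT = sumT gn (call elemT (arg 2 ∷ call bestT (arg 2 ∷ arg 4 ∷ arg 5 ∷ glob gN ∷ []) ∷ arg 3 ∷ []))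

opaque
  checkT : Tm 2
  checkT = andT
    (allT gn (call validT (arg 2 ∷ call bestT (arg 2 ∷ arg 3 ∷ arg 4 ∷ glob gN ∷ []) ∷ arg 3 ∷ arg 4 ∷ glob gN ∷ [])))
    (andT (leT (sumT gn (call phiT (arg 2 ∷ call bestT (arg 2 ∷ arg 3 ∷ arg 4 ∷ glob gN ∷ []) ∷ []))) (inp (nat 1)))
      -- Only members of the chosen sets are compared with p: any other candidate scores 0, and a
      -- loop over all candidates around `bestT` would cost another factor m.
      (allT gn (allT gk
        (leT (call scoreT (call chosenT (arg 5 ∷ arg 6 ∷ arg 7 ∷ glob gN ∷ arg 2 ∷ []) ∷ arg 6 ∷ arg 7 ∷ []))
             (call scoreT (inp (nat 0) ∷ arg 6 ∷ arg 7 ∷ []))))))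

opaque
  runT : Tm 2
  runT = iter gN (nat 0) (nat 0)
    (arg 0 ⊞ call (timesT gn) (call LT (arg 3 ∷ arg 2 ∷ []) ∷ call (powT gn gN) (arg 2 ∷ []) ∷ []))
    (arg 1 ⊞ call (timesT gm)
      (call pickT (arg 0 ∷ arg 1 ∷ arg 2 ∷ call JT (arg 4 ∷ arg 2 ∷ []) ∷ []) ∷ call (powT gm gN) (arg 2 ∷ []) ∷ []))
    (call checkT (arg 0 ∷ arg 1 ∷ []))

opaque
  mainT : Tm 0
  mainT = anyT gL (anyT gJ (call runT (arg 5 ∷ arg 2 ∷ [])))

-- What the terms compute

sum : (ℕ → ℕ) → ℕ → ℕ
sum f zero    = 0
sum f (suc i) = sum f i + f i

sum-cong : ∀ {f g} L → (∀ i → i < L → f i ≡ g i) → sum f L ≡ sum g L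
sum-cong zero    eq = refl
sum-cong (suc L) eq = cong₂ _+_ (sum-cong L λ i lt → eq i (m≤n⇒m≤1+n lt)) (eq L ≤-refl)

fold-ind : ∀ {f : ℕ → ℕ × ℕ → ℕ × ℕ} {a} (Inv : ℕ → ℕ × ℕ → Set) L → Inv 0 a →
           (∀ i s → i < L → Inv i s → Inv (suc i) (f i s)) → Inv L (fold f a L)
fold-ind Inv zero    z s = z
fold-ind Inv (suc L) z s = s L _ ≤-refl (fold-ind Inv L z λ i t lt → s i t (m≤n⇒m≤1+n lt))

below-suc : ∀ {P : ℕ → Set} {L} → (∀ i → i < L → P i) → P L → ∀ i → i < suc L → P i
below-suc f q i lt with m≤n⇒m<n∨m≡n (s≤s⁻¹ lt)
... | inj₁ l    = f i l
... | inj₂ refl = q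

Tr : ℕ → Set
Tr zero    = ⊥
Tr (suc _) = ⊤

pos⇒Tr : ∀ {x} → 0 < x → Tr x
pos⇒Tr {suc x} _ = tt

Tr⇒pos : ∀ {x} → Tr x → 0 < x
Tr⇒pos {suc x} _ = z<s

dig : (b x j : ℕ) .{{_ : NonZero b}} → ℕ
dig b x j = (x / b ^ j) {{m^n≢0 b j}} % b

dig< : ∀ b x j .{{_ : NonZero b}} → dig b x j < b
dig< b x j = m%n<n _ b

dig-eq : ∀ b lo j d h .{{_ : NonZero b}} → lo < b ^ j → d < b → dig b (lo + b ^ j * (d + b * h)) j ≡ d
dig-eq b lo j d h lo< d< = begin
  (lo + b ^ j * (d + b * h)) / b ^ j % b  ≡⟨ cong (_% b) (+-distrib-/-∣ʳ lo {d = b ^ j} (m∣m*n {b ^ j} (d + b * h))) ⟩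
  (lo / b ^ j + b ^ j * (d + b * h) / b ^ j) % b ≡⟨ cong₂ (λ a c → (a + c) % b) (m<n⇒m/n≡0 lo<) (trans (cong (_/ b ^ j) (*-comm (b ^ j) _)) (m*n/n≡m (d + b * h) (b ^ j))) ⟩
  (d + b * h) % b                         ≡⟨ cong (λ a → (d + a) % b) (*-comm b h) ⟩
  (d + h * b) % b                         ≡⟨ [m+kn]%n≡m%n d h b ⟩
  d % b                                   ≡⟨ m<n⇒m%n≡m d< ⟩
  d ∎
  where
  open ≡-Reasoning
  instance _ = m^n≢0 b j

module Loops (X : ℕ → ℕ) (G : Glob → ℕ) where
  open Sem X G public

  sumT-spec : ∀ {d} g (b : Tm (3 + d)) ρ f →
    (∀ i → i < G g → ∀ x y → ⟦ b ⟧ (x ∷ y ∷ i ∷ ρ) ≡ f i) → ⟦ sumT g b ⟧ ρ ≡ sum f (G g)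
  sumT-spec g b ρ f eq = fold-ind (λ i s → proj₁ s ≡ sum f i) (G g) refl
    (λ i s lt ih → cong₂ _+_ ih (eq i lt (proj₁ s) (proj₂ s)))

  allT-spec : ∀ {d} g (b : Tm (3 + d)) ρ (P : ℕ → Set) →
    (∀ i → i < G g → ∀ x y → Tr (⟦ b ⟧ (x ∷ y ∷ i ∷ ρ)) ⇔ P i) →
    Tr (⟦ allT g b ⟧ ρ) ⇔ (∀ i → i < G g → P i)
  allT-spec g b ρ P eq = mk⇔ (proj₁ inv) (proj₂ inv)
    where
    inv : (Tr (⟦ allT g b ⟧ ρ) → ∀ i → i < G g → P i) × ((∀ i → i < G g → P i) → Tr (⟦ allT g b ⟧ ρ))
    Inv : ℕ → ℕ → Set
    Inv L x = (Tr x → ∀ i → i < L → P i) × ((∀ i → i < L → P i) → Tr x)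
    inv = fold-ind (λ L s → Inv L (proj₁ s)) (G g) ((λ _ i ()) , λ _ → tt) step′
      where
      step′ : ∀ i (s : ℕ × ℕ) → i < G g → Inv i (proj₁ s) →
              Inv (suc i) (ifz (⟦ b ⟧ (proj₁ s ∷ proj₂ s ∷ i ∷ ρ)) 0 (proj₁ s))
      step′ i (x , y) lt (f , h) with ⟦ b ⟧ (x ∷ y ∷ i ∷ ρ) | eq i lt x y
      ... | zero  | e = (λ ()) , λ all → ⊥-elim (from e (all i ≤-refl))
      ... | suc _ | e = (λ t → below-suc (f t) (to e tt)) , λ all → h λ j lt′ → all j (m≤n⇒m≤1+n lt′)

  anyT-spec : ∀ {d} g (b : Tm (3 + d)) ρ (P : ℕ → Set) →
    (∀ i → i < G g → ∀ x y → Tr (⟦ b ⟧ (x ∷ y ∷ i ∷ ρ)) ⇔ P i) →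
    Tr (⟦ anyT g b ⟧ ρ) ⇔ (∃ λ i → i < G g × P i)
  anyT-spec g b ρ P eq = mk⇔ (proj₁ inv) (proj₂ inv)
    where
    inv : (Tr (⟦ anyT g b ⟧ ρ) → ∃ λ i → i < G g × P i) × ((∃ λ i → i < G g × P i) → Tr (⟦ anyT g b ⟧ ρ))
    Inv : ℕ → ℕ → Set
    Inv L x = (Tr x → ∃ λ i → i < L × P i) × ((∃ λ i → i < L × P i) → Tr x)
    inv = fold-ind (λ L s → Inv L (proj₁ s)) (G g) ((λ ()) , λ ()) step′
      where
      step′ : ∀ i (s : ℕ × ℕ) → i < G g → Inv i (proj₁ s) →
              Inv (suc i) (ifz (⟦ b ⟧ (proj₁ s ∷ proj₂ s ∷ i ∷ ρ)) (proj₁ s) 1)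
      step′ i (x , y) lt (f , h) with ⟦ b ⟧ (x ∷ y ∷ i ∷ ρ) | eq i lt x y
      ... | suc _ | e = (λ _ → i , ≤-refl , to e tt) , λ _ → tt
      ... | zero  | e = (λ t → let j , l , q = f t in j , m≤n⇒m≤1+n l , q) , back
        where
        back : (∃ λ j → j < suc i × P j) → Tr x
        back (j , lt′ , q) with m≤n⇒m<n∨m≡n (s≤s⁻¹ lt′)
        ... | inj₁ l    = h (j , l , q)
        ... | inj₂ refl = ⊥-elim (from e q)

  anyT-01 : ∀ {d} g (b : Tm (3 + d)) ρ → ⟦ anyT g b ⟧ ρ ≤ 1
  anyT-01 g b ρ = fold-ind (λ _ s → proj₁ s ≤ 1) (G g) z≤n λ i s _ → step′ (⟦ b ⟧ (proj₁ s ∷ proj₂ s ∷ i ∷ ρ))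
    where
    step′ : ∀ c {x} → x ≤ 1 → ifz c x 1 ≤ 1
    step′ zero    le = le
    step′ (suc _) _  = ≤-refl

lt-spec : ∀ {x y} → Tr (y ∸ x) ⇔ x < y
lt-spec {x} {y} = mk⇔ (λ t → m∸n≢0⇒n<m (λ eq → subst Tr eq t)) (λ lt → pos⇒Tr (m<n⇒0<n∸m lt))

le-spec : ∀ {x y} → Tr (1 + y ∸ x) ⇔ x ≤ y
le-spec {x} {y} = mk⇔ (λ t → s≤s⁻¹ (to lt-spec t)) (λ le → from (lt-spec {x} {suc y}) (s≤s le))

not-spec : ∀ {x} {P : Set} → Tr x ⇔ P → Tr (1 ∸ x) ⇔ (¬ P)
not-spec {zero}  e = mk⇔ (λ _ p → from e p) (λ _ → tt)
not-spec {suc x} e = mk⇔ (λ t _ → subst Tr (0∸n≡0 x) t) (λ np → ⊥-elim (np (to e tt)))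

eq-spec : ∀ {x y} → Tr (1 ∸ ((x ∸ y) + (y ∸ x))) ⇔ x ≡ y
eq-spec {zero}  {zero}  = mk⇔ (λ _ → refl) (λ _ → tt)
eq-spec {zero}  {suc y} = mk⇔ (λ t → ⊥-elim (subst Tr (0∸n≡0 y) t)) (λ ())
eq-spec {suc x} {zero}  = mk⇔ (λ t → ⊥-elim (subst Tr (0∸n≡0 (x + 0)) t)) (λ ())
eq-spec {suc x} {suc y} = mk⇔ (λ t → cong suc (to (eq-spec {x} {y}) t))
                              (λ e → from (eq-spec {x} {y}) (suc-injective e))

and-spec : ∀ {x y} {P Q : Set} → Tr x ⇔ P → Tr y ⇔ Q → Tr (ifz x 0 y) ⇔ (P × Q)
and-spec {zero}  e f = mk⇔ (λ ()) (λ (p , _) → from e p)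
and-spec {suc _} e f = mk⇔ (λ t → to e tt , to f t) (λ (_ , q) → from f q)

or-spec : ∀ {x y} {P Q : Set} → Tr x ⇔ P → Tr y ⇔ Q → Tr (ifz x y 1) ⇔ (P ⊎ Q)
or-spec {zero}  e f = mk⇔ (inj₂ ∘ to f) λ { (inj₁ p) → ⊥-elim (from e p) ; (inj₂ q) → from f q }
or-spec {suc _} e f = mk⇔ (λ _ → inj₁ (to e tt)) (λ _ → tt)

imp-spec : ∀ {x y} {P Q : Set} → Tr x ⇔ P → Tr y ⇔ Q → Tr (ifz x 1 y) ⇔ (P → Q)
imp-spec {zero}  e f = mk⇔ (λ _ p → ⊥-elim (from e p)) (λ _ → tt)
imp-spec {suc _} e f = mk⇔ (λ t _ → to f t) (λ h → from f (h (to e tt)))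

ifz-Tr : ∀ {A : Set} {x} {a b : A} → Tr x → ifz x a b ≡ b
ifz-Tr {x = suc x} _ = refl

ifz-¬Tr : ∀ {A : Set} {x} {a b : A} → ¬ Tr x → ifz x a b ≡ a
ifz-¬Tr {x = zero}  _ = refl
ifz-¬Tr {x = suc x} n = ⊥-elim (n tt)

Tr? : ∀ x → Tr x ⊎ ¬ Tr x
Tr? zero    = inj₂ (λ ())
Tr? (suc x) = inj₁ tt

sum-const : ∀ c L → sum (λ _ → c) L ≡ L * c
sum-const c zero    = refl
sum-const c (suc L) = trans (cong (_+ c) (sum-const c L)) (+-comm (L * c) c)

-- Loops always run to a fixed bound; a sum up to a varying t is a full loop whose later terms the
-- guard turns into 0.
sum-guard : ∀ (g : ℕ → ℕ) t L → t ≤ L → sum (λ u → ifz (t ∸ u) 0 (g u)) L ≡ sum g t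
sum-guard g t L le with m≤n⇒∃[o]m+o≡n le
... | o , refl = trans (high o) (sum-cong t λ u u< → ifz-Tr (from lt-spec u<))
  where
  f : ℕ → ℕ
  f u = ifz (t ∸ u) 0 (g u)
  high : ∀ o → sum f (t + o) ≡ sum f t
  high zero    = cong (sum f) (+-identityʳ t)
  high (suc o) = trans (cong (sum f) (+-suc t o)) (trans (cong₂ _+_ (high o)
    (ifz-¬Tr (λ t′ → <⇒≱ (to lt-spec t′) (m≤m+n t o)))) (+-identityʳ _))

module Digits (X : ℕ → ℕ) (G : Glob → ℕ) where
  open Loops X G

  opaque
    unfolding mulT
    mulT-spec : ∀ g x → ⟦ mulT g ⟧ (x ∷ []) ≡ G g * x
    mulT-spec g x = trans (sumT-spec g (arg 3) (x ∷ []) (λ _ → x) (λ _ _ _ _ → refl)) (sum-const x (G g))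

    timesT-spec : ∀ g i c → i ≤ G g → ⟦ timesT g ⟧ (i ∷ c ∷ []) ≡ i * c
    timesT-spec g i c le = trans (sumT-spec g (cond (ltT (arg 2) (arg 3)) (arg 4) (nat 0)) (i ∷ c ∷ []) _ (λ _ _ _ _ → refl))
      (trans (sum-guard (λ _ → c) i (G g) le) (sum-const c i))

    powT-spec : ∀ b J j → j ≤ G J → ⟦ powT b J ⟧ (j ∷ []) ≡ G b ^ j
    powT-spec b J j le = trans (fold-ind (λ u s → proj₁ s ≡ G b ^ (u ⊓ j)) (G J) refl st)
                               (cong (G b ^_) (m≥n⇒m⊓n≡n le))
      where
      st : ∀ u (s : ℕ × ℕ) → u < G J → proj₁ s ≡ G b ^ (u ⊓ j) →
           ifz (j ∸ u) (proj₁ s) (⟦ mulT b ⟧ (proj₁ s ∷ [])) ≡ G b ^ (suc u ⊓ j)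
      st u s _ ih with u <? j
      ... | yes lt = trans (ifz-Tr (from lt-spec lt)) (trans (mulT-spec b (proj₁ s))
              (trans (cong (G b *_) (trans ih (cong (G b ^_) (m≤n⇒m⊓n≡m (<⇒≤ lt)))))
                     (cong (G b ^_) (sym (m≤n⇒m⊓n≡m lt)))))
      ... | no ge  = trans (ifz-¬Tr (ge ∘ to lt-spec)) (trans ih (cong (G b ^_)
              (trans (m≥n⇒m⊓n≡n (≮⇒≥ ge)) (sym (m≥n⇒m⊓n≡n (m≤n⇒m≤1+n (≮⇒≥ ge)))))))

    -- After b rounds either the value has dropped below P, or P has been subtracted b times,
    -- contradicting x < b * P.
    remT-spec : ∀ b x P .{{_ : NonZero P}} → x < G b * P → ⟦ remT b ⟧ (x ∷ P ∷ []) ≡ x % P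
    remT-spec b x P lt with fold-ind (λ i s → proj₁ s % P ≡ x % P × (proj₁ s < P ⊎ proj₁ s + i * P ≤ x))
                              (G b) (refl , inj₂ (≤-reflexive (+-identityʳ x))) st
      where
      st : ∀ i (s : ℕ × ℕ) → i < G b → proj₁ s % P ≡ x % P × (proj₁ s < P ⊎ proj₁ s + i * P ≤ x) →
           let y = ifz (1 + proj₁ s ∸ P) (proj₁ s) (proj₁ s ∸ P) in
           y % P ≡ x % P × (y < P ⊎ y + suc i * P ≤ x)
      st i (a , _) _ (e , h) with P ≤? a
      ... | no ¬le rewrite ifz-¬Tr {x = 1 + a ∸ P} {a} {a ∸ P} (¬le ∘ to le-spec) = e , inj₁ (≰⇒> ¬le)
      ... | yes le rewrite ifz-Tr {x = 1 + a ∸ P} {a} {a ∸ P} (from le-spec le) with h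
      ... | inj₁ lt′ = contradiction le (<⇒≱ lt′)
      ... | inj₂ le′ = trans (m≤n⇒[n∸m]%m≡n%m le) e , inj₂ (≤-trans (≤-reflexive
              (trans (sym (+-assoc (a ∸ P) P (i * P))) (cong (_+ i * P) (m∸n+n≡m le)))) le′)
    ... | e , inj₁ small = trans (sym (m<n⇒m%n≡m small)) e
    ... | e , inj₂ le    = contradiction (≤-trans (m≤n+m (G b * P) _) le) (<⇒≱ lt)

    quoT-spec : ∀ b x P .{{_ : NonZero P}} → x < G b * P → ⟦ quoT b ⟧ (x ∷ P ∷ []) ≡ x / P
    quoT-spec b x P lt with fold-ind (λ i s → proj₁ s + proj₂ s * P ≡ x × (proj₁ s < P ⊎ proj₂ s ≡ i))
                              (G b) (+-identityʳ x , inj₂ refl) st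
      where
      st : ∀ i (s : ℕ × ℕ) → i < G b → proj₁ s + proj₂ s * P ≡ x × (proj₁ s < P ⊎ proj₂ s ≡ i) →
           let y = ifz (1 + proj₁ s ∸ P) (proj₁ s) (proj₁ s ∸ P)
               z = ifz (1 + proj₁ s ∸ P) (proj₂ s) (1 + proj₂ s) in
           y + z * P ≡ x × (y < P ⊎ z ≡ suc i)
      st i (a , c) _ (e , h) with P ≤? a
      ... | no ¬le rewrite ifz-¬Tr {x = 1 + a ∸ P} {a} {a ∸ P} (¬le ∘ to le-spec)
                         | ifz-¬Tr {x = 1 + a ∸ P} {c} {suc c} (¬le ∘ to le-spec) = e , inj₁ (≰⇒> ¬le)
      ... | yes le rewrite ifz-Tr {x = 1 + a ∸ P} {a} {a ∸ P} (from le-spec le)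
                         | ifz-Tr {x = 1 + a ∸ P} {c} {suc c} (from le-spec le) with h
      ... | inj₁ lt′  = contradiction le (<⇒≱ lt′)
      ... | inj₂ refl = trans (trans (sym (+-assoc (a ∸ P) P (c * P))) (cong (_+ c * P) (m∸n+n≡m le))) e , inj₂ refl
    ... | e , inj₂ ce = contradiction (subst (λ z → z * P ≤ x) ce (≤-trans (m≤n+m _ _) (≤-reflexive e))) (<⇒≱ lt)
    ... | e , inj₁ small = quotient-unique _ _ e small
      where
      quotient-unique : ∀ a c → a + c * P ≡ x → a < P → c ≡ x / P
      quotient-unique a c refl a<P = sym (trans (+-distrib-/-∣ʳ a (divides-refl c))
        (cong₂ _+_ (m<n⇒m/n≡0 a<P) (m*n/n≡m c P)))

    -- After u rounds the value is x modulo b to the power max(J - u, j + 1). Each round thus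
    -- divides a number below b^(i+1) by b^i, which is within the range of `remT`.
    truncT-spec : ∀ b J x j .{{_ : NonZero (G b)}} → x < G b ^ G J → j < G J →
                  ⟦ truncT b J ⟧ (x ∷ j ∷ []) ≡ _%_ x (G b ^ suc j) {{m^n≢0 (G b) (suc j)}}
    truncT-spec b J x j x< j< = trans (fold-ind (λ u s → proj₁ s ≡ md ((G J ∸ u) ⊔ suc j)) (G J)
        (sym (trans (cong md (m≥n⇒m⊔n≡m j<)) (m<n⇒m%n≡m {{m^n≢0 (G b) (G J)}} x<))) st)
        (cong (λ z → md (z ⊔ suc j)) (n∸n≡0 (G J)))
      where
      md : ℕ → ℕ
      md e = _%_ x (G b ^ e) {{m^n≢0 (G b) e}}
      st : ∀ u (s : ℕ × ℕ) → u < G J → proj₁ s ≡ md ((G J ∸ u) ⊔ suc j) →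
           ifz ((G J ∸ 1 ∸ u) ∸ j) (proj₁ s)
               (⟦ remT b ⟧ (proj₁ s ∷ ⟦ powT b J ⟧ (G J ∸ 1 ∸ u ∷ []) ∷ [])) ≡ md ((G J ∸ suc u) ⊔ suc j)
      st u (a , _) lt ih rewrite ∸-+-assoc (G J) 1 u | +-∸-assoc 1 lt
        with G J ∸ suc u | m∸n≤m (G J) (suc u)
      ... | i | i≤ with j <? i
      ... | no ge = trans (ifz-¬Tr (ge ∘ to lt-spec)) (trans ih (cong md
              (trans (m≤n⇒m⊔n≡n (s≤s (≮⇒≥ ge))) (sym (m≤n⇒m⊔n≡n (m≤n⇒m≤1+n (≮⇒≥ ge)))))))
      ... | yes l = trans (ifz-Tr (from lt-spec l))
              (trans (cong (λ P → ⟦ remT b ⟧ (a ∷ P ∷ [])) (powT-spec b J i i≤))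
              (trans (remT-spec b a (G b ^ i) {{nz}} (subst (_< G b ^ suc i) (sym a≡) (m%n<n x _ {{nz′}})))
              (trans (cong (λ z → _%_ z (G b ^ i) {{nz}}) a≡)
              (trans (m∣n⇒o%n%m≡o%m (G b ^ i) (G b ^ suc i) x {{nz}} {{nz′}} (n∣m*n (G b)))
                     (cong md (sym (m≥n⇒m⊔n≡m l)))))))
        where
        nz : NonZero (G b ^ i)
        nz = m^n≢0 (G b) i
        nz′ : NonZero (G b ^ suc i)
        nz′ = m^n≢0 (G b) (suc i)
        a≡ : a ≡ md (suc i)
        a≡ = trans ih (cong md (m≥n⇒m⊔n≡m (s≤s (<⇒≤ l))))

    digT-spec : ∀ b J x j .{{_ : NonZero (G b)}} → x < G b ^ G J → j < G J →
                ⟦ digT b J ⟧ (x ∷ j ∷ []) ≡ dig (G b) x j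
    digT-spec b J x j x< j< =
      trans (cong₂ (λ y P → ⟦ quoT b ⟧ (y ∷ P ∷ [])) (truncT-spec b J x j x< j<) (powT-spec b J j (<⇒≤ j<)))
      (trans (quoT-spec b _ (G b ^ j) {{nz}} (m%n<n x (G b ^ suc j) {{m^n≢0 (G b) (suc j)}}))
             (m%[n*o]/o≡m/o%n x (G b) (G b ^ j) {{_}} {{nz}} {{m^n≢0 (G b) (suc j)}}))
      where
      nz : NonZero (G b ^ j)
      nz = m^n≢0 (G b) j

-- The indicator of equality, in the form in which `eqT` computes it.
ind : ℕ → ℕ → ℕ
ind x y = 1 ∸ ((x ∸ y) + (y ∸ x))

-- The interface between instance and algorithm: the analysis of the search sees the input only
-- through these equations.
record Layout (n m p β : ℕ) (X : ℕ → ℕ) (cand : ℕ → ℕ → ℕ) (cst : ℕ → ℕ → ℕ → ℕ) : Set where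
  field
    at-p     : X 0 ≡ p
    at-β     : X 1 ≡ β
    at-cand  : ∀ i r → i < n → r < m → X (2 + i * m + r) ≡ cand i r
    at-cost  : ∀ i a b → i < n → a < m → b < m → X (2 + n * m + i * (m * m) + a * m + b) ≡ cst i a b
    at-table : ∀ a → a < m → X (2 + n * m + n * (m * m) + a) ≡ a * m
    p<       : p < m
    cand<    : ∀ i r → i < n → r < m → cand i r < m
    cand-inj : ∀ i r r′ → i < n → r < m → r′ < m → cand i r ≡ cand i r′ → r ≡ r′

size : ℕ → ℕ → ℕ → Glob → ℕ
size n m k gn  = n
size n m k gm  = m
size n m k gk  = k
size n m k gk1 = suc k
size n m k gN  = n * k
size n m k gR  = m ^ k
size n m k gL  = n ^ (n * k)
size n m k gJ  = suc k ^ (n * k)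
size n m k gnm = n * m
size n m k gmm = m * m

-- Finite sums and digit strings

sum-mono : ∀ {f g} L → (∀ i → i < L → f i ≤ g i) → sum f L ≤ sum g L
sum-mono zero    le = z≤n
sum-mono (suc L) le = +-mono-≤ (sum-mono L λ i lt → le i (m≤n⇒m≤1+n lt)) (le L ≤-refl)

sum-+ : ∀ f g L → sum (λ i → f i + g i) L ≡ sum f L + sum g L
sum-+ f g zero    = refl
sum-+ f g (suc L) = trans (cong (_+ (f L + g L)) (sum-+ f g L)) (+-interchange (sum f L) _ _ _)

sum-* : ∀ c f L → sum (λ i → c * f i) L ≡ c * sum f L
sum-* c f zero    = sym (*-zeroʳ c)
sum-* c f (suc L) = trans (cong (_+ c * f L) (sum-* c f L)) (sym (*-distribˡ-+ c (sum f L) (f L)))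

sum-zero : ∀ L → sum (λ _ → 0) L ≡ 0
sum-zero L = trans (sum-const 0 L) (*-zeroʳ L)

sum-swap : ∀ (f : ℕ → ℕ → ℕ) K L → sum (λ i → sum (f i) L) K ≡ sum (λ j → sum (λ i → f i j) K) L
sum-swap f zero    L = sym (sum-zero L)
sum-swap f (suc K) L = trans (cong (_+ sum (f K) L) (sum-swap f K L)) (sym (sum-+ (λ j → sum (λ i → f i j) K) (f K) L))

sum-lt : ∀ {f g} L → sum f L < sum g L → ∃ λ i → i < L × f i < g i
sum-lt {f} {g} (suc L) lt with f L <? g L
... | yes l = L , ≤-refl , l
... | no ge = let i , i< , l = sum-lt L (≰⇒> λ le → <⇒≱ lt (+-mono-≤ le (≮⇒≥ ge))) in i , m≤n⇒m≤1+n i< , l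

term≤sum : ∀ f L {i} → i < L → f i ≤ sum f L
term≤sum f (suc L) {i} lt with m≤n⇒m<n∨m≡n (s≤s⁻¹ lt)
... | inj₁ l    = ≤-trans (term≤sum f L l) (m≤m+n _ _)
... | inj₂ refl = m≤n+m _ _

two≤sum : ∀ f L {i j} → i < j → j < L → f i + f j ≤ sum f L
two≤sum f (suc L) {i} {j} lt lt′ with m≤n⇒m<n∨m≡n (s≤s⁻¹ lt′)
... | inj₁ l    = ≤-trans (two≤sum f L lt l) (m≤m+n _ _)
... | inj₂ refl = +-monoˡ-≤ (f L) (term≤sum f L lt)

-- No slack in the total leaves no slack in any term. This is how counting is turned into equality
-- of sets later on.
sum-≡ : ∀ {f g} L → (∀ i → i < L → f i ≤ g i) → sum g L ≤ sum f L → ∀ i → i < L → f i ≡ g i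
sum-≡ {f} {g} (suc L) le ge i lt with m≤n⇒m<n∨m≡n (s≤s⁻¹ lt)
... | inj₁ l = sum-≡ L (λ i lt → le i (m≤n⇒m≤1+n lt))
        (+-cancelʳ-≤ (g L) _ _ (≤-trans ge (+-monoʳ-≤ (sum f L) (le L ≤-refl)))) i l
... | inj₂ refl = ≤-antisym (le L ≤-refl)
        (+-cancelˡ-≤ (sum f L) _ _ (≤-trans (+-monoˡ-≤ (g L) (sum-mono L λ i lt → le i (m≤n⇒m≤1+n lt))) ge))

ind-refl : ∀ x → ind x x ≡ 1
ind-refl x rewrite n∸n≡0 x = refl

ind-≢ : ∀ {x y} → x ≢ y → ind x y ≡ 0
ind-≢ {x} {y} ne with ind x y | eq-spec {x} {y}
... | zero  | _ = refl
... | suc _ | e = contradiction (to e tt) ne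

sum-ind : ∀ a (F : ℕ → ℕ) L → a < L → sum (λ c → ind a c * F c) L ≡ F a
sum-ind a F (suc L) lt with m≤n⇒m<n∨m≡n (s≤s⁻¹ lt)
... | inj₁ l = trans (cong₂ _+_ (sum-ind a F L l) (cong (_* F L) (ind-≢ (<⇒≢ l)))) (+-identityʳ _)
... | inj₂ refl = trans (cong₂ _+_ (below L ≤-refl) (trans (cong (_* F L) (ind-refl L)) (+-identityʳ _))) refl
  where
  below : ∀ j → j ≤ L → sum (λ c → ind L c * F c) j ≡ 0
  below zero    _ = refl
  below (suc j) l = cong₂ _+_ (below j (<⇒≤ l)) (cong (_* F j) (ind-≢ (<⇒≢ l ∘ sym)))

sum-ind1 : ∀ a L → a < L → sum (ind a) L ≡ 1
sum-ind1 a L lt = trans (sum-cong L λ c _ → sym (*-identityʳ (ind a c))) (sum-ind a (λ _ → 1) L lt)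

count : (ℕ → ℕ) → ℕ → ℕ → ℕ
count a K c = sum (λ j → ind (a j) c) K

-- Double counting: the terms are regrouped by the value that `a` takes.
sum-along : ∀ a (F : ℕ → ℕ) K m → (∀ j → j < K → a j < m) → sum (F ∘ a) K ≡ sum (λ c → count a K c * F c) m
sum-along a F K m a< = begin
  sum (F ∘ a) K
    ≡⟨ sum-cong K (λ j j< → sym (sum-ind (a j) F m (a< j j<))) ⟩
  sum (λ j → sum (λ c → ind (a j) c * F c) m) K
    ≡⟨ sum-swap (λ j c → ind (a j) c * F c) K m ⟩
  sum (λ c → sum (λ j → ind (a j) c * F c) K) m
    ≡⟨ sum-cong m (λ c _ → trans (sum-cong K λ j _ → *-comm (ind (a j) c) (F c))
         (trans (sum-* (F c) (λ j → ind (a j) c) K) (*-comm (F c) _))) ⟩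
  sum (λ c → count a K c * F c) m ∎
  where open ≡-Reasoning

sum-count : ∀ a K m → (∀ j → j < K → a j < m) → sum (count a K) m ≡ K
sum-count a K m a< = trans (sum-cong m λ c _ → sym (*-identityʳ (count a K c)))
  (trans (sym (sum-along a (λ _ → 1) K m a<)) (trans (sum-const 1 K) (*-identityʳ K)))

count-Tr : ∀ a K c → Tr (count a K c) ⇔ (∃ λ j → j < K × a j ≡ c)
count-Tr a K c = mk⇔ there back
  where
  there : Tr (count a K c) → ∃ λ j → j < K × a j ≡ c
  there t = let j , j< , l = sum-lt {λ _ → 0} {λ j → ind (a j) c} K (subst (_< count a K c) (sym (sum-zero K)) (Tr⇒pos t))
            in j , j< , to eq-spec (pos⇒Tr l)
  back : (∃ λ j → j < K × a j ≡ c) → Tr (count a K c)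
  back (j , j< , refl) = pos⇒Tr (≤-trans (≤-reflexive (sym (ind-refl (a j)))) (term≤sum (λ u → ind (a u) (a j)) K j<))

Injective : (ℕ → ℕ) → ℕ → Set
Injective a K = ∀ i j → i < K → j < K → a i ≡ a j → i ≡ j

count≤1 : ∀ a K → Injective a K → ∀ c → count a K c ≤ 1
count≤1 a zero    inj c = z≤n
count≤1 a (suc K) inj c with a K ≟ c
... | no ne rewrite ind-≢ ne | +-identityʳ (count a K c) =
  count≤1 a K (λ i j i< j< → inj i j (m≤n⇒m≤1+n i<) (m≤n⇒m≤1+n j<)) c
... | yes refl with Tr? (count a K (a K))
... | inj₁ t = let j , j< , e = to (count-Tr a K (a K)) t in
  contradiction (inj j K (m≤n⇒m≤1+n j<) ≤-refl e) (<⇒≢ j<)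
... | inj₂ ¬t with count a K (a K)
... | zero  = ≤-reflexive (ind-refl (a K))
... | suc _ = ⊥-elim (¬t tt)

repeated : ∀ a K → (∀ j → j < K → count a K (a j) ≤ 1) → ∀ {i j} → i < j → j < K → a i ≢ a j
repeated a K le {i} {j} l j< e = contradiction
  (≤-trans (two≤sum (λ u → ind (a u) (a j)) K l j<) (le j j<))
  (<⇒≱ (≤-reflexive (sym (cong₂ _+_ (trans (cong (λ z → ind z (a j)) e) (ind-refl (a j))) (ind-refl (a j))))))

count-injective : ∀ a K → (∀ j → j < K → count a K (a j) ≤ 1) → Injective a K
count-injective a K le i j i< j< eq with <-cmp i j
... | tri≈ _ e _ = e
... | tri< l _ _ = ⊥-elim (repeated a K le l j< eq)
... | tri> _ _ l = ⊥-elim (repeated a K le l i< (sym eq))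

-- An injection of [0, m) into itself is a bijection.
sum-permuted : ∀ a (F : ℕ → ℕ) m → (∀ j → j < m → a j < m) → Injective a m → sum (F ∘ a) m ≡ sum F m
sum-permuted a F m a< inj = trans (sum-along a F m m a<) (sum-cong m λ c c< →
  trans (cong (_* F c) (sum-≡ m (λ c _ → count≤1 a m inj c)
    (≤-reflexive (trans (trans (sum-const 1 m) (*-identityʳ m)) (sym (sum-count a m m a<)))) c c<)) (+-identityʳ (F c)))

-- A set given by its indicator becomes a tuple listing it, the form in which k-sets are scanned;
-- the largest element is appended as last entry.
enumerate : ∀ f m K → (∀ r → f r ≤ 1) → sum f m ≡ K →
            ∃ λ a → (∀ j → j < K → a j < m) × (∀ r → r < m → count a K r ≡ f r)
enumerate f zero    .0 f≤ refl = id , (λ _ ()) , λ _ ()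
enumerate f (suc m) K  f≤ eq with f m in fm | f≤ m
... | zero | _ = let a , a< , cnt = enumerate f m K f≤ (trans (sym (+-identityʳ _)) eq) in
  a , (λ j j< → m≤n⇒m≤1+n (a< j j<)) , below-suc cnt (last a a<)
  where
  last : ∀ a → (∀ j → j < K → a j < m) → count a K m ≡ f m
  last a a< = trans (sum-cong K λ j j< → ind-≢ (<⇒≢ (a< j j<))) (trans (sum-zero K) (sym fm))
... | suc zero | _ with enumerate f m (sum f m) f≤ refl
... | a , a< , cnt = a′ , a′< , cnt′
  where
  k = sum f m
  K≡ : suc k ≡ K
  K≡ = trans (+-comm 1 k) eq
  a′ : ℕ → ℕ
  a′ = write k m a
  old : ∀ {j} → j < k → a′ j ≡ a j
  old l = write-other k m a (<⇒≢ l)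
  new : a′ k ≡ m
  new = write-same k m a refl
  a′< : ∀ j → j < K → a′ j < suc m
  a′< j j< with m≤n⇒m<n∨m≡n (s≤s⁻¹ (subst (j <_) (sym K≡) j<))
  ... | inj₁ l    = subst (_< suc m) (sym (old l)) (m≤n⇒m≤1+n (a< j l))
  ... | inj₂ refl = subst (_< suc m) (sym new) ≤-refl
  cnt′ : ∀ r → r < suc m → count a′ K r ≡ f r
  cnt′ r r< = trans (cong (λ z → count a′ z r) (sym K≡)) (trans (cong₂ _+_
    (sum-cong k λ j j< → cong (λ z → ind z r) (old j<)) (cong (λ z → ind z r) new)) (split r r<))
    where
    split : ∀ r → r < suc m → count a k r + ind m r ≡ f r
    split = below-suc (λ r l → trans (cong₂ _+_ (cnt r l) (ind-≢ (<⇒≢ l ∘ sym))) (+-identityʳ _))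
      (trans (cong₂ _+_ (trans (sum-cong k λ j j< → ind-≢ (<⇒≢ (a< j j<))) (sum-zero k)) (ind-refl m)) (sym fm))
enumerate f (suc m) K f≤ eq | suc (suc _) | s≤s ()

module _ (b : ℕ) {{_ : NonZero b}} where
  dig-low : ∀ x d t u → u < t → dig b (x + b ^ t * d) u ≡ dig b x u
  dig-low x d t u lt with m≤n⇒∃[o]m+o≡n lt
  ... | o , refl = begin
    (x + b ^ (suc u + o) * d) / b ^ u % b
      ≡⟨ cong (λ z → (x + z) / b ^ u % b) (trans (cong (_* d) (trans (cong (b ^_) (sym (+-suc u o))) (^-distribˡ-+-* b u (suc o))))
           (*-assoc (b ^ u) (b * b ^ o) d)) ⟩
    (x + b ^ u * (b * b ^ o * d)) / b ^ u % b
      ≡⟨ cong (_% b) (+-distrib-/-∣ʳ x {d = b ^ u} (m∣m*n {b ^ u} (b * b ^ o * d))) ⟩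
    (x / b ^ u + b ^ u * (b * b ^ o * d) / b ^ u) % b
      ≡⟨ cong (λ z → (x / b ^ u + z) % b) (trans (cong (_/ b ^ u) (*-comm (b ^ u) _)) (m*n/n≡m _ (b ^ u))) ⟩
    (x / b ^ u + b * b ^ o * d) % b
      ≡⟨ cong (λ z → (x / b ^ u + z) % b) (trans (*-assoc b (b ^ o) d) (*-comm b _)) ⟩
    (x / b ^ u + b ^ o * d * b) % b
      ≡⟨ [m+kn]%n≡m%n (x / b ^ u) (b ^ o * d) b ⟩
    x / b ^ u % b ∎
    where
    open ≡-Reasoning
    instance _ = m^n≢0 b u

  dig-top : ∀ x d t → x < b ^ t → d < b → dig b (x + b ^ t * d) t ≡ d
  dig-top x d t x< d< = trans (cong (λ z → dig b (x + b ^ t * z) t) (sym (trans (cong (d +_) (*-zeroʳ b)) (+-identityʳ d))))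
    (dig-eq b x t d 0 x< d<)

  append< : ∀ x d t → x < b ^ t → d < b → x + b ^ t * d < b ^ suc t
  append< x d t x< d< = begin-strict
    x + b ^ t * d       <⟨ +-monoˡ-< (b ^ t * d) x< ⟩
    b ^ t + b ^ t * d   ≡⟨ *-suc (b ^ t) d ⟨
    b ^ t * suc d       ≤⟨ *-monoʳ-≤ (b ^ t) d< ⟩
    b ^ t * b           ≡⟨ *-comm (b ^ t) b ⟩
    b ^ suc t ∎
    where open ≤-Reasoning

  code : (ℕ → ℕ) → ℕ → ℕ
  code a zero    = 0
  code a (suc t) = code a t + b ^ t * a t

  code< : ∀ a t → (∀ j → j < t → a j < b) → code a t < b ^ t
  code< a zero    a< = z<s
  code< a (suc t) a< = append< (code a t) (a t) t (code< a t λ j j< → a< j (m≤n⇒m≤1+n j<)) (a< t ≤-refl)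

  dig-code : ∀ a t → (∀ j → j < t → a j < b) → ∀ j → j < t → dig b (code a t) j ≡ a j
  dig-code a (suc t) a< j j< with m≤n⇒m<n∨m≡n (s≤s⁻¹ j<)
  ... | inj₁ l    = trans (dig-low (code a t) (a t) t j l) (dig-code a t (λ i i< → a< i (m≤n⇒m≤1+n i<)) j l)
  ... | inj₂ refl = dig-top (code a t) (a t) t (code< a t λ i i< → a< i (m≤n⇒m≤1+n i<)) (a< t ≤-refl)

Tr-≤ : ∀ {x y} → x ≤ y → Tr x → Tr y
Tr-≤ le t = pos⇒Tr (≤-trans (Tr⇒pos t) le)

¬Tr⇒0 : ∀ {x} → ¬ Tr x → x ≡ 0
¬Tr⇒0 {zero}  _ = refl
¬Tr⇒0 {suc x} n = ⊥-elim (n tt)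

≤-from-Tr : ∀ {x y} → x ≤ 1 → (Tr x → Tr y) → x ≤ y
≤-from-Tr {zero}        _         _ = z≤n
≤-from-Tr {suc zero}    _         f = Tr⇒pos (f tt)
≤-from-Tr {suc (suc x)} (s≤s ()) _

search : ∀ {P : ℕ → Set} → (∀ i → Dec (P i)) → ∀ L → (∃ λ i → i < L × P i) ⊎ (∀ i → i < L → ¬ P i)
search P? zero = inj₂ λ _ ()
search P? (suc L) with P? L | search P? L
... | yes q | _ = inj₁ (L , ≤-refl , q)
... | no _  | inj₁ (i , i< , q) = inj₁ (i , m≤n⇒m≤1+n i< , q)
... | no ¬q | inj₂ none = inj₂ (below-suc none ¬q)

Tr-dec : ∀ x → Dec (Tr x)
Tr-dec zero    = no (λ ())
Tr-dec (suc x) = yes tt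

-- The values of the terms of the algorithm

module Solving (n m k p β : ℕ) {{_ : NonZero n}} {{_ : NonZero m}} {{_ : NonZero k}}
               (X : ℕ → ℕ) (cand : ℕ → ℕ → ℕ) (cst : ℕ → ℕ → ℕ → ℕ)
               (layout : Layout n m p β X cand cst) where
  open Layout layout public
  open Loops X (size n m k)
  open Digits X (size n m k)

  N : ℕ
  N = n * k

  pos : ℕ → ℕ → ℕ
  pos x j = dig m x j

  opaque
    unfolding candT
    candT-spec : ∀ i r → i < n → r < m → ⟦ candT ⟧ (i ∷ r ∷ []) ≡ cand i r
    candT-spec i r i< r< = trans (cong (λ z → X (2 + z + r)) (timesT-spec gn i m (<⇒≤ i<))) (at-cand i r i< r<)

  opaque
    unfolding costT
    costT-spec : ∀ i a b → i < n → a < m → b < m → ⟦ costT ⟧ (i ∷ a ∷ b ∷ []) ≡ cst i a b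
    costT-spec i a b i< a< b< = trans (cong₂ (λ y z → X (2 + n * m + y + z + b))
      (timesT-spec gn i (m * m) (<⇒≤ i<))
      (trans (cong (λ z → X (2 + n * m + z + a)) (timesT-spec gn n (m * m) ≤-refl)) (at-table a a<)))
      (at-cost i a b i< a< b<)

  pair : ℕ → ℕ → ℕ → ℕ
  pair i r′ r = ifz (r ∸ r′) 0 (cst i (cand i r′) (cand i r))

  up : ℕ → ℕ → ℕ
  up i r = sum (λ r′ → pair i r′ r) m

  opaque
    unfolding upT
    upT-spec : ∀ i r → i < n → r < m → ⟦ upT ⟧ (i ∷ r ∷ cand i r ∷ []) ≡ up i r
    upT-spec i r i< r< = sumT-spec gm (cond (ltT (arg 2) (arg 4)) (call costT (arg 3 ∷ call candT (arg 3 ∷ arg 2 ∷ []) ∷ arg 5 ∷ [])) (nat 0))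
      (i ∷ r ∷ cand i r ∷ []) _ λ r′ r′< _ _ → cong (ifz (r ∸ r′) 0)
        (trans (cong (λ c → ⟦ costT ⟧ (i ∷ c ∷ cand i r ∷ [])) (candT-spec i r′ i< r′<))
               (costT-spec i _ _ i< (cand< i r′ i< r′<) (cand< i r i< r<)))

  opaque
    unfolding upAtT
    upAtT-spec : ∀ i r → i < n → r < m → ⟦ upAtT ⟧ (i ∷ r ∷ []) ≡ up i r
    upAtT-spec i r i< r< = trans (cong (λ c → ⟦ upT ⟧ (i ∷ r ∷ c ∷ [])) (candT-spec i r i< r<)) (upT-spec i r i< r<)

  opaque
    unfolding pairT
    pairT-spec : ∀ i r′ r → i < n → r′ < m → r < m → ⟦ pairT ⟧ (i ∷ r′ ∷ r ∷ []) ≡ pair i r′ r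
    pairT-spec i r′ r i< r′< r< = cong (ifz (r ∸ r′) 0)
      (trans (cong₂ (λ c d → ⟦ costT ⟧ (i ∷ c ∷ d ∷ [])) (candT-spec i r′ i< r′<) (candT-spec i r i< r<))
             (costT-spec i _ _ i< (cand< i r′ i< r′<) (cand< i r i< r<)))

  posT-spec : ∀ x j → x < m ^ k → j < k → ⟦ posT ⟧ (x ∷ j ∷ []) ≡ pos x j
  posT-spec x j x< j< = digT-spec gm gk x j x< j<

  pos< : ∀ x j → pos x j < m
  pos< x j = dig< m x j

  -- All costs of lifting the chosen candidates, minus those among themselves.
  phi : ℕ → ℕ → ℕ
  phi i x = sum (λ j → up i (pos x j)) k ∸ sum (λ j → sum (λ j′ → pair i (pos x j′) (pos x j)) k) k

  opaque
    unfolding phiT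
    phiT-spec : ∀ i x → i < n → x < m ^ k → ⟦ phiT ⟧ (i ∷ x ∷ []) ≡ phi i x
    phiT-spec i x i< x< = cong₂ _∸_
      (sumT-spec gk (call upAtT (arg 3 ∷ call posT (arg 4 ∷ arg 2 ∷ []) ∷ [])) (i ∷ x ∷ []) _ λ j j< _ _ →
        trans (cong (λ r → ⟦ upAtT ⟧ (i ∷ r ∷ [])) (posT-spec x j x< j<)) (upAtT-spec i _ i< (pos< x j)))
      (sumT-spec gk (sumT gk (call pairT (arg 6 ∷ call posT (arg 7 ∷ arg 2 ∷ []) ∷ call posT (arg 7 ∷ arg 5 ∷ []) ∷ []))) (i ∷ x ∷ []) _
        λ j j< a b →
        sumT-spec gk (call pairT (arg 6 ∷ call posT (arg 7 ∷ arg 2 ∷ []) ∷ call posT (arg 7 ∷ arg 5 ∷ []) ∷ [])) (a ∷ b ∷ j ∷ i ∷ x ∷ []) _ λ j′ j′< _ _ →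
        trans (cong₂ (λ r s → ⟦ pairT ⟧ (i ∷ r ∷ s ∷ [])) (posT-spec x j′ x< j′<) (posT-spec x j x< j<))
              (pairT-spec i _ _ i< (pos< x j′) (pos< x j)))

  Elem : ℕ → ℕ → ℕ → Set
  Elem i x c = ∃ λ j → j < k × cand i (pos x j) ≡ c

  cand-pos : ∀ i x j → i < n → x < m ^ k → j < k →
             ⟦ candT ⟧ (i ∷ ⟦ posT ⟧ (x ∷ j ∷ []) ∷ []) ≡ cand i (pos x j)
  cand-pos i x j i< x< j< = trans (cong (λ r → ⟦ candT ⟧ (i ∷ r ∷ [])) (posT-spec x j x< j<)) (candT-spec i _ i< (pos< x j))

  Tr≡ : ∀ {x y} {P : Set} → x ≡ y → Tr y ⇔ P → Tr x ⇔ P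
  Tr≡ refl e = e

  opaque
    unfolding elemT
    elemT-spec : ∀ i x c → i < n → x < m ^ k → Tr (⟦ elemT ⟧ (i ∷ x ∷ c ∷ [])) ⇔ Elem i x c
    elemT-spec i x c i< x< = anyT-spec gk (eqT (call candT (arg 3 ∷ call posT (arg 4 ∷ arg 2 ∷ []) ∷ [])) (arg 5)) (i ∷ x ∷ c ∷ []) _ λ j j< _ _ →
      Tr≡ (cong (λ z → 1 ∸ ((z ∸ c) + (c ∸ z))) (cand-pos i x j i< x< j<)) eq-spec

    elemT-01 : ∀ i x c → ⟦ elemT ⟧ (i ∷ x ∷ c ∷ []) ≤ 1
    elemT-01 i x c = anyT-01 gk (eqT (call candT (arg 3 ∷ call posT (arg 4 ∷ arg 2 ∷ []) ∷ [])) (arg 5)) (i ∷ x ∷ c ∷ [])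

  Distinct : ℕ → Set
  Distinct x = ∀ j → j < k → ∀ j′ → j′ < k → j ≡ j′ ⊎ pos x j ≢ pos x j′

  opaque
    unfolding distinctT
    distinctT-spec : ∀ x → x < m ^ k → Tr (⟦ distinctT ⟧ (x ∷ [])) ⇔ Distinct x
    distinctT-spec x x< = allT-spec gk (allT gk body) (x ∷ []) _ λ j j< a b → allT-spec gk body (a ∷ b ∷ j ∷ x ∷ []) _ λ j′ j′< _ _ →
      or-spec eq-spec (not-spec (Tr≡ (cong₂ (λ y z → 1 ∸ ((y ∸ z) + (z ∸ y))) (posT-spec x j x< j<) (posT-spec x j′ x< j′<)) eq-spec))
      where
      body : Tm 7
      body = orT (eqT (arg 5) (arg 2)) (notT (eqT (call posT (arg 6 ∷ arg 5 ∷ [])) (call posT (arg 6 ∷ arg 2 ∷ []))))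

  module State (sL sY : ℕ) (sL< : sL < n ^ N) (sY< : sY < m ^ N) where
    L Y : ℕ → ℕ
    L t = dig n sL t
    Y t = dig m sY t

    LT-spec : ∀ t → t < N → ⟦ LT ⟧ (sL ∷ t ∷ []) ≡ L t
    LT-spec t t< = digT-spec gn gN sL t sL< t<

    YT-spec : ∀ t → t < N → ⟦ YT ⟧ (sY ∷ t ∷ []) ≡ Y t
    YT-spec t t< = digT-spec gm gN sY t sY< t<

    Entry : ℕ → ℕ → ℕ → Set
    Entry t l c = ∃ λ u → u < N × (u < t × (L u ≡ l × Y u ≡ c))

    Known : ℕ → ℕ → Set
    Known t c = c ≡ p ⊎ (∃ λ u → u < N × (u < t × Y u ≡ c))

    eqL : ∀ u l → u < N → Tr (1 ∸ ((⟦ LT ⟧ (sL ∷ u ∷ []) ∸ l) + (l ∸ ⟦ LT ⟧ (sL ∷ u ∷ [])))) ⇔ L u ≡ l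
    eqL u l u< = Tr≡ (cong (λ z → 1 ∸ ((z ∸ l) + (l ∸ z))) (LT-spec u u<)) eq-spec

    eqY : ∀ u c → u < N → Tr (1 ∸ ((⟦ YT ⟧ (sY ∷ u ∷ []) ∸ c) + (c ∸ ⟦ YT ⟧ (sY ∷ u ∷ [])))) ⇔ Y u ≡ c
    eqY u c u< = Tr≡ (cong (λ z → 1 ∸ ((z ∸ c) + (c ∸ z))) (YT-spec u u<)) eq-spec

    opaque
      unfolding entryT
      entryT-spec : ∀ t l c → Tr (⟦ entryT ⟧ (l ∷ c ∷ sL ∷ sY ∷ t ∷ [])) ⇔ Entry t l c
      entryT-spec t l c = anyT-spec gN (andT (ltT (arg 2) (arg 7)) (andT (eqT (call LT (arg 5 ∷ arg 2 ∷ [])) (arg 3)) (eqT (call YT (arg 6 ∷ arg 2 ∷ [])) (arg 4))))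
        (l ∷ c ∷ sL ∷ sY ∷ t ∷ []) _ λ u u< _ _ → and-spec lt-spec (and-spec (eqL u l u<) (eqY u c u<))

    opaque
      unfolding knownT
      knownT-spec : ∀ t c → Tr (⟦ knownT ⟧ (c ∷ sY ∷ t ∷ [])) ⇔ Known t c
      knownT-spec t c = or-spec (Tr≡ (cong (λ z → 1 ∸ ((c ∸ z) + (z ∸ c))) at-p) eq-spec)
        (anyT-spec gN (andT (ltT (arg 2) (arg 5)) (eqT (call YT (arg 4 ∷ arg 2 ∷ [])) (arg 3))) (c ∷ sY ∷ t ∷ []) _ λ u u< _ _ → and-spec lt-spec (eqY u c u<))

    Extends : ℕ → ℕ → ℕ → Set
    Extends t i x = ∀ u → u < N → u < t × L u ≡ i → Elem i x (Y u)

    opaque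
      unfolding extendsT
      extendsT-spec : ∀ t i x → i < n → x < m ^ k → Tr (⟦ extendsT ⟧ (i ∷ x ∷ sL ∷ sY ∷ t ∷ [])) ⇔ Extends t i x
      extendsT-spec t i x i< x< = allT-spec gN
        (impT (andT (ltT (arg 2) (arg 7)) (eqT (call LT (arg 5 ∷ arg 2 ∷ [])) (arg 3))) (call elemT (arg 3 ∷ arg 4 ∷ call YT (arg 6 ∷ arg 2 ∷ []) ∷ [])))
        (i ∷ x ∷ sL ∷ sY ∷ t ∷ []) _ λ u u< _ _ → imp-spec (and-spec lt-spec (eqL u i u<))
        (Tr≡ (cong (λ c → ⟦ elemT ⟧ (i ∷ x ∷ c ∷ [])) (YT-spec u u<)) (elemT-spec i x (Y u) i< x<))

    opaque
      unfolding allowedT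
      allowedT-spec : ∀ t i c → Tr (⟦ allowedT ⟧ (i ∷ c ∷ sL ∷ sY ∷ t ∷ [])) ⇔ (Known t c → Entry t i c)
      allowedT-spec t i c = imp-spec (knownT-spec t c) (entryT-spec t i c)

    Valid : ℕ → ℕ → ℕ → Set
    Valid t i x = Distinct x × (Extends t i x ×
      (∀ j → j < k → Known t (cand i (pos x j)) → Entry t i (cand i (pos x j))))

    opaque
      unfolding validT
      validT-spec : ∀ t i x → i < n → x < m ^ k → Tr (⟦ validT ⟧ (i ∷ x ∷ sL ∷ sY ∷ t ∷ [])) ⇔ Valid t i x
      validT-spec t i x i< x< = and-spec (distinctT-spec x x<) (and-spec (extendsT-spec t i x i< x<)
        (allT-spec gk (call allowedT (arg 3 ∷ call candT (arg 3 ∷ call posT (arg 4 ∷ arg 2 ∷ []) ∷ []) ∷ arg 5 ∷ arg 6 ∷ arg 7 ∷ [])) (i ∷ x ∷ sL ∷ sY ∷ t ∷ []) _ λ j j< _ _ →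
          Tr≡ (cong (λ c → ⟦ allowedT ⟧ (i ∷ c ∷ sL ∷ sY ∷ t ∷ [])) (cand-pos i x j i< x< j<)) (allowedT-spec t i _)))

    best : ℕ → ℕ → ℕ
    best t i = ⟦ bestT ⟧ (i ∷ sL ∷ sY ∷ t ∷ [])

    opaque
      unfolding bestT
      -- The claim is conditional on a valid tuple: the invariant says that as soon as one has been
      -- scanned, the incumbent is valid and no dearer than any valid tuple scanned.
      best-spec : ∀ t i → i < n → best t i < m ^ k ×
        (∀ x → x < m ^ k → Valid t i x → Valid t i (best t i) × phi i (best t i) ≤ phi i x)
      best-spec t i i< with fold-ind Inv (m ^ k) (m^n>0 m k , λ x ()) step′
        where
        V : ℕ → ℕ
        V x = ⟦ validT ⟧ (i ∷ x ∷ sL ∷ sY ∷ t ∷ [])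
        F : ℕ → ℕ
        F x = ⟦ phiT ⟧ (i ∷ x ∷ [])
        Inv : ℕ → ℕ × ℕ → Set
        Inv R s = proj₁ s < m ^ k × (∀ x → x < R → Tr (V x) → Tr (V (proj₁ s)) × F (proj₁ s) ≤ F x)
        step′ : ∀ x (s : ℕ × ℕ) → x < m ^ k → Inv x s →
                Inv (suc x) (ifz (V x) (proj₁ s) (ifz (V (proj₁ s)) x (ifz (F (proj₁ s) ∸ F x) (proj₁ s) x)) , 0)
        step′ x (b , _) x< (b< , ih) with Tr? (V x)
        ... | inj₂ ¬t rewrite ifz-¬Tr {x = V x} {b} {ifz (V b) x (ifz (F b ∸ F x) b x)} ¬t =
          b< , below-suc ih λ tx → contradiction tx ¬t
        ... | inj₁ tx rewrite ifz-Tr {x = V x} {b} {ifz (V b) x (ifz (F b ∸ F x) b x)} tx with Tr? (V b)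
        ... | inj₂ ¬t rewrite ifz-¬Tr {x = V b} {x} {ifz (F b ∸ F x) b x} ¬t =
          x< , below-suc (λ y l ty → contradiction (proj₁ (ih y l ty)) ¬t) λ _ → tx , ≤-refl
        ... | inj₁ tb rewrite ifz-Tr {x = V b} {x} {ifz (F b ∸ F x) b x} tb with Tr? (F b ∸ F x)
        ... | inj₁ lt rewrite ifz-Tr {x = F b ∸ F x} {b} {x} lt =
          x< , below-suc (λ y l ty → tx , ≤-trans (<⇒≤ (to lt-spec lt)) (proj₂ (ih y l ty))) λ _ → tx , ≤-refl
        ... | inj₂ ¬lt rewrite ifz-¬Tr {x = F b ∸ F x} {b} {x} ¬lt =
          b< , below-suc ih λ _ → tb , ≮⇒≥ (¬lt ∘ from lt-spec)
      ... | b< , opt = b< , λ x x< vx →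
        let tb , le = opt x x< (from (validT-spec t i x i< x<) vx) in
        to (validT-spec t i _ i< b<) tb ,
        subst₂ _≤_ (phiT-spec i _ i< b<) (phiT-spec i x i< x<) le

    cnt : ℕ → ℕ → ℕ
    cnt t l = sum (λ u → ifz (t ∸ u) 0 (ind (L u) l)) N

    opaque
      unfolding cntT
      cntT-spec : ∀ t l → ⟦ cntT ⟧ (l ∷ sL ∷ t ∷ []) ≡ cnt t l
      cntT-spec t l = sumT-spec gN (cond (ltT (arg 2) (arg 5)) (eqT (call LT (arg 4 ∷ arg 2 ∷ [])) (arg 3)) (nat 0)) (l ∷ sL ∷ t ∷ []) _
        λ u u< _ _ → cong (λ z → ifz (t ∸ u) 0 (ind z l)) (LT-spec u u<)

    cur : ℕ → ℕ
    cur t = ⟦ curT ⟧ (sL ∷ t ∷ [])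

    opaque
      unfolding curT
      -- Any vote with room will do. The scan keeps the last one, and the default 0 if all votes are
      -- full.
      cur-spec : ∀ t → cur t < n × (∀ l → l < n → cnt t l < k → cnt t (cur t) < k)
      cur-spec t = fold-ind (λ h s → proj₁ s < n × (∀ l → l < h → cnt t l < k → cnt t (proj₁ s) < k)) n
        (>-nonZero⁻¹ n , λ l ()) step′
        where
        step′ : ∀ h (s : ℕ × ℕ) → h < n → proj₁ s < n × (∀ l → l < h → cnt t l < k → cnt t (proj₁ s) < k) →
                let c = ifz (k ∸ ⟦ cntT ⟧ (h ∷ sL ∷ t ∷ [])) (proj₁ s) h in
                c < n × (∀ l → l < suc h → cnt t l < k → cnt t c < k)
        step′ h (c , _) h< (c< , ih) rewrite cntT-spec t h with Tr? (k ∸ cnt t h)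
        ... | inj₁ lt rewrite ifz-Tr {x = k ∸ cnt t h} {c} {h} lt = h< , λ _ _ _ → to lt-spec lt
        ... | inj₂ ¬lt rewrite ifz-¬Tr {x = k ∸ cnt t h} {c} {h} ¬lt =
          c< , below-suc ih λ few → contradiction (from lt-spec few) ¬lt

    opaque
      unfolding chosenT
      chosenT-spec : ∀ t i j → i < n → j < k →
        ⟦ chosenT ⟧ (i ∷ sL ∷ sY ∷ t ∷ j ∷ []) ≡ cand i (pos (best t i) j)
      chosenT-spec t i j i< j< = cand-pos i (best t i) j i< (proj₁ (best-spec t i i<)) j<

    last : ℕ → ℕ
    last zero    = p
    last (suc t) = Y t

    opaque
      unfolding lastT
      lastT-spec : ∀ t → t ≤ N → ⟦ lastT ⟧ (sY ∷ t ∷ []) ≡ last t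
      lastT-spec zero    _ = at-p
      lastT-spec (suc t) t< = YT-spec t t<

    pick : ℕ → ℕ → ℕ
    pick t j = ⟦ pickT ⟧ (sL ∷ sY ∷ t ∷ j ∷ [])

    opaque
      unfolding pickT
      pick-chosen : ∀ t j → j < k → pick t j ≡ cand (cur t) (pos (best t (cur t)) j)
      pick-chosen t j j< = trans (ifz-Tr (from lt-spec j<)) (chosenT-spec t (cur t) j (proj₁ (cur-spec t)) j<)

      pick-last : ∀ t j → t ≤ N → k ≤ j → pick t j ≡ last t
      pick-last t j t≤ j≥ = trans (ifz-¬Tr (≤⇒≯ j≥ ∘ to lt-spec)) (lastT-spec t t≤)

    last< : ∀ t → last t < m
    last< zero    = p<
    last< (suc t) = dig< m sY t

    pick< : ∀ t j → t ≤ N → pick t j < m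
    pick< t j t≤ with j <? k
    ... | yes j< = subst (_< m) (sym (pick-chosen t j j<)) (cand< _ _ (proj₁ (cur-spec t)) (pos< _ j))
    ... | no ge  = subst (_< m) (sym (pick-last t j t≤ (≮⇒≥ ge))) (last< t)

    score′ : ℕ → ℕ
    score′ c = sum (λ l → ⟦ elemT ⟧ (l ∷ best N l ∷ c ∷ [])) n

    opaque
      unfolding scoreT
      scoreT-spec : ∀ c → ⟦ scoreT ⟧ (c ∷ sL ∷ sY ∷ []) ≡ score′ c
      scoreT-spec c = sumT-spec gn (call elemT (arg 2 ∷ call bestT (arg 2 ∷ arg 4 ∷ arg 5 ∷ glob gN ∷ []) ∷ arg 3 ∷ [])) (c ∷ sL ∷ sY ∷ []) _
        λ _ _ _ _ → refl

    Check : Set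
    Check = (∀ l → l < n → Valid N l (best N l)) × (sum (λ l → phi l (best N l)) n ≤ β ×
      (∀ l → l < n → ∀ j → j < k → score′ (cand l (pos (best N l) j)) ≤ score′ p))

    opaque
      unfolding checkT
      checkT-spec : Tr (⟦ checkT ⟧ (sL ∷ sY ∷ [])) ⇔ Check
      checkT-spec = and-spec
        (allT-spec gn (call validT (arg 2 ∷ call bestT (arg 2 ∷ arg 3 ∷ arg 4 ∷ glob gN ∷ []) ∷ arg 3 ∷ arg 4 ∷ glob gN ∷ [])) (sL ∷ sY ∷ []) _
          λ l l< _ _ → validT-spec N l _ l< (proj₁ (best-spec N l l<)))
        (and-spec
          (Tr≡ (cong₂ (λ y z → 1 + y ∸ z) at-β
                 (sumT-spec gn (call phiT (arg 2 ∷ call bestT (arg 2 ∷ arg 3 ∷ arg 4 ∷ glob gN ∷ []) ∷ [])) (sL ∷ sY ∷ []) _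
                   λ l l< _ _ → phiT-spec l _ l< (proj₁ (best-spec N l l<)))) le-spec)
          (allT-spec gn (allT gk
              (leT (call scoreT (call chosenT (arg 5 ∷ arg 6 ∷ arg 7 ∷ glob gN ∷ arg 2 ∷ []) ∷ arg 6 ∷ arg 7 ∷ []))
                   (call scoreT (inp (nat 0) ∷ arg 6 ∷ arg 7 ∷ [])))) (sL ∷ sY ∷ []) _ λ l l< a b →
           allT-spec gk (leT (call scoreT (call chosenT (arg 5 ∷ arg 6 ∷ arg 7 ∷ glob gN ∷ arg 2 ∷ []) ∷ arg 6 ∷ arg 7 ∷ []))
                             (call scoreT (inp (nat 0) ∷ arg 6 ∷ arg 7 ∷ []))) (a ∷ b ∷ l ∷ sL ∷ sY ∷ []) _ λ j j< _ _ →
           Tr≡ (cong₂ (λ y z → 1 + y ∸ z)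
                  (trans (cong (λ c → ⟦ scoreT ⟧ (c ∷ sL ∷ sY ∷ [])) at-p) (scoreT-spec p))
                  (trans (cong (λ c → ⟦ scoreT ⟧ (c ∷ sL ∷ sY ∷ [])) (chosenT-spec N l j l< j<)) (scoreT-spec _)))
               le-spec))

  -- Solutions and the exchange argument

  -- f is the indicator of the candidates to be lifted; pair i r′ r = 0 unless r′ < r.
  Φ : ℕ → (ℕ → ℕ) → ℕ
  Φ i f = sum (λ r → sum (λ r′ → (1 ∸ f (cand i r′)) * (f (cand i r) * pair i r′ r)) m) m

  -- One k-set per vote as a 0/1 matrix, so that the exchange becomes a comparison of row and column
  -- sums.
  record Solution : Set where
    field
      s     : ℕ → ℕ → ℕ
      s≤1   : ∀ l c → s l c ≤ 1
      row   : ∀ l → l < n → sum (s l) m ≡ k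
      cheap : sum (λ l → Φ l (s l)) n ≤ β
      wins  : ∀ c → c < m → sum (λ l → s l c) n ≤ sum (λ l → s l p) n

  Φ-cong : ∀ {i f g} → i < n → (∀ c → c < m → f c ≡ g c) → Φ i f ≡ Φ i g
  Φ-cong {i} i< eq = sum-cong m λ r r< → sum-cong m λ r′ r′< →
    cong₂ (λ a b → (1 ∸ a) * (b * pair i r′ r)) (eq _ (cand< i r′ i< r′<)) (eq _ (cand< i r i< r<))

  mult : ℕ → ℕ → ℕ → ℕ
  mult i x c = count (λ j → cand i (pos x j)) k c

  mult-Elem : ∀ i x c → Tr (mult i x c) ⇔ Elem i x c
  mult-Elem i x c = count-Tr (λ j → cand i (pos x j)) k c

  distinct-injective : ∀ {x} → Distinct x → Injective (pos x) k
  distinct-injective d j j′ j< j′< e with d j j< j′ j′<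
  ... | inj₁ q = q
  ... | inj₂ ne = contradiction e ne

  mult≤1 : ∀ {i x} → i < n → Distinct x → ∀ c → mult i x c ≤ 1
  mult≤1 {i} {x} i< d = count≤1 _ k λ j j′ j< j′< e →
    distinct-injective d j j′ j< j′< (cand-inj i _ _ i< (pos< x j) (pos< x j′) e)

  mult-row : ∀ i x → i < n → sum (mult i x) m ≡ k
  mult-row i x i< = sum-count _ k m λ j _ → cand< i _ i< (pos< x j)

  mult-cand : ∀ i x r → i < n → r < m → mult i x (cand i r) ≡ count (pos x) k r
  mult-cand i x r i< r< = sum-cong k λ j _ → lem (pos x j) (pos< x j)
    where
    lem : ∀ a → a < m → ind (cand i a) (cand i r) ≡ ind a r
    lem a a< with a ≟ r
    ... | yes refl = trans (ind-refl (cand i a)) (sym (ind-refl a))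
    ... | no ne    = trans (ind-≢ (ne ∘ cand-inj i a r i< a< r<)) (sym (ind-≢ ne))

  -- The full lifting cost is split by whether the overtaken position belongs to the set: outside,
  -- it contributes to `Φ`, inside to `B`, which is what `phi` subtracts. So the truncated
  -- subtraction is exact.
  phi-Φ : ∀ i x → i < n → Distinct x → phi i x ≡ Φ i (mult i x)
  phi-Φ i x i< d = begin
    phi i x                ≡⟨ cong₂ _∸_ A≡ B≡ ⟩
    (Φσ + B) ∸ B           ≡⟨ m+n∸n≡m Φσ B ⟩
    Φσ                     ≡⟨ sum-cong m (λ r r< → sum-cong m λ r′ r′< →
                                cong₂ (λ a b → (1 ∸ a) * (b * pair i r′ r)) (mult-cand i x r′ i< r′<) (mult-cand i x r i< r<)) ⟨
    Φ i (mult i x) ∎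
    where
    open ≡-Reasoning
    σ : ℕ → ℕ
    σ = count (pos x) k
    σ≤1 : ∀ r → σ r ≤ 1
    σ≤1 = count≤1 (pos x) k (distinct-injective d)
    Φσ B : ℕ
    Φσ = sum (λ r → sum (λ r′ → (1 ∸ σ r′) * (σ r * pair i r′ r)) m) m
    B = sum (λ r → σ r * sum (λ r′ → σ r′ * pair i r′ r) m) m
    split : ∀ a b q → a ≤ 1 → b * q ≡ (1 ∸ a) * (b * q) + b * (a * q)
    split zero b q _ = sym (trans (cong₂ _+_ (+-identityʳ (b * q)) (*-zeroʳ b)) (+-identityʳ (b * q)))
    split (suc zero) b q _ = cong (b *_) (sym (+-identityʳ q))
    split (suc (suc _)) b q (s≤s ())
    A≡ : sum (λ j → up i (pos x j)) k ≡ Φσ + B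
    A≡ = trans (sum-along (pos x) (up i) k m (λ j _ → pos< x j))
      (trans (sum-cong m λ r _ →
        trans (sym (sum-* (σ r) (λ r′ → pair i r′ r) m))
        (trans (sum-cong m λ r′ _ → split (σ r′) (σ r) (pair i r′ r) (σ≤1 r′))
        (trans (sum-+ _ _ m) (cong (sum (λ r′ → (1 ∸ σ r′) * (σ r * pair i r′ r)) m +_)
          (sum-* (σ r) (λ r′ → σ r′ * pair i r′ r) m)))))
      (sum-+ _ _ m))
    B≡ : sum (λ j → sum (λ j′ → pair i (pos x j′) (pos x j)) k) k ≡ B
    B≡ = trans (sum-cong k λ j _ → sum-along (pos x) (λ r′ → pair i r′ (pos x j)) k m (λ j′ _ → pos< x j′))
      (sum-along (pos x) (λ r → sum (λ r′ → σ r′ * pair i r′ r) m) k m (λ j _ → pos< x j))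

  cand-surj : ∀ i c → i < n → c < m → ∃ λ r → r < m × cand i r ≡ c
  cand-surj i c i< c< = to (count-Tr (cand i) m c) (subst Tr (sym one) tt)
    where
    one : count (cand i) m c ≡ 1
    one = sum-≡ m (λ c _ → count≤1 (cand i) m (λ r r′ r< r′< → cand-inj i r r′ i< r< r′<) c)
      (≤-reflexive (trans (trans (sum-const 1 m) (*-identityʳ m))
        (sym (sum-count (cand i) m m λ r r< → cand< i r i< r<)))) c c<

  -- The scan of tuples misses no k-set: the positions of its members, read as digits in base m,
  -- code it.
  tuple : ∀ i f → i < n → (∀ c → f c ≤ 1) → sum f m ≡ k →
          ∃ λ x → x < m ^ k × Distinct x × (∀ c → c < m → mult i x c ≡ f c)
  tuple i f i< f≤ eq with enumerate (f ∘ cand i) m k (f≤ ∘ cand i)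
    (trans (sum-permuted (cand i) f m (λ r → cand< i r i<) (λ r r′ r< r′< → cand-inj i r r′ i< r< r′<)) eq)
  ... | a , a< , cnt = code m a k , code< m a k a< , distinct , same
    where
    x = code m a k
    pos≡ : ∀ j → j < k → pos x j ≡ a j
    pos≡ = dig-code m a k a<
    inj : Injective a k
    inj = count-injective a k λ j j< → ≤-trans (≤-reflexive (cnt (a j) (a< j j<))) (f≤ _)
    distinct : Distinct x
    distinct j j< j′ j′< with j ≟ j′
    ... | yes e = inj₁ e
    ... | no ne = inj₂ λ e → ne (inj j j′ j< j′< (trans (sym (pos≡ j j<)) (trans e (pos≡ j′ j′<))))
    same : ∀ c → c < m → mult i x c ≡ f c
    same c c< with cand-surj i c i< c<
    ... | r , r< , refl = trans (mult-cand i x r i< r<)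
      (trans (sum-cong k λ j j< → cong (λ z → ind z r) (pos≡ j j<)) (cnt r r<))

  -- The matrix of the first t incidences found, with multiplicity: a repeated incidence gives an
  -- entry above 1.
  chi : (ℕ → ℕ) → (ℕ → ℕ) → ℕ → ℕ → ℕ → ℕ
  chi L Y t l c = sum (λ u → ind (L u) l * ind (Y u) c) t

  Pick : ℕ → ℕ → ℕ → ℕ → ℕ
  Pick sL sY t j = ⟦ pickT ⟧ (sL ∷ sY ∷ t ∷ j ∷ [])

  module Entries (sL sY : ℕ) (sL< : sL < n ^ N) (sY< : sY < m ^ N) where
    open State sL sY sL< sY<

    χ : ℕ → ℕ → ℕ → ℕ
    χ = chi L Y

    entry-χ : ∀ t l c → t ≤ N → Tr (χ t l c) ⇔ Entry t l c
    entry-χ t l c t≤ = mk⇔ there back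
      where
      there : Tr (χ t l c) → Entry t l c
      there tr with sum-lt {λ _ → 0} {λ u → ind (L u) l * ind (Y u) c} t (subst (_< χ t l c) (sym (sum-zero t)) (Tr⇒pos tr))
      ... | u , u< , h with L u ≟ l | Y u ≟ c
      ... | yes e | yes e′ = u , <-≤-trans u< t≤ , u< , e , e′
      ... | no ne | _ = contradiction h (<-irrefl (sym (cong (_* ind (Y u) c) (ind-≢ ne))))
      ... | yes _ | no ne = contradiction h (<-irrefl (sym (trans (cong (ind (L u) l *_) (ind-≢ ne)) (*-zeroʳ (ind (L u) l)))))
      back : Entry t l c → Tr (χ t l c)
      back (u , _ , u< , refl , refl) = Tr-≤ (term≤sum (λ u′ → ind (L u′) (L u) * ind (Y u′) (Y u)) t u<)
        (subst Tr (sym (cong₂ _*_ (ind-refl (L u)) (ind-refl (Y u)))) tt)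

    χ-row : ∀ t l → t ≤ N → sum (χ t l) m ≡ cnt t l
    χ-row t l t≤ = trans (sum-swap (λ c u → ind (L u) l * ind (Y u) c) m t)
      (trans (sum-cong t λ u _ → trans (sum-* (ind (L u) l) (ind (Y u)) m)
        (trans (cong (ind (L u) l *_) (sum-ind1 (Y u) m (dig< m sY u))) (*-identityʳ _)))
      (sym (sum-guard (λ u → ind (L u) l) t N t≤)))

    cnt-total : ∀ t → t ≤ N → sum (cnt t) n ≡ t
    cnt-total t t≤ = trans (sum-cong n λ l _ → sum-guard (λ u → ind (L u) l) t N t≤)
      (sum-count L t n λ u _ → dig< n sL u)

    -- The solution may change from one state to the next. `below` together with `s≤1` also excludes
    -- repeated incidences, so that n k incidences exhaust the solution.
    record Inv (t : ℕ) : Set where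
      field
        solution : Solution
      open Solution solution public
      field
        below    : ∀ l c → l < n → c < m → χ t l c ≤ s l c
        complete : ∀ l c → l < n → c < m → Known t c → c ≢ last t → Tr (s l c) → Tr (χ t l c)

    -- A row compatible with the state is itself coded by a valid tuple, so the scan ends at a valid
    -- tuple that is no dearer.
    best-valid : ∀ t i f → i < n → (∀ c → f c ≤ 1) → sum f m ≡ k → t ≤ N →
      (∀ c → c < m → χ t i c ≤ f c) → (∀ c → c < m → Known t c → Tr (f c) → Tr (χ t i c)) →
      Valid t i (best t i) × Φ i (mult i (best t i)) ≤ Φ i f
    best-valid t i f i< f≤ row t≤ le full with tuple i f i< f≤ row
    ... | x , x< , d , same = proj₁ opt ,
      ≤-trans (≤-reflexive (sym (phi-Φ i _ i< (proj₁ (proj₁ opt)))))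
        (≤-trans (proj₂ opt) (≤-reflexive (trans (phi-Φ i x i< d) (Φ-cong i< same))))
      where
      extends : Extends t i x
      extends u u<N (u< , refl) = to (mult-Elem i x (Y u)) (subst Tr (sym (same (Y u) (dig< m sY u)))
        (Tr-≤ (le (Y u) (dig< m sY u)) (from (entry-χ t i (Y u) t≤) (u , u<N , u< , refl , refl))))
      allowed : ∀ j → j < k → Known t (cand i (pos x j)) → Entry t i (cand i (pos x j))
      allowed j j< kn = let c< = cand< i _ i< (pos< x j) in
        to (entry-χ t i _ t≤) (full _ c< kn (subst Tr (same _ c<) (from (mult-Elem i x _) (j , j< , refl))))
      opt = proj₂ (best-spec t i i<) x x< (d , extends , allowed)

    mult-extends : ∀ t i x c → t ≤ N → Extends t i x → Tr (χ t i c) → Tr (mult i x c)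
    mult-extends t i x c t≤ ext tr with to (entry-χ t i c t≤) tr
    ... | u , u<N , u< , refl , refl = from (mult-Elem i x _) (ext u u<N (u< , refl))

    χ≤1 : ∀ {t} (inv : Inv t) → ∀ l c → l < n → c < m → χ t l c ≤ 1
    χ≤1 inv l c l< c< = ≤-trans (Inv.below inv l c l< c<) (Inv.s≤1 inv l c)

  module _ {sL sY t : ℕ} (t< : t < N) (sL< : sL < n ^ t) (sY< : sY < m ^ t) where
    sL<N : sL < n ^ N
    sL<N = <-≤-trans sL< (^-monoʳ-≤ n (<⇒≤ t<))
    sY<N : sY < m ^ N
    sY<N = <-≤-trans sY< (^-monoʳ-≤ m (<⇒≤ t<))
    open State sL sY sL<N sY<N
    open Entries sL sY sL<N sY<N

    append<N : ∀ b x d {{_ : NonZero b}} → x < b ^ t → d < b → x + b ^ t * d < b ^ N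
    append<N b x d x< d< = <-≤-trans (append< b x d t x< d<) (^-monoʳ-≤ b t<)

    -- After the new incidence y is the last candidate, hence exempt from completeness. Every other
    -- known candidate must be complete by now, the previous last one included unless it is y.
    advance : ∀ l y (l< : l < n) (y< : y < m) (sol : Solution) → let open Solution sol in
      (∀ l′ c → l′ < n → c < m → χ t l′ c + ind l l′ * ind y c ≤ s l′ c) →
      (∀ l′ c → l′ < n → c < m → Known t c → c ≢ y → Tr (s l′ c) → Tr (χ t l′ c)) →
      Entries.Inv (sL + n ^ t * l) (sY + m ^ t * y) (append<N n sL l sL< l<) (append<N m sY y sY< y<) (suc t)
    advance l y l< y< sol le full = record
      { solution = sol
      ; below    = λ l′ c l′< c< → ≤-trans (≤-reflexive (χ′≡ l′ c)) (le l′ c l′< c<)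
      ; complete = λ l′ c l′< c< kn ne tr → Tr-≤ (≤-trans (m≤m+n _ _) (≤-reflexive (sym (χ′≡ l′ c))))
          (full l′ c l′< c< (known kn ne) (λ e → ne (trans e (sym top))) tr) }
      where
      module S′ = State (sL + n ^ t * l) (sY + m ^ t * y) (append<N n sL l sL< l<) (append<N m sY y sY< y<)
      top : S′.Y t ≡ y
      top = dig-top m sY y t sY< y<
      χ′≡ : ∀ l′ c → chi S′.L S′.Y (suc t) l′ c ≡ chi L Y t l′ c + ind l l′ * ind y c
      χ′≡ l′ c = cong₂ _+_
        (sum-cong t λ u u< → cong₂ (λ a b → ind a l′ * ind b c) (dig-low n sL l t u u<) (dig-low m sY y t u u<))
        (cong₂ (λ a b → ind a l′ * ind b c) (dig-top n sL l t sL< l<) top)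
      known : ∀ {c} → S′.Known (suc t) c → c ≢ S′.Y t → Known t c
      known (inj₁ e) _ = inj₁ e
      known (inj₂ (u , u<N , u< , e)) ne with m≤n⇒m<n∨m≡n (s≤s⁻¹ u<)
      ... | inj₁ l    = inj₂ (u , u<N , l , trans (sym (dig-low m sY y t u l)) e)
      ... | inj₂ refl = contradiction (sym e) ne

    Goal : Set
    Goal = ∃ λ l → ∃ λ j → Σ (l < n) λ l< → j < suc k × Σ (Pick sL sY t j < m) λ y< →
      Entries.Inv (sL + n ^ t * l) (sY + m ^ t * Pick sL sY t j) (append<N n sL l sL< l<) (append<N m sY _ sY< y<) (suc t)

    private
      χₜ : ℕ → ℕ → ℕ
      χₜ = χ t

    χ-unknown : ∀ {c} l → ¬ Known t c → χₜ l c ≡ 0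
    χ-unknown {c} l un = ¬Tr⇒0 λ tr → let u , u<N , u< , _ , e = to (entry-χ t l c (<⇒≤ t<)) tr in
      un (inj₂ (u , u<N , u< , e))

    add-ok : ∀ {l y} (f : ℕ → ℕ → ℕ) → (∀ l′ c → l′ < n → c < m → χₜ l′ c ≤ f l′ c) →
      χₜ l y ≡ 0 → Tr (f l y) →
      ∀ l′ c → l′ < n → c < m → χₜ l′ c + ind l l′ * ind y c ≤ f l′ c
    add-ok {l} {y} f le z tr l′ c l′< c< with l ≟ l′ | y ≟ c
    ... | yes refl | yes refl = ≤-trans (≤-reflexive (cong₂ _+_ z (cong₂ _*_ (ind-refl l) (ind-refl y)))) (Tr⇒pos tr)
    ... | no ne | _ = ≤-trans (≤-reflexive (trans (cong (λ a → χₜ l′ c + a * ind y c) (ind-≢ ne)) (+-identityʳ _))) (le l′ c l′< c<)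
    ... | yes _ | no ne = ≤-trans (≤-reflexive (trans (cong (λ a → χₜ l′ c + ind l l′ * a) (ind-≢ ne))
            (trans (cong (χₜ l′ c +_) (*-zeroʳ (ind l l′))) (+-identityʳ _)))) (le l′ c l′< c<)

    module Complete (inv : Inv t)
                    (full : ∀ l → l < n → Inv.s inv l (last t) ≤ χₜ l (last t)) where
      open Inv inv

      complete′ : ∀ l c → l < n → c < m → Known t c → Tr (s l c) → Tr (χₜ l c)
      complete′ l c l< c< kn tr with c ≟ last t
      ... | yes refl = Tr-≤ (full l l<) tr
      ... | no ne    = complete l c l< c< kn ne tr

      i x : ℕ
      i = cur t
      x = best t i

      i< : i < n
      i< = proj₁ (cur-spec t)

      -- Pigeonhole: t < n k incidences cannot give each of the n votes k of them.
      cnt< : cnt t i < k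
      cnt< = let l , l< , lt = sum-lt {cnt t} {λ _ → k} n (subst₂ _<_ (sym (cnt-total t (<⇒≤ t<))) (sym (sum-const k n)) t<) in
        proj₂ (cur-spec t) l l< lt

      best-ok : Valid t i x × Φ i (mult i x) ≤ Φ i (s i)
      best-ok = best-valid t i (s i) i< (s≤1 i) (row i i<) (<⇒≤ t<)
        (λ c → below i c i<) (λ c → complete′ i c i<)

      f : ℕ → ℕ
      f = mult i x

      f≤1 : ∀ c → f c ≤ 1
      f≤1 = mult≤1 i< (proj₁ (proj₁ best-ok))

      χ≤f : ∀ c → c < m → χₜ i c ≤ f c
      χ≤f c c< = ≤-from-Tr (χ≤1 inv i c i< c<)
        (mult-extends t i x c (<⇒≤ t<) (proj₁ (proj₂ (proj₁ best-ok))))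

      f-known : ∀ c → Known t c → Tr (f c) → Tr (χₜ i c)
      f-known c kn tr with to (mult-Elem i x c) tr
      ... | j , j< , refl = from (entry-χ t i _ (<⇒≤ t<)) (proj₂ (proj₂ (proj₁ best-ok)) j j< kn)

      -- A valid set meets the known candidates only in recorded incidences, so a member not
      -- recorded for i is unknown.
      fresh-unknown : ∀ {c} → χₜ i c < f c → ¬ Known t c
      fresh-unknown {c} lt kn = <⇒≱ lt (≤-from-Tr (f≤1 c) (f-known c kn))

      choose : ∀ {c} → χₜ i c < f c → ∃ λ j → j < k × Pick sL sY t j ≡ c
      choose {c} lt = let j , j< , e = to (mult-Elem i x c) (pos⇒Tr (≤-<-trans z≤n lt)) in
        j , j< , trans (pick-chosen t j j<) e

      finish : ∀ l c → l < n → c < m → χₜ i c < f c → (sol : Solution) → let open Solution sol renaming (s to s′) in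
        (∀ l′ c′ → l′ < n → c′ < m → χₜ l′ c′ ≤ s′ l′ c′) → Tr (s′ l c) →
        (∀ l′ c′ → l′ < n → c′ < m → Known t c′ → Tr (s′ l′ c′) → Tr (χₜ l′ c′)) → Goal
      finish l c l< c< lt sol le tr full′ with choose {c} lt
      ... | j , j< , refl = l , j , l< , m≤n⇒m≤1+n j< , c< ,
        advance l c l< c< sol (add-ok (Solution.s sol) le (χ-unknown l (fresh-unknown {Pick sL sY t j} lt)) tr)
          (λ l′ c′ l′< c′< kn _ → full′ l′ c′ l′< c′< kn)

      Elsewhere : ℕ → ℕ → Set
      Elsewhere c l = χₜ i c < f c × l ≢ i × Tr (s l c)

      elsewhere? : ∀ c → Dec (∃ λ l → l < n × Elsewhere c l)
      elsewhere? c with search (λ l → (χₜ i c <? f c) ×-dec (¬? (l ≟ i) ×-dec Tr-dec (s l c))) n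
      ... | inj₁ found = yes found
      ... | inj₂ none  = no λ (l , l< , e) → none l l< e

      -- No fresh candidate of the best tuple is used elsewhere, so it can replace row i.
      module Exchange (alone : ∀ c → c < m → ¬ (∃ λ l → l < n × Elsewhere c l)) where
        s′ : ℕ → ℕ → ℕ
        s′ l with l ≟ i
        ... | yes _ = f
        ... | no _  = s l

        s′-i : ∀ c → s′ i c ≡ f c
        s′-i c with i ≟ i
        ... | yes _ = refl
        ... | no ne = contradiction refl ne

        -- p is known, and on known candidates both the old and the new row agree with the recorded
        -- incidences. So the exchange leaves the score of p alone.
        f-p : f p ≡ s i p
        f-p = ≤-antisym
          (≤-from-Tr (f≤1 p) λ tr → Tr-≤ (below i p i< p<) (f-known p (inj₁ refl) tr))
          (≤-from-Tr (s≤1 i p) λ tr → Tr-≤ (χ≤f p p<) (complete′ i p i< p< (inj₁ refl) tr))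

        score-p : sum (λ l → s′ l p) n ≡ sum (λ l → s l p) n
        score-p = sum-cong n λ l _ → same l
          where
          same : ∀ l → s′ l p ≡ s l p
          same l with l ≟ i
          ... | yes refl = f-p
          ... | no _     = refl

        -- Here k ≥ 1 enters: row i has a member, and p scores at least as much as that member.
        1≤score : 1 ≤ sum (λ l → s l p) n
        1≤score with sum-lt {λ _ → 0} {s i} m (subst₂ _<_ (sym (sum-zero m)) (sym (row i i<)) (>-nonZero⁻¹ k))
        ... | c , c< , lt = ≤-trans (≤-trans lt (term≤sum (λ l → s l c) n i<)) (wins c c<)

        solution′ : Solution
        solution′ = record
          { s     = s′
          ; s≤1   = s′≤1
          ; row   = row′
          ; cheap = ≤-trans (sum-mono n λ l _ → cheaper l) cheap
          ; wins  = λ c c< → ≤-trans (wins′ c c<) (≤-reflexive (sym score-p)) }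
          where
          s′≤1 : ∀ l c → s′ l c ≤ 1
          s′≤1 l c with l ≟ i
          ... | yes _ = f≤1 c
          ... | no _  = s≤1 l c
          row′ : ∀ l → l < n → sum (s′ l) m ≡ k
          row′ l l< with l ≟ i
          ... | yes _ = mult-row i x i<
          ... | no _  = row l l<
          cheaper : ∀ l → Φ l (s′ l) ≤ Φ l (s l)
          cheaper l with l ≟ i
          ... | yes refl = proj₂ best-ok
          ... | no _     = ≤-refl
          wins′ : ∀ c → c < m → sum (λ l → s′ l c) n ≤ sum (λ l → s l p) n
          wins′ c c< with f c ≤? s i c
          -- If the new row does not add c, the score of c does not rise.
          ... | yes le = ≤-trans (sum-mono n λ l _ → smaller l) (wins c c<)
            where
            smaller : ∀ l → s′ l c ≤ s l c
            smaller l with l ≟ i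
            ... | yes refl = le
            ... | no _     = ≤-refl
          -- Otherwise c is a fresh member used in no other vote, so its column is at most the
          -- indicator of i.
          ... | no ¬le = ≤-trans (≤-trans (sum-mono n single) (≤-reflexive (sum-ind1 i n i<))) 1≤score
            where
            single : ∀ l → l < n → s′ l c ≤ ind i l
            single l l< with l ≟ i
            ... | yes refl = ≤-trans (f≤1 c) (≤-reflexive (sym (ind-refl i)))
            ... | no ne    = ≤-trans (≤-reflexive (¬Tr⇒0 λ tr →
              alone c c< (l , l< , ≤-<-trans (below i c i< c<) (≰⇒> ¬le) , ne , tr))) z≤n

        goal : Goal
        -- The state has fewer than k incidences for i and the new set has k members, so some member
        -- is fresh; it is assigned to i itself.
        goal with sum-lt {χₜ i} {f} m (subst₂ _<_ (sym (χ-row t i (<⇒≤ t<))) (sym (mult-row i x i<)) cnt<)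
        ... | c , c< , lt = finish i c i< c< lt solution′ below′ (subst Tr (sym (s′-i c)) (pos⇒Tr (≤-<-trans z≤n lt))) full′
          where
          below′ : ∀ l c → l < n → c < m → χₜ l c ≤ s′ l c
          below′ l c l< c< with l ≟ i
          ... | yes refl = χ≤f c c<
          ... | no _     = below l c l< c<
          full′ : ∀ l c → l < n → c < m → Known t c → Tr (s′ l c) → Tr (χₜ l c)
          full′ l c l< c< kn tr with l ≟ i
          ... | yes refl = f-known c kn tr
          ... | no _     = complete′ l c l< c< kn tr

      goal : Goal
      goal with search elsewhere? m
      ... | inj₁ (c , c< , l , l< , lt , _ , tr) = finish l c l< c< lt solution below tr complete′
      ... | inj₂ alone = Exchange.goal alone

    progress : Inv t → Goal
    -- Such a vote l uses the last candidate in the solution but not yet in the state; the guess j =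
    -- k records it. Without such a vote the last candidate is complete too.
    progress inv with search (λ l → χₜ l (last t) <? Inv.s inv l (last t)) n
    ... | inj₂ none = Complete.goal inv λ l l< → ≮⇒≥ (none l l<)
    ... | inj₁ (l , l< , lt) = l , k , l< , ≤-refl , subst (_< m) (sym pick≡) (last< t) , finished
      where
      open Inv inv
      pick≡ : Pick sL sY t k ≡ last t
      pick≡ = pick-last t k (<⇒≤ t<) ≤-refl
      keep : ∀ y (y< : y < m) → y ≡ last t →
        Entries.Inv (sL + n ^ t * l) (sY + m ^ t * y) (append<N n sL l sL< l<) (append<N m sY y sY< y<) (suc t)
      keep y y< refl = advance l y l< y< solution
        (add-ok s below (n<1⇒n≡0 (≤-trans lt (s≤1 l y))) (pos⇒Tr (≤-<-trans z≤n lt)))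
        complete
      finished = keep (Pick sL sY t k) (subst (_< m) (sym pick≡) (last< t)) pick≡

  -- From good guesses to acceptance, and back to a solution

  next-state : ℕ → ℕ → ℕ → ℕ × ℕ → ℕ × ℕ
  next-state xL xJ t s =
    proj₁ s + ⟦ timesT gn ⟧ (⟦ LT ⟧ (xL ∷ t ∷ []) ∷ ⟦ powT gn gN ⟧ (t ∷ []) ∷ []) ,
    proj₂ s + ⟦ timesT gm ⟧ (Pick (proj₁ s) (proj₂ s) t (⟦ JT ⟧ (xJ ∷ t ∷ [])) ∷ ⟦ powT gm gN ⟧ (t ∷ []) ∷ [])

  state : ℕ → ℕ → ℕ → ℕ × ℕ
  state xL xJ = fold (next-state xL xJ) (0 , 0)

  opaque
    unfolding runT
    runT-spec : ∀ xL xJ → ⟦ runT ⟧ (xL ∷ xJ ∷ []) ≡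
      ⟦ checkT ⟧ (proj₁ (state xL xJ N) ∷ proj₂ (state xL xJ N) ∷ [])
    runT-spec xL xJ = refl

  module _ (xL xJ : ℕ) (xL< : xL < n ^ N) (xJ< : xJ < suc k ^ N) where
    next-state-spec : ∀ t sL sY → t < N → sL < n ^ t → sY < m ^ t →
      let y = Pick sL sY t (dig (suc k) xJ t) in
      y < m × next-state xL xJ t (sL , sY) ≡ (sL + n ^ t * dig n xL t , sY + m ^ t * y)
    next-state-spec t sL sY t< sL< sY< = y< , cong₂ _,_
      (cong (sL +_) (trans (cong₂ (λ a b → ⟦ timesT gn ⟧ (a ∷ b ∷ [])) (digT-spec gn gN xL t xL< t<) (powT-spec gn gN t (<⇒≤ t<)))
        (trans (timesT-spec gn _ _ (<⇒≤ (dig< n xL t))) (*-comm (dig n xL t) (n ^ t)))))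
      (cong (sY +_) (trans (cong₂ (λ a b → ⟦ timesT gm ⟧ (a ∷ b ∷ [])) (cong (Pick sL sY t) (digT-spec gk1 gN xJ t xJ< t<)) (powT-spec gm gN t (<⇒≤ t<)))
        (trans (timesT-spec gm y _ (<⇒≤ y<)) (*-comm y (m ^ t)))))
      where
      y = Pick sL sY t (dig (suc k) xJ t)
      y< : y < m
      y< = State.pick< sL sY (sL<N t< sL< sY<) (sY<N t< sL< sY<) t _ (<⇒≤ t<)

    state< : ∀ t → t ≤ N → proj₁ (state xL xJ t) < n ^ t × proj₂ (state xL xJ t) < m ^ t
    state< zero    _  = z<s , z<s
    state< (suc t) t< with state xL xJ t | state< t (<⇒≤ t<)
    ... | sL , sY | sL< , sY< =
      let y< , eq = next-state-spec t sL sY t< sL< sY< in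
      subst (λ s → proj₁ s < n ^ suc t × proj₂ s < m ^ suc t) (sym eq)
        (append< n sL _ t sL< (dig< n xL t) , append< m sY _ t sY< y<)

  opaque
    unfolding mainT
    mainT-spec : Tr (⟦ mainT ⟧ []) ⇔
      (∃ λ xL → xL < n ^ N × (∃ λ xJ → xJ < suc k ^ N × Tr (⟦ runT ⟧ (xL ∷ xJ ∷ []))))
    mainT-spec = anyT-spec gL (anyT gJ (call runT (arg 5 ∷ arg 2 ∷ []))) [] _ λ xL xL< a b →
      anyT-spec gJ (call runT (arg 5 ∷ arg 2 ∷ [])) (a ∷ b ∷ xL ∷ []) _ λ xJ xJ< _ _ → mk⇔ id id

  -- The guesses leading to a state are collected in it: sL and sJ.
  data Path : ℕ → ℕ → ℕ → ℕ → Set where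
    empty  : Path 0 0 0 0
    extend : ∀ {t sL sY sJ} → Path t sL sY sJ → ∀ l j → l < n → j < suc k →
             Path (suc t) (sL + n ^ t * l) (sY + m ^ t * Pick sL sY t j) (sJ + suc k ^ t * j)

  path-bounds : ∀ {t sL sY sJ} → t ≤ N → Path t sL sY sJ → sL < n ^ t × sY < m ^ t × sJ < suc k ^ t
  path-bounds _ empty = z<s , z<s , z<s
  path-bounds {suc t} t< (extend {sL = sL} {sY} {sJ} path l j l< j<) with path-bounds (<⇒≤ t<) path
  ... | sL< , sY< , sJ< = append< n sL l t sL< l< ,
    append< m sY _ t sY< (State.pick< sL sY (sL<N t< sL< sY<) (sY<N t< sL< sY<) t _ (<⇒≤ t<)) ,
    append< (suc k) sJ j t sJ< j<

  append-assoc : ∀ b x t d h → x + b ^ t * d + b ^ suc t * h ≡ x + b ^ t * (d + b * h)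
  append-assoc b x t d h = trans (+-assoc x (b ^ t * d) (b ^ suc t * h)) (cong (x +_)
    (trans (cong (b ^ t * d +_) (trans (cong (_* h) (*-comm b (b ^ t))) (*-assoc (b ^ t) b h))) (sym (*-distribˡ-+ (b ^ t) d (b * h)))))

  -- `state` reads digits of the complete guesses, so the induction must allow arbitrary digits `hL`
  -- and `hJ` above those collected so far.
  path-state : ∀ {t sL sY sJ} → t ≤ N → Path t sL sY sJ → ∀ hL hJ xL xJ → xL < n ^ N → xJ < suc k ^ N →
    xL ≡ sL + n ^ t * hL → xJ ≡ sJ + suc k ^ t * hJ → state xL xJ t ≡ (sL , sY)
  path-state _ empty _ _ _ _ _ _ _ _ = refl
  path-state {suc t} t< (extend {sL = sL} {sY} {sJ} path l j l< j<) hL hJ xL xJ xL< xJ< refl refl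
    with path-bounds (<⇒≤ t<) path
  ... | sL< , sY< , sJ< = trans (cong (next-state xL xJ t)
      (path-state (<⇒≤ t<) path (l + n * hL) (j + suc k * hJ) xL xJ xL< xJ< eL eJ))
    (trans (proj₂ (next-state-spec xL xJ xL< xJ< t sL sY t< sL< sY<))
      (cong₂ (λ a b → (sL + n ^ t * a , sY + m ^ t * Pick sL sY t b))
        (trans (cong (λ z → dig n z t) eL) (dig-eq n sL t l hL sL< l<))
        (trans (cong (λ z → dig (suc k) z t) eJ) (dig-eq (suc k) sJ t j hJ sJ< j<))))
    where
    eL : xL ≡ sL + n ^ t * (l + n * hL)
    eL = append-assoc n sL t l hL
    eJ : xJ ≡ sJ + suc k ^ t * (j + suc k * hJ)
    eJ = append-assoc (suc k) sJ t j hJ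

  Reached : ℕ → Set
  Reached t = ∃ λ sL → ∃ λ sY → ∃ λ sJ → Path t sL sY sJ ×
    ∃ λ sL< → ∃ λ sY< → Entries.Inv sL sY sL< sY< t

  reach : Solution → ∀ t → t ≤ N → Reached t
  -- At the start p is the only known candidate and also the last one, so completeness asks nothing.
  reach sol zero _ = 0 , 0 , 0 , empty , m^n>0 n N , m^n>0 m N , record
    { solution = sol
    ; below    = λ _ _ _ _ → z≤n
    ; complete = λ { _ _ _ _ (inj₁ e) ne _ → contradiction e ne ; _ _ _ _ (inj₂ (_ , _ , () , _)) } }
  reach sol (suc t) t< with reach sol t (<⇒≤ t<)
  ... | sL , sY , sJ , path , _ , _ , inv with path-bounds (<⇒≤ t<) path
  ... | sL< , sY< , _ with progress t< sL< sY< (subst₂ (λ a b → Entries.Inv sL sY a b t) (<-irrelevant _ _) (<-irrelevant _ _) inv)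
  ... | l , j , l< , j< , y< , inv′ = _ , _ , _ , extend path l j l< j< , _ , _ , inv′

  module _ (sL sY : ℕ) (sL< : sL < n ^ N) (sY< : sY < m ^ N) where
    open State sL sY sL< sY<
    open Entries sL sY sL< sY<

    01-≡ : ∀ {x y} → x ≤ 1 → y ≤ 1 → (Tr x → Tr y) → (Tr y → Tr x) → x ≡ y
    01-≡ x≤ y≤ f g = ≤-antisym (≤-from-Tr x≤ f) (≤-from-Tr y≤ g)

    score-mult : (∀ l → l < n → Valid N l (best N l)) → ∀ c →
                 score′ c ≡ sum (λ l → mult l (best N l) c) n
    score-mult valid c = sum-cong n λ l l< →
      let e = elemT-spec l (best N l) c l< (proj₁ (best-spec N l l<)) in
      01-≡ (elemT-01 l _ c) (mult≤1 l< (proj₁ (valid l l<)) c)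
        (from (mult-Elem l _ c) ∘ to e) (from e ∘ to (mult-Elem l _ c))

    -- The sets tested by the check form a solution however the state arose. Comparing their members
    -- with p is enough, since a candidate in no set scores 0.
    check-sound : Check → Solution
    check-sound (valid , budget , winner) = record
      { s     = s
      ; s≤1   = s≤1
      ; row   = λ l l< → trans (s-row l l<) (mult-row l (best N l) l<)
      ; cheap = ≤-trans (≤-reflexive (sum-cong n λ l l< →
                  trans (Φ-cong l< λ c _ → s≡ l c l<) (sym (phi-Φ l _ l< (proj₁ (valid l l<)))))) budget
      ; wins  = wins }
      where
      -- Cut to 0 beyond n because `s≤1` is demanded of every row, while validity is known for the
      -- actual votes only.
      s : ℕ → ℕ → ℕ
      s l c with l <? n
      ... | yes _ = mult l (best N l) c
      ... | no _  = 0
      s≡ : ∀ l c → l < n → s l c ≡ mult l (best N l) c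
      s≡ l c l< with l <? n
      ... | yes _ = refl
      ... | no ≮  = contradiction l< ≮
      s≤1 : ∀ l c → s l c ≤ 1
      s≤1 l c with l <? n
      ... | yes l< = mult≤1 l< (proj₁ (valid l l<)) c
      ... | no _   = z≤n
      s-row : ∀ l → l < n → sum (s l) m ≡ sum (mult l (best N l)) m
      s-row l l< = sum-cong m λ c _ → s≡ l c l<
      score≡ : ∀ c → sum (λ l → s l c) n ≡ score′ c
      score≡ c = trans (sum-cong n λ l l< → s≡ l c l<) (sym (score-mult valid c))
      wins : ∀ c → c < m → sum (λ l → s l c) n ≤ sum (λ l → s l p) n
      wins c c< with search (λ l → Tr-dec (mult l (best N l) c)) n
      ... | inj₁ (l , l< , tr) with to (mult-Elem l _ c) tr
      ... | j , j< , refl = subst₂ _≤_ (sym (score≡ _)) (sym (score≡ p)) (winner l l< j j<)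
      wins c c< | inj₂ none = ≤-trans (≤-reflexive (trans (sum-cong n λ l l< →
        trans (s≡ l c l<) (¬Tr⇒0 (none l l<))) (sum-zero n))) z≤n

    -- n rows of at most k incidences with total n k are all full, so `χ` is the solution itself.
    -- The best set of each vote contains its row of `χ` and has the same size, hence equals it.
    check-complete : Inv N → Check
    check-complete inv = valid ,
      ≤-trans (sum-mono n λ l l< → ≤-trans (≤-reflexive (phi-Φ l _ l< (proj₁ (valid l l<)))) (proj₂ (ok l l<))) cheap ,
      λ l l< j j< → let c< = cand< l _ l< (pos< (best N l) j) in
        subst₂ _≤_ (sym (score≡ _ c<)) (sym (score≡ p p<)) (wins _ c<)
      where
      open Inv inv
      rows : ∀ l → l < n → cnt N l ≡ k
      rows = sum-≡ n (λ l l< → ≤-trans (≤-reflexive (sym (χ-row N l ≤-refl)))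
          (≤-trans (sum-mono m λ c → below l c l<) (≤-reflexive (row l l<))))
        (≤-reflexive (trans (sum-const k n) (sym (cnt-total N ≤-refl))))
      χ≡s : ∀ l → l < n → ∀ c → c < m → χ N l c ≡ s l c
      χ≡s l l< = sum-≡ m (λ c → below l c l<)
        (≤-reflexive (trans (row l l<) (sym (trans (χ-row N l ≤-refl) (rows l l<)))))
      ok : ∀ l → l < n → Valid N l (best N l) × Φ l (mult l (best N l)) ≤ Φ l (s l)
      ok l l< = best-valid N l (s l) l< (s≤1 l) (row l l<) ≤-refl
        (λ c → below l c l<) (λ c c< _ → subst Tr (sym (χ≡s l l< c c<)))
      valid : ∀ l → l < n → Valid N l (best N l)
      valid l l< = proj₁ (ok l l<)
      mult≡s : ∀ l → l < n → ∀ c → c < m → s l c ≡ mult l (best N l) c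
      mult≡s l l< = sum-≡ m (λ c c< → ≤-from-Tr (s≤1 l c) λ tr →
          mult-extends N l (best N l) c ≤-refl (proj₁ (proj₂ (valid l l<))) (subst Tr (sym (χ≡s l l< c c<)) tr))
        (≤-reflexive (trans (mult-row l (best N l) l<) (sym (row l l<))))
      score≡ : ∀ c → c < m → score′ c ≡ sum (λ l → s l c) n
      score≡ c c< = trans (score-mult valid c) (sum-cong n λ l l< → sym (mult≡s l l< c c<))

  decides : Tr (⟦ mainT ⟧ []) ⇔ Solution
  decides = mk⇔ sound complete
    where
    sound : Tr (⟦ mainT ⟧ []) → Solution
    sound tr with to mainT-spec tr
    ... | xL , xL< , xJ , xJ< , tr′ with state xL xJ N | state< xL xJ xL< xJ< N ≤-refl | subst Tr (runT-spec xL xJ) tr′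
    ... | sL , sY | sL< , sY< | tr″ = check-sound sL sY sL< sY< (to (State.checkT-spec sL sY sL< sY<) tr″)
    complete : Solution → Tr (⟦ mainT ⟧ [])
    complete sol with reach sol N ≤-refl
    ... | sL , sY , sJ , path , sL< , sY< , inv with path-bounds ≤-refl path
    ... | xL< , _ , xJ< = from mainT-spec (sL , xL< , sJ , xJ< , subst Tr (sym
        (trans (runT-spec sL sJ) (cong (λ s → ⟦ checkT ⟧ (proj₁ s ∷ proj₂ s ∷ []))
          (path-state ≤-refl path 0 0 sL sJ xL< xJ< (zero-high n sL) (zero-high (suc k) sJ)))))
        (from (State.checkT-spec sL sY sL< sY<) (check-complete sL sY sL< sY< inv)))
      where
      zero-high : ∀ b x → x ≡ x + b ^ N * 0
      zero-high b x = sym (trans (cong (x +_) (*-zeroʳ (b ^ N))) (+-identityʳ x))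

-- Swaps and potentials

∑-cong : ∀ {n} {f g : Fin n → ℕ} → (∀ i → f i ≡ g i) → ∑ f ≡ ∑ g
∑-cong {zero}  eq = refl
∑-cong {suc n} eq = cong₂ _+_ (eq Fin.zero) (∑-cong (eq ∘ Fin.suc))

∑-mono : ∀ {n} {f g : Fin n → ℕ} → (∀ i → f i ≤ g i) → ∑ f ≤ ∑ g
∑-mono {zero}  le = z≤n
∑-mono {suc n} le = +-mono-≤ (le Fin.zero) (∑-mono (le ∘ Fin.suc))

∑-zero : ∀ n → ∑ {n} (λ _ → 0) ≡ 0
∑-zero zero    = refl
∑-zero (suc n) = ∑-zero n

-- For a sum in which one index is exceptional; applied twice, it isolates one entry of a double
-- sum.
∑-bump : ∀ {n} {f g : Fin n → ℕ} {c} i → (∀ j → j ≢ i → f j ≤ g j) → f i ≤ c + g i → ∑ f ≤ c + ∑ g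
∑-bump {suc n} {f} {g} {c} Fin.zero le le′ = ≤-trans (+-mono-≤ le′ (∑-mono λ j → le (Fin.suc j) λ ()))
  (≤-reflexive (+-assoc c _ _))
∑-bump {suc n} {f} {g} {c} (Fin.suc i) le le′ = ≤-trans (+-mono-≤ (le Fin.zero λ ())
    (∑-bump i (λ j ne → le (Fin.suc j) (ne ∘ Fin.suc-injective)) le′))
  (≤-reflexive (trans (sym (+-assoc (g Fin.zero) c _)) (trans (cong (_+ ∑ (g ∘ Fin.suc)) (+-comm (g Fin.zero) c)) (+-assoc c _ _))))

∑-drop : ∀ {n} {f g : Fin n → ℕ} {c} i → (∀ j → j ≢ i → g j ≤ f j) → c + g i ≤ f i → c + ∑ g ≤ ∑ f
∑-drop {suc n} {f} {g} {c} Fin.zero le le′ = ≤-trans (≤-reflexive (sym (+-assoc c _ _)))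
  (+-mono-≤ le′ (∑-mono λ j → le (Fin.suc j) λ ()))
∑-drop {suc n} {f} {g} {c} (Fin.suc i) le le′ = ≤-trans
  (≤-reflexive (trans (sym (+-assoc c (g Fin.zero) _)) (trans (cong (_+ ∑ (g ∘ Fin.suc)) (+-comm c (g Fin.zero))) (+-assoc (g Fin.zero) c _))))
  (+-mono-≤ (le Fin.zero λ ()) (∑-drop i (λ j ne → le (Fin.suc j) (ne ∘ Fin.suc-injective)) le′))

∑-≡ : ∀ {n} {f g : Fin n → ℕ} → (∀ i → f i ≤ g i) → ∑ g ≤ ∑ f → ∀ i → f i ≡ g i
∑-≡ {suc n} {f} {g} le ge Fin.zero = ≤-antisym (le Fin.zero)
  (+-cancelʳ-≤ (∑ (f ∘ Fin.suc)) _ _ (≤-trans (+-monoʳ-≤ (g Fin.zero) (∑-mono (le ∘ Fin.suc))) ge))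
∑-≡ {suc n} {f} {g} le ge (Fin.suc i) = ∑-≡ (le ∘ Fin.suc)
  (+-cancelˡ-≤ (f Fin.zero) _ _ (≤-trans (+-monoˡ-≤ _ (le Fin.zero)) ge)) i

module _ {m : ℕ} where
  place : Vote m → Fin m → ℕ
  place v c = toℕ (v ⟨$⟩ʳ c)

  place-injective : ∀ v {c d} → place v c ≡ place v d → c ≡ d
  place-injective v e = trans (sym (inverseˡ v)) (trans (cong (v ⟨$⟩ˡ_) (Fin.toℕ-injective e)) (inverseˡ v))

  module _ {v : Vote m} {a b : Fin m} (adm : Admissible (a , b) v) where
    private
      v′ : Vote m
      v′ = applySwap (a , b) v

    adj : place v b ≡ suc (place v a)
    adj = sym (suc-injective adm)

    a≢b : a ≢ b
    a≢b e = 1+n≢n (trans (sym adj) (cong (place v) (sym e)))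

    place-a : place v′ a ≡ place v b
    place-a rewrite dec-true (a Fin.≟ a) refl = refl

    place-b : place v′ b ≡ place v a
    place-b rewrite dec-false (b Fin.≟ a) (a≢b ∘ sym) | dec-true (b Fin.≟ b) refl = refl

    place-c : ∀ {c} → c ≢ a → c ≢ b → place v′ c ≡ place v c
    place-c {c} na nb rewrite dec-false (c Fin.≟ a) na | dec-false (c Fin.≟ b) nb = refl

    -- An adjacent swap seen through positions alone: with the positions before and after as
    -- indices, comparing two candidates is arithmetic near `place v a`.
    data Which (c : Fin m) : ℕ → ℕ → Set where
      is-a  : c ≡ a → Which c (place v a) (suc (place v a))
      is-b  : c ≡ b → Which c (suc (place v a)) (place v a)
      other : ∀ {x} → x ≢ place v a → x ≢ suc (place v a) → Which c x x

    which : ∀ c → Which c (place v c) (place v′ c)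
    which c = go (c Fin.≟ a) (c Fin.≟ b)
      where
      go : Dec (c ≡ a) → Dec (c ≡ b) → Which c (place v c) (place v′ c)
      go (yes e) _ = subst₂ (Which c) (cong (place v) (sym e))
        (sym (trans (cong (place v′) e) (trans place-a adj))) (is-a e)
      go (no _) (yes e) = subst₂ (Which c) (sym (trans (cong (place v) e) adj))
        (sym (trans (cong (place v′) e) place-b)) (is-b e)
      go (no na) (no nb) = subst (Which c (place v c)) (sym (place-c na nb))
        (other (na ∘ place-injective v) (λ e → nb (place-injective v (trans e (sym adj)))))

    swap-keeps : ∀ {c d} → place v c < place v d → (c ≡ a × d ≡ b) ⊎ place v′ c < place v′ d
    swap-keeps {c} {d} lt = go (which c) (which d) lt
      where
      go : ∀ {x x′ y y′} → Which c x x′ → Which d y y′ → x < y → (c ≡ a × d ≡ b) ⊎ x′ < y′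
      go (is-a _)    (is-a _)    l = contradiction l (<-irrefl refl)
      go (is-a e)    (is-b e′)   l = inj₁ (e , e′)
      go (is-a _)    (other _ n) l = inj₂ (≤∧≢⇒< l (n ∘ sym))
      go (is-b _)    (is-a _)    l = contradiction l (<⇒≯ ≤-refl)
      go (is-b _)    (is-b _)    l = contradiction l (<-irrefl refl)
      go (is-b _)    (other _ _) l = inj₂ (<⇒≤ l)
      go (other _ _) (is-a _)    l = inj₂ (m≤n⇒m≤1+n l)
      go (other n _) (is-b _)    l = inj₂ (≤∧≢⇒< (s≤s⁻¹ l) n)
      go (other _ _) (other _ _) l = inj₂ l

    swap-adds : ∀ {c d} → place v′ c < place v′ d → (c ≡ b × d ≡ a) ⊎ place v c < place v d
    swap-adds {c} {d} lt = go (which c) (which d) lt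
      where
      go : ∀ {x x′ y y′} → Which c x x′ → Which d y y′ → x′ < y′ → (c ≡ b × d ≡ a) ⊎ x < y
      go (is-a _)    (is-a _)    l = contradiction l (<-irrefl refl)
      go (is-a _)    (is-b _)    l = contradiction l (<⇒≯ ≤-refl)
      go (is-a _)    (other _ _) l = inj₂ (<⇒≤ l)
      go (is-b e)    (is-a e′)   l = inj₁ (e , e′)
      go (is-b _)    (is-b _)    l = contradiction l (<-irrefl refl)
      go (is-b _)    (other _ n) l = inj₂ (≤∧≢⇒< l (n ∘ sym))
      go (other n _) (is-a _)    l = inj₂ (≤∧≢⇒< (s≤s⁻¹ l) n)
      go (other _ _) (is-b _)    l = inj₂ (m≤n⇒m≤1+n l)
      go (other _ _) (other _ _) l = inj₂ l

  module Lifting (f : Fin m → ℕ) (f≤1 : ∀ c → f c ≤ 1) where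
    term : (Fin m → Fin m → ℕ) → Vote m → Fin m → Fin m → ℕ
    term cost v a b = (1 ∸ f a) * (f b * ifz (place v b ∸ place v a) 0 (cost a b))

    -- What it costs at least to bring all candidates with f = 1 to the top of v.
    potential : (Fin m → Fin m → ℕ) → Vote m → ℕ
    potential cost v = ∑ λ a → ∑ λ b → term cost v a b

    total : (Fin m → Fin m → ℕ) → List (Swap m) → ℕ
    total cost ss = sumᴸ (map (λ (a , b) → cost a b) ss)

    ifz-mono : ∀ {x y} c → (Tr x → Tr y) → ifz x 0 c ≤ ifz y 0 c
    ifz-mono {zero}          c h = z≤n
    ifz-mono {suc x} {zero}  c h = ⊥-elim (h _)
    ifz-mono {suc x} {suc y} c h = ≤-refl

    term-≤ : ∀ cost v w a b → (place v a < place v b → place w a < place w b) →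
             term cost v a b ≤ term cost w a b
    term-≤ cost v w a b h = *-monoʳ-≤ (1 ∸ f a) (*-monoʳ-≤ (f b) (ifz-mono (cost a b) (from lt-spec ∘ h ∘ to lt-spec)))

    term-cost : ∀ cost v a b → term cost v a b ≤ cost a b
    term-cost cost v a b = ≤-trans (*-mono-≤ (m∸n≤m 1 (f a)) (*-mono-≤ (f≤1 b) (bound (place v b ∸ place v a))))
      (≤-reflexive (trans (*-identityˡ _) (*-identityˡ _)))
      where
      bound : ∀ x → ifz x 0 (cost a b) ≤ cost a b
      bound zero    = z≤n
      bound (suc _) = ≤-refl

    -- The swap puts only the pair (a , b) out of its order, so only this term of the potential can
    -- fall, and it is at most `cost a b`.
    potential-step : ∀ cost {v a b} → Admissible (a , b) v →
      potential cost v ≤ cost a b + potential cost (applySwap (a , b) v)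
    potential-step cost {v} {a} {b} adm = ∑-bump a
      (λ c ne → ∑-mono λ d → term-≤ cost v (applySwap (a , b) v) c d (λ lt → kept c d (λ (e , _) → ne e) lt))
      (∑-bump b (λ d ne → term-≤ cost v (applySwap (a , b) v) a d (λ lt → kept a d (λ (_ , e) → ne e) lt))
        (≤-trans (term-cost cost v a b) (m≤m+n _ _)))
      where
      kept : ∀ c d → ¬ (c ≡ a × d ≡ b) → place v c < place v d →
             place (applySwap (a , b) v) c < place (applySwap (a , b) v) d
      kept c d ne lt with swap-keeps {v} adm {c} {d} lt
      ... | inj₁ e = contradiction e ne
      ... | inj₂ l = l

    lower-bound : ∀ cost {v ss w} → v —[ ss ]→ w → potential cost w ≡ 0 → potential cost v ≤ total cost ss
    lower-bound cost done z = ≤-reflexive z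
    lower-bound cost {v} (next {s = a , b} adm run) z =
      ≤-trans (potential-step cost {v} adm) (+-monoʳ-≤ (cost a b) (lower-bound cost run z))

    Lifted : Vote m → Fin m × Fin m → Set
    Lifted v (a , b) = f a ≡ 0 × f b ≡ 1 × place v a < place v b

    Sorted : Vote m → Set
    Sorted w = ∀ a b → f a ≡ 0 → f b ≡ 1 → place w b < place w a

    -- The term of (a , b) was all of `cost a b` and vanishes; the one newly ordered pair (b , a)
    -- has weight 0 because f b = 1.
    potential-drop : ∀ cost {v a b} → Admissible (a , b) v → f a ≡ 0 → f b ≡ 1 →
      cost a b + potential cost (applySwap (a , b) v) ≤ potential cost v
    potential-drop cost {v} {a} {b} adm fa fb = ∑-drop a (λ c _ → ∑-mono λ d → smaller c d)
      (∑-drop b (λ d _ → smaller a d) exact)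
      where
      v′ = applySwap (a , b) v
      smaller : ∀ c d → term cost v′ c d ≤ term cost v c d
      smaller c d with place v′ c <? place v′ d
      ... | no ≮ = ≤-trans (≤-reflexive vanish) z≤n
        where
        vanish : term cost v′ c d ≡ 0
        vanish rewrite m≤n⇒m∸n≡0 (≮⇒≥ ≮) | *-zeroʳ (f d) = *-zeroʳ (1 ∸ f c)
      ... | yes lt with swap-adds {v} adm {c} {d} lt
      ... | inj₂ l = term-≤ cost v′ v c d (λ _ → l)
      ... | inj₁ (refl , refl) rewrite fb = z≤n
      exact : cost a b + term cost v′ a b ≤ term cost v a b
      exact rewrite fa | fb | place-a {v} adm | place-b {v} adm | adj {v} adm
                  | m≤n⇒m∸n≡0 (n≤1+n (place v a)) | m+n∸n≡m 1 (place v a) =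
        ≤-reflexive (trans (+-identityʳ _) (sym (trans (+-identityʳ _) (+-identityʳ _))))

    -- Going down from a to b, f changes from 0 to 1 between two neighbours; the recursion is on
    -- their distance.
    adjacent : ∀ v a b d → f a ≡ 0 → f b ≡ 1 → place v b ≡ place v a + suc d →
               ∃ λ a → ∃ λ b → f a ≡ 0 × f b ≡ 1 × Admissible (a , b) v
    adjacent v a b zero fa fb e = a , b , fa , fb , cong suc (sym (trans e (+-comm (place v a) 1)))
    adjacent v a b (suc d) fa fb e with f c in fc | f≤1 c
      where
      r< : suc (place v a) < m
      r< = ≤-trans (s≤s (≤-trans (≤-trans (s≤s (m≤m+n (place v a) (suc d))) (≤-reflexive (sym (+-suc (place v a) (suc d)))))
             (≤-reflexive (sym e)))) (Fin.toℕ<n (v ⟨$⟩ʳ b))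
      c = v ⟨$⟩ˡ fromℕ< r<
    ... | zero | _ = adjacent v _ b d fc fb (trans e (trans (+-suc (place v a) (suc d)) (cong (_+ suc d) (sym at))))
      where
      at : place v (v ⟨$⟩ˡ fromℕ< _) ≡ suc (place v a)
      at = trans (cong toℕ (inverseʳ v)) (Fin.toℕ-fromℕ< _)
    ... | suc zero | _ = a , _ , fa , fc , cong suc (sym (trans (cong toℕ (inverseʳ v)) (Fin.toℕ-fromℕ< _)))
    ... | suc (suc _) | s≤s ()

    sorted-or-swap : ∀ v → Sorted v ⊎ (∃ λ a → ∃ λ b → f a ≡ 0 × f b ≡ 1 × Admissible (a , b) v)
    sorted-or-swap v with Fin.any? (λ a → Fin.any? (λ b → (f a ≟ 0) ×-dec ((f b ≟ 1) ×-dec (suc (rank a v) ≟ rank b v))))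
    ... | yes found = inj₂ found
    ... | no none   = inj₁ sorted
      where
      sorted : Sorted v
      sorted a b fa fb with place v b <? place v a
      ... | yes lt = lt
      ... | no ≮ with m≤n⇒∃[o]m+o≡n (≤∧≢⇒< (≮⇒≥ ≮) λ e → 0≢1+n (trans (sym fa) (trans (cong f (place-injective v e)) fb)))
      ... | d , e = contradiction (adjacent v a b d fa fb (trans (sym e) (sym (+-suc (place v a) d)))) none

    -- `B` is fuel: each swap lowers the potential for unit costs by at least 1. The swaps are
    -- distinct because each puts its pair in the right order, while all later ones concern pairs
    -- that are then still in the wrong order.
    lift : ∀ cost B v → potential (λ _ _ → 1) v ≤ B →
      ∃ λ ss → ∃ λ w → v —[ ss ]→ w × Unique ss × All (Lifted v) ss × total cost ss ≤ potential cost v × Sorted w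
    lift cost B v le with sorted-or-swap v
    ... | inj₁ sorted = [] , v , done , [] , [] , z≤n , sorted
    lift cost zero v le | inj₂ (a , b , fa , fb , adm) =
      contradiction (≤-trans (potential-drop (λ _ _ → 1) {v} adm fa fb) le) λ ()
    lift cost (suc B) v le | inj₂ (a , b , fa , fb , adm)
      with lift cost B (applySwap (a , b) v) (s≤s⁻¹ (≤-trans (potential-drop (λ _ _ → 1) {v} adm fa fb) le))
    ... | ss , w , run , uniq , lifted , cheap , sorted =
      (a , b) ∷ ss , w , next adm run , All.map (λ {s} → new s) lifted ∷ uniq ,
      (fa , fb , ≤-reflexive (sym (adj {v} adm))) ∷ All.map (λ {s} → old s) lifted ,
      ≤-trans (+-monoʳ-≤ (cost a b) cheap) (potential-drop cost {v} adm fa fb) , sorted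
      where
      new : ∀ s → Lifted (applySwap (a , b) v) s → (a , b) ≢ s
      new (_ , _) (_ , _ , lt) refl = <⇒≯ ≤-refl (subst₂ _<_ (trans (place-a {v} adm) (adj {v} adm)) (place-b {v} adm) lt)
      old : ∀ s → Lifted (applySwap (a , b) v) s → Lifted v s
      old (c , d) (fc , fd , lt) with swap-adds {v} adm {c} {d} lt
      ... | inj₁ (refl , refl) = contradiction (trans (sym fc) fb) 0≢1+n
      ... | inj₂ l = fc , fd , l

  points≤1 : ∀ k c (v : Vote m) → points k c v ≤ 1
  points≤1 k c v with does (rank c v ≤? k)
  ... | true  = ≤-refl
  ... | false = z≤n

  points-1 : ∀ k c (v : Vote m) → place v c < k → points k c v ≡ 1
  points-1 k c v lt rewrite dec-true (rank c v ≤? k) lt = refl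

  points-0 : ∀ k c (v : Vote m) → ¬ (place v c < k) → points k c v ≡ 0
  points-0 k c v ≮ rewrite dec-false (rank c v ≤? k) ≮ = refl

  ∑-points : ∀ k (v : Vote m) → k ≤ m → ∑ (λ c → points k c v) ≡ k
  ∑-points k v k≤m = trans (sum-permute (λ c → points k c v) (flip v)) (trans
    (∑-cong {m} {λ r → points k (v ⟨$⟩ˡ r) v} λ r → cong (λ x → if does (suc (toℕ x) ≤? k) then 1 else 0) (inverseʳ v {r})) (go m k k≤m))
    where
    go : ∀ m k → k ≤ m → ∑ {m} (λ r → if does (suc (toℕ r) ≤? k) then 1 else 0) ≡ k
    go zero    zero    _        = refl
    go (suc m) zero    _        = go m zero z≤n
    go (suc m) (suc k) (s≤s le) = cong suc (go m k le)

  -- If a candidate with f = 1 missed the top k, sortedness would give f = 1 to the whole top k,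
  -- making more than k such candidates.
  sorted-points : ∀ f (f≤1 : ∀ c → f c ≤ 1) k (w : Vote m) → k ≤ m → ∑ f ≡ k →
                  Lifting.Sorted f f≤1 w → ∀ c → points k c w ≡ f c
  sorted-points f f≤1 k w k≤m sum-f sorted c = sym (∑-≡ f≤points
      (≤-reflexive (trans (∑-points k w k≤m) (sym sum-f))) c)
    where
    f≤points : ∀ c → f c ≤ points k c w
    f≤points c with place w c <? k
    ... | yes lt = ≤-trans (f≤1 c) (≤-reflexive (sym (points-1 k c w lt)))
    ... | no ≮ with f c in fc | f≤1 c
    ... | zero | _ = z≤n
    ... | suc (suc _) | s≤s ()
    ... | suc zero | _ = contradiction (trans (sym (points-0 k c w ≮)) (trans (∑-≡ points≤f
            (≤-reflexive (trans sum-f (sym (∑-points k w k≤m)))) c) fc)) 0≢1+n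
      where
      points≤f : ∀ d → points k d w ≤ f d
      points≤f d with place w d <? k
      ... | no ≮′ = ≤-trans (≤-reflexive (points-0 k d w ≮′)) z≤n
      ... | yes lt with f d in fd
      ... | suc _ = ≤-trans (points≤1 k d w) (s≤s z≤n)
      ... | zero  = contradiction (<-trans (sorted d c fd fc) lt) ≮

  -- No unapproved candidate stands above an approved one. So the lower bound applies to every final
  -- vote, with its own approved set as target.
  potential-top : ∀ k (w : Vote m) cost → Lifting.potential (λ c → points k c w) (λ c → points≤1 k c w) cost w ≡ 0
  potential-top k w cost = trans (∑-cong λ a → trans (∑-cong λ b → vanish a b) (∑-zero m)) (∑-zero m)
    where
    vanish : ∀ a b → Lifting.term (λ c → points k c w) (λ c → points≤1 k c w) cost w a b ≡ 0
    vanish a b with place w a <? k | place w b <? k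
    ... | yes lt | _ rewrite points-1 k a w lt = refl
    ... | no _ | no ≮ rewrite points-0 k b w ≮ = *-zeroʳ (1 ∸ points k a w)
    ... | no ≮ | yes lt rewrite m≤n⇒m∸n≡0 (≤-trans (<⇒≤ lt) (≮⇒≥ ≮)) | *-zeroʳ (points k b w) = *-zeroʳ (1 ∸ points k a w)

-- Bribery as a choice of one k-set per vote

record Selection {n m : ℕ} (I : Instance n m) (k : ℕ) : Set where
  open Instance I
  field
    chosen   : Fin n → Fin m → ℕ
    chosen≤1 : ∀ i c → chosen i c ≤ 1
    size-k   : ∀ i → ∑ (chosen i) ≡ k
    cheap    : ∑ (λ i → Lifting.potential (chosen i) (chosen≤1 i) (cost i) (votes i)) ≤ β
    wins     : ∀ c → ∑ (λ i → chosen i c) ≤ ∑ (λ i → chosen i p)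

-- One direction takes the approved sets of the final votes, whose potentials bound the cost from
-- below; the other lifts the chosen sets at no more than their potentials.
bribery⇔selection : ∀ {n m} (I : Instance n m) k → k ≤ m → SwapBribery I k ⇔ Selection I k
bribery⇔selection {n} {m} I k k≤m = mk⇔ select bribe
  where
  open Instance I
  select : SwapBribery I k → Selection I k
  select (Γ , W , runs , cheap , winner) = record
    { chosen   = λ i c → points k c (W i)
    ; chosen≤1 = λ i c → points≤1 k c (W i)
    ; size-k   = λ i → ∑-points k (W i) k≤m
    ; cheap    = ≤-trans (∑-mono bound) cheap
    ; wins     = winner }
    where
    bound : ∀ i → _ ≤ sumᴸ (map (λ (a , b) → cost i a b) (proj₁ (Γ i)))
    bound i with runs i
    ... | ss , perm , run = ≤-trans
      (Lifting.lower-bound (λ c → points k c (W i)) (λ c → points≤1 k c (W i)) (cost i) run (potential-top k (W i) (cost i)))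
      (≤-reflexive (sum-↭ (map⁺ (λ (a , b) → cost i a b) perm)))
  bribe : Selection I k → SwapBribery I k
  bribe sel = (λ i → proj₁ (lifted i) , proj₁ (proj₂ (proj₂ (proj₂ (lifted i))))) ,
    (λ i → proj₁ (proj₂ (lifted i))) ,
    (λ i → proj₁ (lifted i) , ↭-refl , proj₁ (proj₂ (proj₂ (lifted i)))) ,
    ≤-trans (∑-mono λ i → proj₁ (proj₂ (proj₂ (proj₂ (proj₂ (proj₂ (lifted i))))))) cheap ,
    λ c → subst₂ _≤_ (sym (∑-cong λ i → top i c)) (sym (∑-cong λ i → top i p)) (wins c)
    where
    open Selection sel
    lifted : ∀ i → _
    lifted i = Lifting.lift (chosen i) (chosen≤1 i) (cost i) _ (votes i) ≤-refl
    top : ∀ i c → points k c (proj₁ (proj₂ (lifted i))) ≡ chosen i c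
    top i = sorted-points (chosen i) (chosen≤1 i) k (proj₁ (proj₂ (lifted i))) k≤m (size-k i) (proj₂ (proj₂ (proj₂ (proj₂ (proj₂ (proj₂ (lifted i)))))))

-- Reading the input

load-++ˡ : ∀ xs {ys j} → j < length xs → load (xs ++ ys) j ≡ load xs j
load-++ˡ (x ∷ xs) {j = zero}  _  = refl
load-++ˡ (x ∷ xs) {j = suc j} lt = load-++ˡ xs (s≤s⁻¹ lt)

load-++ʳ : ∀ xs {ys} j → load (xs ++ ys) (length xs + j) ≡ load ys j
load-++ʳ []       j = refl
load-++ʳ (x ∷ xs) j = load-++ʳ xs j

load-tabulate : ∀ {m} (f : Fin m → ℕ) r → load (tabulate f) (toℕ r) ≡ f r
load-tabulate f Fin.zero    = refl
load-tabulate f (Fin.suc r) = load-tabulate (f ∘ Fin.suc) r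

load-beyond : ∀ xs {j} → length xs ≤ j → load xs j ≡ 0
load-beyond []       _        = refl
load-beyond (x ∷ xs) (s≤s le) = load-beyond xs le

length-blocks : ∀ {n} w (f : Fin n → List ℕ) → (∀ i → length (f i) ≡ w) → length (concat (tabulate f)) ≡ n * w
length-blocks {zero}  w f eq = refl
length-blocks {suc n} w f eq = trans (length-++ (f Fin.zero)) (cong₂ _+_ (eq Fin.zero) (length-blocks w (f ∘ Fin.suc) (eq ∘ Fin.suc)))

load-blocks : ∀ {n} w (f : Fin n → List ℕ) → (∀ i → length (f i) ≡ w) → ∀ i {j} → j < w →
              load (concat (tabulate f)) (toℕ i * w + j) ≡ load (f i) j
load-blocks {suc n} w f eq Fin.zero {j} lt = load-++ˡ (f Fin.zero) (subst (j <_) (sym (eq Fin.zero)) lt)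
load-blocks {suc n} w f eq (Fin.suc i) {j} lt =
  trans (cong (load (f Fin.zero ++ concat (tabulate (f ∘ Fin.suc))))
          (trans (+-assoc w (toℕ i * w) j) (cong (_+ (toℕ i * w + j)) (sym (eq Fin.zero)))))
    (trans (load-++ʳ (f Fin.zero) (toℕ i * w + j)) (load-blocks w (f ∘ Fin.suc) (eq ∘ Fin.suc) i lt))

cell< : ∀ {n m} (i : Fin n) {r} → r < m → toℕ i * m + r < n * m
cell< {n} {m} i {r} r< = begin-strict
  toℕ i * m + r   <⟨ +-monoʳ-< (toℕ i * m) r< ⟩
  toℕ i * m + m   ≡⟨ +-comm (toℕ i * m) m ⟩
  suc (toℕ i) * m ≤⟨ *-monoˡ-≤ m (Fin.toℕ<n i) ⟩
  n * m ∎
  where open ≤-Reasoning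

∑-sum : ∀ {m} (f : Fin m → ℕ) (g : ℕ → ℕ) → (∀ i → f i ≡ g (toℕ i)) → ∑ f ≡ sum g m
∑-sum {zero}  f g eq = refl
∑-sum {suc m} f g eq = trans (cong₂ _+_ (eq Fin.zero) (∑-sum (f ∘ Fin.suc) (g ∘ suc) (eq ∘ Fin.suc))) (front g m)
  where
  front : ∀ g m → g 0 + sum (g ∘ suc) m ≡ sum g (suc m)
  front g zero    = +-comm (g 0) 0
  front g (suc m) = trans (sym (+-assoc (g 0) _ _)) (cong (_+ g (suc m)) (front g m))

ext : ∀ {m} → (Fin m → ℕ) → ℕ → ℕ
ext {m} f j with j <? m
... | yes lt = f (fromℕ< lt)
... | no _   = 0

ext-toℕ : ∀ {m} (f : Fin m → ℕ) i → ext f (toℕ i) ≡ f i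
ext-toℕ {m} f i with toℕ i <? m
... | yes lt = cong f (Fin.fromℕ<-toℕ i lt)
... | no ≮   = contradiction (Fin.toℕ<n i) ≮

extended : ℕ → ℕ → Memory → Memory
extended L m μ x = if does (x <? L) then μ x else if does (x <? L + m) then (x ∸ L) * m else 0

extended-input : ∀ L m μ x → x < L → extended L m μ x ≡ μ x
extended-input L m μ x lt rewrite dec-true (x <? L) lt = refl

extended-table : ∀ L m μ a → a < m → extended L m μ (L + a) ≡ a * m
extended-table L m μ a a<
  rewrite dec-false (L + a <? L) (m+n≮m L a) | dec-true (L + a <? L + m) (+-monoʳ-< L a<) | m+n∸m≡n L a = refl

extended-outside : ∀ L m μ x → L + m ≤ x → extended L m μ x ≡ 0
extended-outside L m μ x le
  rewrite dec-false (x <? L) (≤⇒≯ (≤-trans (m≤m+n L m) le)) | dec-false (x <? L + m) (≤⇒≯ le) = refl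

module Encoded (k n m : ℕ) (I : Instance n m) where
  open Instance I

  length-input : ℕ
  length-input = 5 + n * m + n * (m * m)

  private
    ranking : Fin n → List ℕ
    ranking i = tabulate λ r → toℕ (votes i ⟨$⟩ˡ r)
    costs : Fin n → List ℕ
    costs i = concat (tabulate λ a → tabulate λ b → cost i a b)
    length-costs : ∀ i → length (costs i) ≡ m * m
    length-costs i = length-blocks m (λ a → tabulate λ b → cost i a b) λ a → length-tabulate (λ b → cost i a b)
    length-ranking : ∀ i → length (ranking i) ≡ m
    length-ranking i = length-tabulate (λ r → toℕ (votes i ⟨$⟩ˡ r))

  length-encode : length (encode k I) ≡ length-input
  length-encode = cong (5 +_) (trans (length-++ (concat (tabulate ranking)))
    (cong₂ _+_ (length-blocks m ranking length-ranking) (length-blocks (m * m) costs length-costs)))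

  load-vote : ∀ i r → load (encode k I) (5 + (toℕ i * m + toℕ r)) ≡ toℕ (votes i ⟨$⟩ˡ r)
  load-vote i r = trans (load-++ˡ (concat (tabulate ranking))
      (subst (toℕ i * m + toℕ r <_) (sym (length-blocks m ranking length-ranking)) (cell< i (Fin.toℕ<n r))))
    (trans (load-blocks m ranking length-ranking i (Fin.toℕ<n r)) (load-tabulate (λ r → toℕ (votes i ⟨$⟩ˡ r)) r))

  load-cost : ∀ i a b → load (encode k I) (5 + (n * m + (toℕ i * (m * m) + (toℕ a * m + toℕ b)))) ≡ cost i a b
  load-cost i a b = trans (cong (λ x → load (concat (tabulate ranking) ++ concat (tabulate costs)) (x + off))
                            (sym (length-blocks m ranking length-ranking)))
    (trans (load-++ʳ (concat (tabulate ranking)) off)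
    (trans (load-blocks (m * m) costs length-costs i (cell< a (Fin.toℕ<n b)))
    (trans (load-blocks m (λ a → tabulate λ b → cost i a b) (λ a → length-tabulate (λ b → cost i a b)) a (Fin.toℕ<n b))
      (load-tabulate (cost i a) b))))
    where off = toℕ i * (m * m) + (toℕ a * m + toℕ b)

  X : ℕ → ℕ
  X j = extended length-input m (load (encode k I)) (3 + j)

  X-input : ∀ j → 3 + j < length-input → X j ≡ load (encode k I) (3 + j)
  X-input j = extended-input length-input m (load (encode k I)) (3 + j)

  X-table : ∀ j a → a < m → 3 + j ≡ length-input + a → X j ≡ a * m
  X-table j a a< eq = trans (cong (extended length-input m (load (encode k I))) eq)
    (extended-table length-input m (load (encode k I)) a a<)

  X-outside : ∀ j → length-input + m ≤ 3 + j → X j ≡ 0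
  X-outside j = extended-outside length-input m (load (encode k I)) (3 + j)

  cand : ℕ → ℕ → ℕ
  cand i r = X (2 + i * m + r)

  cst : ℕ → ℕ → ℕ → ℕ
  cst i a b = X (2 + n * m + i * (m * m) + a * m + b)

  cand-Fin : ∀ i r → cand (toℕ i) (toℕ r) ≡ toℕ (votes i ⟨$⟩ˡ r)
  cand-Fin i r = trans (X-input _ (+-monoʳ-< 5 (<-≤-trans (cell< i (Fin.toℕ<n r)) (m≤m+n (n * m) _)))) (load-vote i r)

  cst-Fin : ∀ i a b → cst (toℕ i) (toℕ a) (toℕ b) ≡ cost i a b
  cst-Fin i a b = trans (cong X assoc) (trans (X-input _ (+-monoʳ-< 5 (+-monoʳ-< (n * m) (cell< i (cell< a (Fin.toℕ<n b)))))) (load-cost i a b))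
    where
    assoc : 2 + n * m + toℕ i * (m * m) + toℕ a * m + toℕ b ≡ 2 + (n * m + (toℕ i * (m * m) + (toℕ a * m + toℕ b)))
    assoc = cong (2 +_) (trans (+-assoc (n * m + toℕ i * (m * m)) (toℕ a * m) (toℕ b)) (+-assoc (n * m) (toℕ i * (m * m)) _))

  cand-at : ∀ i r (i< : i < n) (r< : r < m) → cand i r ≡ toℕ (votes (fromℕ< i<) ⟨$⟩ˡ fromℕ< r<)
  cand-at i r i< r< = trans (cong₂ cand (sym (Fin.toℕ-fromℕ< i<)) (sym (Fin.toℕ-fromℕ< r<))) (cand-Fin _ _)

  layout : Layout n m (toℕ p) β X cand cst
  layout = record
    { at-p     = X-input 0 (m≤m+n 4 _)
    ; at-β     = X-input 1 (m≤m+n 5 _)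
    ; at-cand  = λ _ _ _ _ → refl
    ; at-cost  = λ _ _ _ _ _ _ → refl
    ; at-table = λ a a< → X-table _ a a< refl
    ; p<       = Fin.toℕ<n p
    ; cand<    = λ i r i< r< → subst (_< m) (sym (cand-at i r i< r<)) (Fin.toℕ<n _)
    ; cand-inj = λ i r r′ i< r< r′< e → trans (sym (Fin.toℕ-fromℕ< r<)) (trans (cong toℕ
        (vote-inj (votes (fromℕ< i<)) (Fin.toℕ-injective (trans (sym (cand-at i r i< r<)) (trans e (cand-at i r′ i< r′<))))))
        (Fin.toℕ-fromℕ< r′<)) }
    where
    vote-inj : ∀ (v : Vote m) {x y} → v ⟨$⟩ˡ x ≡ v ⟨$⟩ˡ y → x ≡ y
    vote-inj v e = trans (sym (inverseʳ v)) (trans (cong (v ⟨$⟩ʳ_) e) (inverseʳ v))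

  module _ {{_ : NonZero n}} {{_ : NonZero m}} {{_ : NonZero k}} where
    open Solving n m k (toℕ p) β X cand cst layout using (pair; Φ; Solution; decides)

    -- The potential runs over candidates, `Φ` over positions with the lifted one outermost.
    -- Reindexing along the vote and exchanging the two sums matches them term by term.
    potential-Φ : ∀ i f (f≤1 : ∀ c → f c ≤ 1) g → (∀ c → g (toℕ c) ≡ f c) →
      Lifting.potential f f≤1 (cost i) (votes i) ≡ Φ (toℕ i) g
    potential-Φ i f f≤1 g eq = begin
      (∑ λ a → ∑ λ b → t a b)
        ≡⟨ sum-permute (λ a → ∑ λ b → t a b) (flip v) ⟩
      (∑ λ r′ → ∑ λ b → t (v ⟨$⟩ˡ r′) b)
        ≡⟨ ∑-cong (λ r′ → sum-permute (λ b → t (v ⟨$⟩ˡ r′) b) (flip v)) ⟩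
      (∑ λ r′ → ∑ λ r → t (v ⟨$⟩ˡ r′) (v ⟨$⟩ˡ r))
        ≡⟨ ∑-comm (λ r′ r → t (v ⟨$⟩ˡ r′) (v ⟨$⟩ˡ r)) ⟩
      (∑ λ r → ∑ λ r′ → t (v ⟨$⟩ˡ r′) (v ⟨$⟩ˡ r))
        ≡⟨ ∑-sum _ _ (λ r → ∑-sum _ (λ r′ → (1 ∸ g (cand (toℕ i) r′)) * (g (cand (toℕ i) (toℕ r)) * pair (toℕ i) r′ (toℕ r))) (λ r′ → same r r′)) ⟩
      Φ (toℕ i) g ∎
      where
      open ≡-Reasoning
      v = votes i
      t = Lifting.term f f≤1 (cost i) v
      g≡ : ∀ r → f (v ⟨$⟩ˡ r) ≡ g (cand (toℕ i) (toℕ r))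
      g≡ r = trans (sym (eq _)) (cong g (sym (cand-Fin i r)))
      same : ∀ r r′ → t (v ⟨$⟩ˡ r′) (v ⟨$⟩ˡ r) ≡
        (1 ∸ g (cand (toℕ i) (toℕ r′))) * (g (cand (toℕ i) (toℕ r)) * pair (toℕ i) (toℕ r′) (toℕ r))
      same r r′ = cong₂ (λ x y → (1 ∸ x) * y) (g≡ r′) (cong₂ _*_ (g≡ r)
        (cong₂ (λ x c → ifz x 0 c) (cong₂ _∸_ (cong toℕ (inverseʳ v)) (cong toℕ (inverseʳ v)))
          (trans (sym (cst-Fin i _ _)) (cong₂ (cst (toℕ i)) (sym (cand-Fin i r′)) (sym (cand-Fin i r))))))

    selection⇔solution : Selection I k ⇔ Solution
    selection⇔solution = mk⇔ there back
      where
      there : Selection I k → Solution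
      there sel = record
        { s     = s
        ; s≤1   = s≤1
        ; row   = λ l l< → trans (sym (∑-sum (chosen (fromℕ< l<)) (s l) λ c →
                    sym (trans (cong (λ x → s x (toℕ c)) (sym (Fin.toℕ-fromℕ< l<))) (s-Fin _ c)))) (size-k (fromℕ< l<))
        ; cheap = ≤-trans (≤-reflexive (sym (∑-sum _ (λ l → Φ l (s l)) λ i → potential-Φ i _ (chosen≤1 i) (s (toℕ i)) (s-Fin i)))) cheap
        ; wins  = λ c c< → subst₂ _≤_
            (∑-sum _ _ λ i → trans (sym (s-Fin i _)) (cong (s (toℕ i)) (Fin.toℕ-fromℕ< c<)))
            (∑-sum _ _ λ i → sym (s-Fin i p)) (wins (fromℕ< c<)) }
        where
        open Selection sel
        s : ℕ → ℕ → ℕ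
        s l c = ext (λ i → ext (chosen i) c) l
        s-Fin : ∀ i c → s (toℕ i) (toℕ c) ≡ chosen i c
        s-Fin i c = trans (ext-toℕ (λ i → ext (chosen i) (toℕ c)) i) (ext-toℕ (chosen i) c)
        s≤1 : ∀ l c → s l c ≤ 1
        s≤1 l c with l <? n
        ... | no _ = z≤n
        ... | yes _ with c <? m
        ... | no _  = z≤n
        ... | yes _ = chosen≤1 _ _
      back : Solution → Selection I k
      back sol = record
        { chosen   = λ i c → s (toℕ i) (toℕ c)
        ; chosen≤1 = λ i c → s≤1 (toℕ i) (toℕ c)
        ; size-k   = λ i → trans (∑-sum {m} (λ c → s (toℕ i) (toℕ c)) (s (toℕ i)) λ _ → refl) (row (toℕ i) (Fin.toℕ<n i))
        ; cheap    = ≤-trans (≤-reflexive (∑-sum _ (λ l → Φ l (s l)) λ i → potential-Φ i (λ c → s (toℕ i) (toℕ c)) (λ c → s≤1 (toℕ i) (toℕ c)) (s (toℕ i)) λ _ → refl)) cheap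
        ; wins     = λ c → subst₂ _≤_ (sym (∑-sum {n} (λ i → s (toℕ i) (toℕ c)) (λ l → s l (toℕ c)) λ _ → refl))
                             (sym (∑-sum {n} (λ i → s (toℕ i) (toℕ p)) (λ l → s l (toℕ p)) λ _ → refl))
                             (wins (toℕ c) (Fin.toℕ<n c)) }
        where open Solution sol

    main⇔bribery : k ≤ m → Tr (Sem.⟦_⟧ X (size n m k) mainT []) ⇔ SwapBribery I k
    main⇔bribery k≤m = mk⇔
      (from (bribery⇔selection I k k≤m) ∘ from selection⇔solution ∘ to decides)
      (from decides ∘ to selection⇔solution ∘ to (bribery⇔selection I k k≤m))

-- Computing the loop bounds

stage : Glob → Tm 0 → Program
stage g t = compile (λ ()) 10 t ⨾ r[ reg g ]≔ rd 10

value-of : Glob → Tm 0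
value-of gk1 = nat 1 ⊞ glob gk
value-of gN  = call (mulT gn) (glob gk ∷ [])
value-of gR  = call (powT gm gk) (glob gk ∷ [])
value-of gL  = call (powT gn gN) (glob gN ∷ [])
value-of gJ  = call (powT gk1 gN) (glob gN ∷ [])
value-of gnm = call (mulT gn) (glob gm ∷ [])
value-of gmm = call (mulT gm) (glob gm ∷ [])
value-of g   = glob g

stages : List Glob → Program
stages []       = skip
stages (g ∷ gs) = stage g (value-of g) ⨾ stages gs

derived : List Glob
derived = gk1 ∷ gN ∷ gR ∷ gL ∷ gJ ∷ gnm ∷ gmm ∷ []

core : Program
core = stages derived ⨾ compile (λ ()) 10 mainT ⨾ M[ lit 0 ]≔ rd 10

unreg : ℕ → Glob
unreg 0 = gn
unreg 1 = gm
unreg 2 = gk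
unreg 3 = gk1
unreg 4 = gN
unreg 5 = gR
unreg 6 = gL
unreg 7 = gJ
unreg 8 = gnm
unreg _ = gmm

unreg-reg : ∀ g → unreg (reg g) ≡ g
unreg-reg gn  = refl
unreg-reg gm  = refl
unreg-reg gk  = refl
unreg-reg gk1 = refl
unreg-reg gN  = refl
unreg-reg gR  = refl
unreg-reg gL  = refl
unreg-reg gJ  = refl
unreg-reg gnm = refl
unreg-reg gmm = refl

module Core (n m k : ℕ) (X : ℕ → ℕ) (base : ℕ) (base>0 : 0 < base)
            (outside : ∀ j → base ≤ 3 + j → X j ≡ 0) where

  -- The loop bounds when only the registers below s are filled and the others hold 0; with it,
  -- compiler correctness applies while the bounds are still being computed.
  partial : ℕ → Glob → ℕ
  partial s g = if does (reg g <? s) then size n m k g else 0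

  module C s = Correctness X (partial s) base base>0 outside

  Ready : ℕ → Memory → Set
  Ready s = C.Ok s {0} (λ ()) 10 []

  stage-ok : ∀ g {μ} → Sem.⟦_⟧ X (partial (reg g)) (value-of g) [] ≡ size n m k g → Ready (reg g) μ →
             Exec (stage g (value-of g)) μ (suc (Cost.cost (partial (reg g)) (value-of g) + 1)) (Ready (suc (reg g)))
  stage-ok g {μ} eq ok = exec-seq (C.compile-ok (reg g) (value-of g) ok) λ ν (s , a) →
    let ok′ = C.ok-same (reg g) ok s in
    C.set (reg g) (reg g) {Q = Ready (suc (reg g))} ok′ (C.rd-eq (reg g) 10 ok′ (trans a eq)) (update ok′)
    where
    update : ∀ {ν} → Ready (reg g) ν → Ready (suc (reg g)) (write (base + reg g) (size n m k g) ν)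
    update {ν} ok = record
      { pointer = trans (write-other (base + reg g) _ ν (<⇒≢ (<-≤-trans base>0 (m≤m+n base (reg g))))) (pointer ok)
      ; input   = λ j lt → trans (write-other (base + reg g) _ ν (<⇒≢ (<-≤-trans lt (m≤m+n base (reg g))))) (input ok j lt)
      ; globals = glob-ok
      ; locals  = λ ()
      ; fresh   = λ ()
      ; large   = ≤-refl }
      where
      open Correctness X (partial (reg g)) base base>0 outside using (module Ok)
      open Ok
      glob-ok : ∀ h → write (base + reg g) (size n m k g) ν (base + reg h) ≡ partial (suc (reg g)) h
      glob-ok h with reg h ≟ reg g
      ... | yes e = trans (write-same (base + reg g) _ ν (cong (base +_) e)) (trans (cong (size n m k) same)
              (sym (now (≤-reflexive (cong suc e)))))
        where
        same : g ≡ h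
        same = trans (sym (unreg-reg g)) (trans (cong unreg (sym e)) (unreg-reg h))
        now : reg h < suc (reg g) → partial (suc (reg g)) h ≡ size n m k h
        now lt rewrite dec-true (reg h <? suc (reg g)) lt = refl
      ... | no ne = trans (write-other (base + reg g) _ ν (ne ∘ +-cancelˡ-≡ base _ _)) (trans (globals ok h)
              (cong (λ b → if b then size n m k h else 0) (later (reg h <? reg g))))
        where
        later : Dec (reg h < reg g) → does (reg h <? reg g) ≡ does (reg h <? suc (reg g))
        later (yes lt) = trans (dec-true (reg h <? reg g) lt) (sym (dec-true (reg h <? suc (reg g)) (m≤n⇒m≤1+n lt)))
        later (no ≮)   = trans (dec-false (reg h <? reg g) ≮) (sym (dec-false (reg h <? suc (reg g))
          λ lt → ≮ (≤∧≢⇒< (s≤s⁻¹ lt) ne)))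

  value-ok : All (λ g → Sem.⟦_⟧ X (partial (reg g)) (value-of g) [] ≡ size n m k g) derived
  value-ok = refl ∷ D.mulT-spec 4 gn k ∷ D.powT-spec 5 gm gk k ≤-refl ∷ D.powT-spec 6 gn gN (n * k) ≤-refl ∷
    D.powT-spec 7 gk1 gN (n * k) ≤-refl ∷ D.mulT-spec 8 gn m ∷ D.mulT-spec 9 gm m ∷ []
    where module D s = Digits X (partial s)

  stageTime : Glob → ℕ
  stageTime g = suc (Cost.cost (partial (reg g)) (value-of g) + 1)

  coreTime : ℕ
  coreTime = suc (suc (stageTime gk1 + suc (stageTime gN + suc (stageTime gR + suc (stageTime gL +
    suc (stageTime gJ + suc (stageTime gnm + suc (stageTime gmm + 1))))))) + suc (Cost.cost (size n m k) mainT + 1))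

  core-ok : ∀ {μ} → Ready 3 μ → Exec core μ coreTime (λ ν → ν 0 ≡ Sem.⟦_⟧ X (size n m k) mainT [])
  core-ok {μ} ok with value-ok
  ... | e₃ ∷ e₄ ∷ e₅ ∷ e₆ ∷ e₇ ∷ e₈ ∷ e₉ ∷ [] =
    exec-seq {Q = Ready 10}
      (exec-seq (stage-ok gk1 e₃ ok) λ _ ok → exec-seq (stage-ok gN e₄ ok) λ _ ok →
       exec-seq (stage-ok gR e₅ ok) λ _ ok → exec-seq (stage-ok gL e₆ ok) λ _ ok →
       exec-seq (stage-ok gJ e₇ ok) λ _ ok → exec-seq (stage-ok gnm e₈ ok) λ _ ok →
       exec-seq (stage-ok gmm e₉ ok) λ ν ok → exec 1 ν ≤-refl (λ _ → refl) ok)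
      λ ν ok → exec-seq (Full.compile-ok mainT (full ok)) λ ξ (s , a) →
        exec-assign {Q = λ ν → ν 0 ≡ _} (Full.rd-eq 10 (Full.ok-same (full ok) s) a)
    where
    module Full = Correctness X (size n m k) base base>0 outside
    full-size : ∀ g → partial 10 g ≡ size n m k g
    full-size g = cong (λ b → if b then size n m k g else 0) (dec-true (reg g <? 10) (reg<10 g))
    full : ∀ {ν} → Ready 10 ν → Full.Ok {0} (λ ()) 10 [] ν
    full ok = record
      { pointer = pointer ok ; input = input ok ; globals = λ g → trans (globals ok g) (full-size g)
      ; locals = λ () ; fresh = λ () ; large = ≤-refl }
      where
      open Correctness X (partial 10) base base>0 outside using (module Ok)
      open Ok

-- Laying out the memory

-- Cells 2 and 0 are emptied, k being stored in cell 3 as p + k m, so that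
-- n m (m + 1) can be computed before any cell beyond the input is known.
clear product area recover-area recover-nm recover-n recover-k table setup : Program
clear   = whilenz M[ lit 2 ] (M[ lit 3 ]≔ M[ lit 3 ] ⊕ M[ lit 1 ] ⨾ M[ lit 2 ]≔ M[ lit 2 ] ⊖ lit 1)
product = whilenz M[ lit 0 ] (M[ lit 2 ]≔ M[ lit 2 ] ⊕ M[ lit 1 ] ⨾ M[ lit 0 ]≔ M[ lit 0 ] ⊖ lit 1)
area    = whilenz M[ lit 2 ] (M[ lit 0 ]≔ M[ lit 0 ] ⊕ (M[ lit 1 ] ⊕ lit 1) ⨾ M[ lit 2 ]≔ M[ lit 2 ] ⊖ lit 1)
recover-area = r[ 10 ]≔ M[ lit 0 ] ⊖ lit 5 ⊖ M[ lit 1 ]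
recover-nm = whilenz (rd 10) (r[ 11 ]≔ rd 11 ⊕ lit 1 ⨾ r[ 10 ]≔ rd 10 ⊖ (M[ lit 1 ] ⊕ lit 1))
recover-n  = whilenz (rd 11) (r[ 0 ]≔ rd 0 ⊕ lit 1 ⨾ r[ 11 ]≔ rd 11 ⊖ M[ lit 1 ])
recover-k  = whilenz (M[ lit 3 ] ⊕ lit 1 ⊖ M[ lit 1 ]) (r[ 2 ]≔ rd 2 ⊕ lit 1 ⨾ M[ lit 3 ]≔ M[ lit 3 ] ⊖ M[ lit 1 ])
table      = whilenz (M[ lit 1 ] ⊖ rd 12)
  (M[ M[ lit 0 ] ⊖ M[ lit 1 ] ⊕ rd 12 ]≔ rd 13 ⨾ r[ 13 ]≔ rd 13 ⊕ M[ lit 1 ] ⨾ r[ 12 ]≔ rd 12 ⊕ lit 1)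
setup = clear ⨾ product ⨾ area ⨾ M[ lit 0 ]≔ M[ lit 0 ] ⊕ lit 5 ⊕ M[ lit 1 ] ⨾
  recover-area ⨾ recover-nm ⨾ recover-n ⨾ recover-k ⨾ r[ 1 ]≔ M[ lit 1 ] ⨾ table

setupTime : ℕ → ℕ → ℕ → ℕ
setupTime n m k = suc ((k * 4 + 1) + suc ((n * 4 + 1) + suc ((n * m * 4 + 1) + suc (1 + suc (1 +
  suc ((n * m * 4 + 1) + suc ((n * 4 + 1) + suc ((k * 4 + 1) + suc (1 + (m * 6 + 1))))))))))

setup-det : Deterministic setup
setup-det = (tt , tt) , (tt , tt) , (tt , tt) , tt , tt , (tt , tt) , (tt , tt) , (tt , tt) , tt , tt , tt , tt

update : List ℕ → ℕ → ℕ → List ℕ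
update []       r       v = []
update (x ∷ xs) zero    v = v ∷ xs
update (x ∷ xs) (suc r) v = x ∷ update xs r v

load-update : ∀ xs r v s → r < length xs → write r v (load xs) s ≡ load (update xs r v) s
load-update (x ∷ xs) zero    v zero    _  = refl
load-update (x ∷ xs) zero    v (suc s) _  = refl
load-update (x ∷ xs) (suc r) v zero    _  = refl
load-update (x ∷ xs) (suc r) v (suc s) lt = load-update xs r v s (s≤s⁻¹ lt)

∸-suc′ : ∀ a i → a ∸ i ∸ 1 ≡ a ∸ suc i
∸-suc′ a i = trans (∸-+-assoc a i 1) (cong (a ∸_) (+-comm i 1))

∸-unfold : ∀ {a i} → i < a → a ∸ i ≡ suc (a ∸ suc i)
∸-unfold lt = +-∸-assoc 1 lt

∸-*-step : ∀ {a i} c → i < a → (a ∸ i) * c ∸ c ≡ (a ∸ suc i) * c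
∸-*-step {a} {i} c lt = trans (cong (λ x → x * c ∸ c) (∸-unfold lt)) (m+n∸m≡n c ((a ∸ suc i) * c))

0*≡ : ∀ a c → (a ∸ a) * c ≡ 0
0*≡ a c = cong (_* c) (n∸n≡0 a)

positive : ∀ {x} → 0 < x → ∃ λ y → x ≡ suc y
positive {suc y} _ = y , refl

module Setup (k n m : ℕ) (I : Instance n m) (k<m : k < m) where
  open Instance I
  open Encoded k n m I

  q L base : ℕ
  q = toℕ p
  L = length-input
  base = L + m

  enc : Memory
  enc = load (encode k I)

  record Low (a c d : ℕ) (μ : Memory) : Set where
    constructor low
    field
      at0  : μ 0 ≡ a
      at1  : μ 1 ≡ m
      at2  : μ 2 ≡ c
      at3  : μ 3 ≡ d
      rest : ∀ j → μ (4 + j) ≡ enc (4 + j)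

  assign-then : ∀ {e f P μ T} {Q : Memory → Set} → Exec P (write (eval e μ) (eval f μ) μ) T Q →
                Exec (M[ e ]≔ f ⨾ P) μ (suc (1 + T)) Q
  assign-then {e} {f} {μ = μ} ex = exec-seq (exec-assign {Q = λ ν → ν ≡ write (eval e μ) (eval f μ) μ} refl) λ { _ refl → ex }

  clear-ok : ∀ {μ} → Low n k q μ → Exec clear μ (k * 4 + 1) (Low n 0 (q + k * m))
  clear-ok {μ} (low a b c d r) = exec-mono ≤-refl (λ _ (low a b c d r) → low a b (trans c (n∸n≡0 k)) d r)
    (exec-while (λ i → Low n (k ∸ i) (q + i * m)) k
      (λ i ν lt (low a b c d r) → (_ , trans c (∸-unfold lt)) ,
        assign-then (exec-assign (low a b (trans (cong (_∸ 1) c) (∸-suc′ k i))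
          (trans (cong₂ _+_ d b) (trans (+-assoc q (i * m) m) (cong (q +_) (+-comm (i * m) m)))) r)))
      (λ ν (low _ _ c _ _) → trans c (n∸n≡0 k)) (low a b c (trans d (sym (+-identityʳ q))) r))

  product-ok : ∀ {d μ} → Low n 0 d μ → Exec product μ (n * 4 + 1) (Low 0 (n * m) d)
  product-ok {d} {μ} o = exec-mono ≤-refl (λ _ (low a b c d r) → low (trans a (n∸n≡0 n)) b c d r)
    (exec-while (λ i → Low (n ∸ i) (i * m) d) n
      (λ i ν lt (low a b c d r) → (_ , trans a (∸-unfold lt)) ,
        assign-then (exec-assign (low (trans (cong (_∸ 1) a) (∸-suc′ n i)) b
          (trans (cong₂ _+_ c b) (+-comm (i * m) m)) d r)))
      (λ ν (low a _ _ _ _) → trans a (n∸n≡0 n)) o)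

  area-ok : ∀ {d μ} → Low 0 (n * m) d μ → Exec area μ (n * m * 4 + 1) (Low (n * m * (m + 1)) 0 d)
  area-ok {d} {μ} o = exec-mono ≤-refl (λ _ (low a b c d r) → low a b (trans c (n∸n≡0 (n * m))) d r)
    (exec-while (λ i → Low (i * (m + 1)) (n * m ∸ i) d) (n * m)
      (λ i ν lt (low a b c d r) → (_ , trans c (∸-unfold lt)) ,
        assign-then (exec-assign (low (trans (cong₂ _+_ a (cong (_+ 1) b)) (+-comm (i * (m + 1)) (m + 1))) b
          (trans (cong (_∸ 1) c) (∸-suc′ (n * m) i)) d r)))
      (λ ν (low _ _ c _ _) → trans c (n∸n≡0 (n * m))) o)

  -- Votes and costs occupy n m + n m^2 cells. Written as n m (m + 1), this number is built in n m
  -- additions and yields n m and n again by division.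
  area-≡ : n * m * (m + 1) ≡ n * m + n * (m * m)
  area-≡ = solve 2 (λ n m → n :* m :* (m :+ con 1) := n :* m :+ n :* (m :* m)) refl n m
    where open +-*-Solver

  -- The memory once `base` is known: `xs` lists the registers and `tab` counts the table entries
  -- written. Cell 2 is left open, as the input seen by the terms starts at cell 3.
  record High (d : ℕ) (xs : List ℕ) (tab : ℕ) (μ : Memory) : Set where
    constructor high
    field
      at0  : μ 0 ≡ base
      at1  : μ 1 ≡ m
      at3  : μ 3 ≡ d
      rest : ∀ j → 4 + j < L → μ (4 + j) ≡ enc (4 + j)
      tabs : ∀ a → a < tab → μ (L + a) ≡ a * m
      regs : ∀ r → μ (base + r) ≡ load xs r

  -- n, m, k in registers 0 to 2, four temporaries in registers 10 to 13.
  bank : ℕ → ℕ → ℕ → ℕ → ℕ → ℕ → ℕ → List ℕ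
  bank x y z a b c e = x ∷ y ∷ z ∷ 0 ∷ 0 ∷ 0 ∷ 0 ∷ 0 ∷ 0 ∷ 0 ∷ a ∷ b ∷ c ∷ e ∷ []

  base-ok : ∀ {d μ} → Low (n * m * (m + 1)) 0 d μ →
            Exec (M[ lit 0 ]≔ M[ lit 0 ] ⊕ lit 5 ⊕ M[ lit 1 ]) μ 1 (High d (bank 0 0 0 0 0 0 0) 0)
  base-ok {d} {μ} (low a b c d≡ r) = exec-assign (high
    (cong₂ _+_ (trans (cong (_+ 5) (trans a area-≡)) (+-comm _ 5)) b) b d≡ (λ j _ → r j) (λ _ ())
    -- Cells behind the input are initially 0, so the registers need no clearing.
    λ s → trans (r (suc (n * m + n * (m * m) + m + s))) (trans
      (load-beyond (encode k I) (≤-trans (≤-reflexive length-encode) (≤-trans (m≤m+n L m) (m≤m+n (L + m) s))))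
      (sym (zeros s))))
    where
    all-zero : ∀ l s → load (replicate l 0) s ≡ 0
    all-zero zero    s       = refl
    all-zero (suc l) zero    = refl
    all-zero (suc l) (suc s) = all-zero l s
    zeros : ∀ s → load (bank 0 0 0 0 0 0 0) s ≡ 0
    zeros = all-zero 14

  module _ {d xs tab μ} (tab≤ : tab ≤ m) (h : High d xs tab μ) where
    open High h

    rd≡ : ∀ r → eval (rd r) μ ≡ load xs r
    rd≡ r = trans (cong (λ b → μ (b + r)) at0) (regs r)

    high-write : ∀ r v → r < length xs → High d (update xs r v) tab (write (base + r) v μ)
    high-write r v r< = high at0 at1 at3
      (λ j lt → trans (write-other (base + r) v μ (<⇒≢ (<-≤-trans lt (≤-trans (m≤m+n L m) (m≤m+n (L + m) r))))) (rest j lt))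
      (λ a a< → trans (write-other (base + r) v μ (<⇒≢ (<-≤-trans (+-monoʳ-< L (<-≤-trans a< tab≤)) (m≤m+n (L + m) r)))) (tabs a a<))
      λ s → trans (shift s) (load-update xs r v s r<)
      where
      shift : ∀ s → write (base + r) v μ (base + s) ≡ write r v (load xs) s
      shift s with s ≟ r
      ... | yes refl = trans (write-same (base + r) v μ refl) (sym (write-same r v (load xs) refl))
      ... | no ne    = trans (write-other (base + r) v μ (ne ∘ +-cancelˡ-≡ base _ _)) (trans (regs s) (sym (write-other r v (load xs) ne)))

    assign-high : ∀ r {e} {Q : Memory → Set} → r < length xs → (∀ ν → High d (update xs r (eval e μ)) tab ν → Q ν) →
                  Exec (r[ r ]≔ e) μ 1 Q
    assign-high r {e} {Q} r< f = exec-assign (f _ (subst (λ b → High d (update xs r (eval e μ)) tab (write (b + r) (eval e μ) μ))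
      (sym at0) (high-write r (eval e μ) r<)))

    high-3 : ∀ v → High v xs tab (write 3 v μ)
    high-3 v = high at0 at1 refl rest tabs regs

  high-≡ : ∀ {d xs ys tab μ} → xs ≡ ys → High d xs tab μ → High d ys tab μ
  high-≡ refl h = h

  private
    nm A : ℕ
    nm = n * m
    A = nm * (m + 1)

  m>0 : 0 < m
  m>0 = ≤-<-trans z≤n k<m

  product>0 : ∀ {a i} c → i < a → 0 < c → ∃ λ y → (a ∸ i) * c ≡ suc y
  product>0 {a} {i} c lt c>0 = positive (≤-trans (*-mono-≤ (m<n⇒0<n∸m lt) c>0) ≤-refl)

  recover-area-ok : ∀ {d μ} → High d (bank 0 0 0 0 0 0 0) 0 μ → Exec recover-area μ 1 (High d (bank 0 0 0 A 0 0 0) 0)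
  recover-area-ok h = assign-high z≤n h 10 (m≤m+n 11 3) λ ν → high-≡ (cong (λ a → bank 0 0 0 a 0 0 0)
    (trans (cong₂ (λ b c → b ∸ 5 ∸ c) (High.at0 h) (High.at1 h)) (trans (m+n∸n≡m (n * m + n * (m * m)) m) (sym area-≡))))

  recover-nm-ok : ∀ {d μ} → High d (bank 0 0 0 A 0 0 0) 0 μ → Exec recover-nm μ (nm * 4 + 1) (High d (bank 0 0 0 0 nm 0 0) 0)
  recover-nm-ok {d} h = exec-mono ≤-refl (λ _ → high-≡ (cong (λ a → bank 0 0 0 a nm 0 0) (0*≡ nm (m + 1))))
    (exec-while (λ i → High d (bank 0 0 0 ((nm ∸ i) * (m + 1)) i 0 0) 0) nm
      (λ i ν lt h → let y , e = product>0 (m + 1) lt (m≤n+m 1 m) in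
        (y , trans (rd≡ z≤n h 10) e) ,
        exec-seq (assign-high z≤n h 11 (m≤m+n 12 2) λ ξ h′ → h′) λ ξ h′ →
        assign-high z≤n h′ 10 (m≤m+n 11 3) λ ζ → high-≡ (cong₂ (λ a b → bank 0 0 0 a b 0 0)
          (trans (cong₂ (λ a b → a ∸ (b + 1)) (rd≡ z≤n h′ 10) (High.at1 h′)) (∸-*-step (m + 1) lt))
          (trans (cong (_+ 1) (rd≡ z≤n h 11)) (+-comm i 1))))
      (λ ν h → trans (rd≡ z≤n h 10) (0*≡ nm (m + 1))) h)

  recover-n-ok : ∀ {d μ} → High d (bank 0 0 0 0 nm 0 0) 0 μ → Exec recover-n μ (n * 4 + 1) (High d (bank n 0 0 0 0 0 0) 0)
  recover-n-ok {d} h = exec-mono ≤-refl (λ _ → high-≡ (cong (λ a → bank n 0 0 0 a 0 0) (0*≡ n m)))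
    (exec-while (λ i → High d (bank i 0 0 0 ((n ∸ i) * m) 0 0) 0) n
      (λ i ν lt h → let y , e = product>0 m lt m>0 in
        (y , trans (rd≡ z≤n h 11) e) ,
        exec-seq (assign-high z≤n h 0 (m≤m+n 1 13) λ ξ h′ → h′) λ ξ h′ →
        assign-high z≤n h′ 11 (m≤m+n 12 2) λ ζ → high-≡ (cong₂ (λ a b → bank a 0 0 0 b 0 0)
          (trans (cong (_+ 1) (rd≡ z≤n h 0)) (+-comm i 1))
          (trans (cong₂ _∸_ (rd≡ z≤n h′ 11) (High.at1 h′)) (∸-*-step m lt))))
      (λ ν h → trans (rd≡ z≤n h 11) (0*≡ n m)) h)

  -- Since p < m, dividing p + k m by m returns k as quotient and restores p as remainder.
  recover-k-ok : ∀ {μ} → High (q + k * m) (bank n 0 0 0 0 0 0) 0 μ → Exec recover-k μ (k * 4 + 1) (High q (bank n 0 k 0 0 0 0) 0)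
  recover-k-ok h = exec-mono ≤-refl
    (λ ν (high a b c r t s) → high a b (trans c (trans (cong (q +_) (0*≡ k m)) (+-identityʳ q))) r t s)
    (exec-while (λ i → High (q + (k ∸ i) * m) (bank n 0 i 0 0 0 0) 0) k
      (λ i ν lt h → let y , e = positive (m<n⇒0<n∸m (enough lt)) in
        (y , trans (cond-eq h) e) ,
        exec-seq (assign-high z≤n h 2 (m≤m+n 3 11) λ ξ h′ → h′) λ ξ h′ →
        exec-assign (three (trans (cong₂ _∸_ (High.at3 h′) (High.at1 h′)) (fewer lt))
          (high-≡ (cong (λ a → bank n 0 a 0 0 0 0) (trans (cong (_+ 1) (rd≡ z≤n h 2)) (+-comm i 1))) (high-3 z≤n h′ _))))
      (λ ν h → trans (cond-eq h) (m≤n⇒m∸n≡0 (≤-trans (≤-reflexive (trans (cong (λ a → q + a + 1) (0*≡ k m))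
        (trans (cong (_+ 1) (+-identityʳ q)) (+-comm q 1)))) (Fin.toℕ<n p)))) h)
    where
    three : ∀ {x y xs tab ν} → x ≡ y → High x xs tab ν → High y xs tab ν
    three refl h = h
    cond-eq : ∀ {x xs tab ν} → High x xs tab ν → eval (M[ lit 3 ] ⊕ lit 1 ⊖ M[ lit 1 ]) ν ≡ x + 1 ∸ m
    cond-eq h = cong₂ (λ a b → a + 1 ∸ b) (High.at3 h) (High.at1 h)
    enough : ∀ {i} → i < k → m < q + (k ∸ i) * m + 1
    enough {i} lt = ≤-trans (s≤s (≤-trans (≤-trans (m≤m+n m _) (≤-reflexive (cong (_* m) (sym (∸-unfold lt))))) (m≤n+m _ q)))
      (≤-reflexive (+-comm 1 _))
    fewer : ∀ {i} → i < k → q + (k ∸ i) * m ∸ m ≡ q + (k ∸ suc i) * m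
    fewer {i} lt = trans (+-∸-assoc q (≤-trans (m≤m+n m _) (≤-reflexive (cong (_* m) (sym (∸-unfold lt))))))
      (cong (q +_) (∸-*-step m lt))

  table-ok : ∀ {μ} → High q (bank n m k 0 0 0 0) 0 μ → Exec table μ (m * 6 + 1) (High q (bank n m k 0 0 m (m * m)) m)
  table-ok h = exec-while (λ i → High q (bank n m k 0 0 i (i * m)) i) m
    (λ i ν lt h → (_ , trans (cond-eq h) (∸-unfold lt)) ,
      assign-then (exec-seq (assign-high lt (store lt h) 13 ≤-refl λ ξ h′ → h′) λ ξ h′ →
        assign-high lt h′ 12 (m≤m+n 13 1) λ ζ → high-≡ (cong₂ (bank n m k 0 0)
          (trans (cong (_+ 1) (rd≡ lt h′ 12)) (+-comm i 1))
          (trans (cong₂ _+_ (rd≡ lt (store lt h) 13) (High.at1 (store lt h))) (+-comm (i * m) m)))))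
    (λ ν h → trans (cond-eq h) (n∸n≡0 m)) h
    where
    cond-eq : ∀ {i x tab ν} → High q (bank n m k 0 0 i x) tab ν → eval (M[ lit 1 ] ⊖ rd 12) ν ≡ m ∸ i
    cond-eq {ν = ν} (high a b _ _ _ r) = cong₂ _∸_ b (trans (cong (λ b → ν (b + 12)) a) (r 12))
    store : ∀ {i ν} → i < m → High q (bank n m k 0 0 i (i * m)) i ν →
            High q (bank n m k 0 0 i (i * m)) (suc i)
              (write (ν 0 ∸ ν 1 + ν (ν 0 + 12)) (ν (ν 0 + 13)) ν)
    store {i} {ν} lt h@(high a b c r t s) = subst₂ (λ x y → High q (bank n m k 0 0 i (i * m)) (suc i) (write x y ν))
      (sym (cong₂ _+_ (trans (cong₂ _∸_ a b) (m+n∸n≡m L m)) (rd≡ (<⇒≤ lt) h 12))) (sym (rd≡ (<⇒≤ lt) h 13))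
      (high a b c
        (λ j lt′ → trans (write-other (L + i) _ ν (<⇒≢ (<-≤-trans lt′ (m≤m+n L i)))) (r j lt′))
        tabs′
        (λ u → trans (write-other (L + i) _ ν (<⇒≢ (<-≤-trans (+-monoʳ-< L lt) (m≤m+n (L + m) u)) ∘ sym)) (s u)))
      where
      tabs′ : ∀ a → a < suc i → write (L + i) (i * m) ν (L + a) ≡ a * m
      tabs′ a a< with a ≟ i
      ... | yes refl = write-same (L + i) _ ν refl
      ... | no ne    = trans (write-other (L + i) _ ν (ne ∘ +-cancelˡ-≡ L _ _)) (t a (≤∧≢⇒< (s≤s⁻¹ a<) ne))

  base>0 : 0 < base
  base>0 = z<s

  setup-ok : Exec setup enc (setupTime n m k) (Core.Ready n m k X base base>0 X-outside 3)
  setup-ok = exec-seq (clear-ok (low refl refl refl refl (λ _ → refl))) λ _ o → exec-seq (product-ok o) λ _ o →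
    exec-seq (area-ok o) λ _ o → exec-seq (base-ok o) λ _ h → exec-seq (recover-area-ok h) λ _ h →
    exec-seq (recover-nm-ok h) λ _ h → exec-seq (recover-n-ok h) λ _ h → exec-seq (recover-k-ok h) λ _ h →
    exec-seq (assign-high z≤n h 1 (m≤m+n 2 12) λ ν h′ → high-≡ (cong (λ a → bank n a k 0 0 0 0) (High.at1 h)) h′) λ _ h →
    exec-mono ≤-refl (λ _ → ready) (table-ok h)
    where
    ready : ∀ {ν} → High q (bank n m k 0 0 m (m * m)) m ν → Core.Ready n m k X base base>0 X-outside 3 ν
    ready {ν} (high a b c r t s) = record
      { pointer = a
      ; input   = reading
      ; globals = λ { gn → s 0 ; gm → s 1 ; gk → s 2 ; gk1 → s 3 ; gN → s 4 ; gR → s 5 ; gL → s 6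
                    ; gJ → s 7 ; gnm → s 8 ; gmm → s 9 }
      ; locals  = λ ()
      ; fresh   = λ ()
      ; large   = ≤-refl }
      where
      reading : ∀ j → 3 + j < base → ν (3 + j) ≡ X j
      reading zero    _ = trans c (sym (X-input 0 (m≤m+n 4 _)))
      reading (suc j) lt with 4 + j <? L
      ... | yes l = trans (r j l) (sym (X-input (suc j) l))
      ... | no ≮ with m≤n⇒∃[o]m+o≡n (≮⇒≥ ≮)
      ... | o , e = trans (cong ν (sym e)) (trans (t o o<) (sym (X-table (suc j) o o< (sym e))))
        where
        o< : o < m
        o< = +-cancelˡ-< L o m (subst (_< L + m) (sym e) lt)

-- Running time

-- If k ≥ m, every candidate is approved in every vote and the answer is yes; the search needs
-- k-sets to exist.
program : Program
program = ifnz (M[ lit 1 ] ⊖ M[ lit 2 ]) (setup ⨾ core) (M[ lit 0 ]≔ lit 1)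

stages-det : ∀ gs → Deterministic (stages gs)
stages-det []       = tt
stages-det (g ∷ gs) = (compile-det _ 10 (value-of g) , tt) , stages-det gs

program-det : Deterministic program
program-det = (setup-det , stages-det derived , compile-det _ 10 mainT , tt) , tt

stageBound : Glob → Bound
stageBound g = const 1 ⊕ᵇ (costBound (value-of g) ⊕ᵇ const 1)

infixr 5 _⟫_
_⟫_ : Bound → Bound → Bound
x ⟫ y = const 1 ⊕ᵇ (x ⊕ᵇ y)

loopBound : Bound → ℕ → Bound
loopBound x c = x ⊗ᵇ const c ⊕ᵇ const 1

setupBound coreBound : Bound
setupBound = loopBound k 4 ⟫ loopBound n 4 ⟫ loopBound nm 4 ⟫ const 1 ⟫ const 1 ⟫
  loopBound nm 4 ⟫ loopBound n 4 ⟫ loopBound k 4 ⟫ const 1 ⟫ loopBound (globBound gm) 6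
  where
  n = globBound gn
  k = globBound gk
  nm = n ⊗ᵇ globBound gm
coreBound = (stageBound gk1 ⟫ stageBound gN ⟫ stageBound gR ⟫ stageBound gL ⟫ stageBound gJ ⟫
  stageBound gnm ⟫ stageBound gmm ⟫ const 1) ⟫ costBound mainT ⟫ const 1

opaque
  programBound : Bound
  programBound = const 1 ⊕ᵇ (setupBound ⟫ coreBound)

opaque
  unfolding programBound mulT candT costT upT upAtT pairT phiT elemT distinctT entryT knownT extendsT allowedT
            validT bestT cntT curT chosenT lastT pickT scoreT checkT runT mainT
  -- The exponent k + 1 comes from here: by evaluation, the whole program has a single factor m
  -- beside a single factor m^k and one factor for each kind of guess.
  degrees : degm programBound ≤ 1 × degR programBound ≤ 1 ×
            degL programBound ≤ 1 × degJ programBound ≤ 1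
  degrees = ≤-refl , ≤-refl , ≤-refl , ≤-refl

module Timing (n m k : ℕ) {{_ : NonZero n}} {{_ : NonZero m}} {{_ : NonZero k}} where
  instance
    N≢0 : NonZero (n * k)
    N≢0 = m*n≢0 n k
    R≢0 : NonZero (m ^ k)
    R≢0 = m^n≢0 m k
    L≢0 : NonZero (n ^ (n * k))
    L≢0 = m^n≢0 n (n * k)
    J≢0 : NonZero (suc k ^ (n * k))
    J≢0 = m^n≢0 (suc k) (n * k)

  open Monomials (n * k) m (m ^ k) (n ^ (n * k)) (suc k ^ (n * k))

  size≼ : ∀ g → size n m k g ≼ globBound g
  size≼ g = ≼-intro (go g)
    where
    open +-*-Solver
    N R L JJ : ℕ
    N = n * k
    R = m ^ k
    L = n ^ N
    JJ = suc k ^ N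
    n≤N : n ≤ N
    n≤N = m≤m*n n k
    k≤N : k ≤ N
    k≤N = m≤n*m k n
    one : ∀ N → 1 * (N * 1 * 1) ≡ N
    one N = solve 1 (λ x → con 1 :* (x :* con 1 :* con 1) := x) refl N
    go : ∀ g → size n m k g ≤ value (globBound g)
    go gn  = ≤-trans n≤N (≤-reflexive (sym (one N)))
    go gm  = ≤-reflexive (solve 1 (λ x → x := con 1 :* (con 1 :* (x :* con 1 :* con 1))) refl m)
    go gk  = ≤-trans k≤N (≤-reflexive (sym (one N)))
    go gk1 = ≤-trans (+-mono-≤ (>-nonZero⁻¹ N) k≤N) (≤-reflexive (solve 1 (λ x → x :+ x := con 2 :* (x :* con 1 :* con 1)) refl N))
    go gN  = ≤-reflexive (sym (one N))
    go gR  = ≤-reflexive (solve 1 (λ x → x := con 1 :* (con 1 :* (con 1 :* (x :* con 1 :* con 1)))) refl R)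
    go gL  = ≤-reflexive (solve 1 (λ x → x := con 1 :* (con 1 :* (con 1 :* (con 1 :* (x :* con 1 :* con 1))))) refl L)
    go gJ  = ≤-reflexive (solve 1 (λ x → x := con 1 :* (con 1 :* (con 1 :* (con 1 :* (con 1 :* (x :* con 1)))))) refl JJ)
    go gnm = ≤-trans (*-monoˡ-≤ m n≤N) (≤-reflexive (solve 2 (λ x y → x :* y := con 1 :* (x :* con 1 :* (y :* con 1 :* con 1))) refl N m))
    go gmm = ≤-reflexive (solve 1 (λ x → x :* x := con 1 :* (con 1 :* (x :* (x :* con 1) :* con 1))) refl m)

  ≼-≤ : ∀ {x y b} → x ≤ y → y ≼ b → x ≼ b
  ≼-≤ le (≼-intro h) = ≼-intro (≤-trans le h)

  _≼⟫_ : ∀ {x y b c} → x ≼ b → y ≼ c → suc (x + y) ≼ (b ⟫ c)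
  h ≼⟫ h′ = ≼-const 1 ≼+ (h ≼+ h′)

  infixr 5 _≼⟫_

  ≼-loop : ∀ {x b} c → x ≼ b → (x * c + 1) ≼ loopBound b c
  ≼-loop c h = (h ≼* ≼-const c) ≼+ ≼-const 1

  setup≼ : setupTime n m k ≼ setupBound
  setup≼ = ≼-loop 4 (size≼ gk) ≼⟫ ≼-loop 4 (size≼ gn) ≼⟫ ≼-loop 4 (size≼ gn ≼* size≼ gm) ≼⟫ ≼-const 1 ≼⟫ ≼-const 1 ≼⟫
    ≼-loop 4 (size≼ gn ≼* size≼ gm) ≼⟫ ≼-loop 4 (size≼ gn) ≼⟫ ≼-loop 4 (size≼ gk) ≼⟫ ≼-const 1 ≼⟫ ≼-loop 6 (size≼ gm)

  module _ (X : ℕ → ℕ) (base : ℕ) (base>0 : 0 < base) (outside : ∀ j → base ≤ 3 + j → X j ≡ 0) where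
    open Core n m k X base base>0 outside

    partial≼ : ∀ s g → partial s g ≼ globBound g
    partial≼ s g = ≼-≤ (le (does (reg g <? s))) (size≼ g)
      where
      le : ∀ b → (if b then size n m k g else 0) ≤ size n m k g
      le true  = ≤-refl
      le false = z≤n

    stage≼ : ∀ g → stageTime g ≼ stageBound g
    stage≼ g = ≼-const 1 ≼+ (cost≼ (partial (reg g)) (partial≼ (reg g)) (value-of g) ≼+ ≼-const 1)

    core≼ : coreTime ≼ coreBound
    core≼ = (stage≼ gk1 ≼⟫ stage≼ gN ≼⟫ stage≼ gR ≼⟫ stage≼ gL ≼⟫ stage≼ gJ ≼⟫ stage≼ gnm ≼⟫ stage≼ gmm ≼⟫ ≼-const 1)
      ≼⟫ cost≼ (size n m k) size≼ mainT ≼⟫ ≼-const 1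

    opaque
      unfolding programBound
      program≼ : suc (suc (setupTime n m k + coreTime)) ≼ programBound
      program≼ = ≼-const 1 ≼+ (setup≼ ≼⟫ core≼)

^-distribʳ-* : ∀ o m n → (m * n) ^ o ≡ m ^ o * n ^ o
^-distribʳ-* zero    m n = refl
^-distribʳ-* (suc o) m n = trans (cong (m * n *_) (^-distribʳ-* o m n)) (interchange m n (m ^ o) (n ^ o))

-- Above 2a + 4 already 2 ^ N ≤ N ^ (N ∸ a).
growth : ∀ a N .{{_ : NonZero N}} → N ^ a * 2 ^ N ≤ (2 * a + 4) ^ a * 2 ^ (2 * a + 4) * N ^ N
growth a N with ≤-total N (2 * a + 4)
... | inj₁ le = ≤-trans (*-mono-≤ (^-monoˡ-≤ a le) (^-monoʳ-≤ 2 le)) (m≤m*n _ (N ^ N) {{m^n≢0 N N}})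
... | inj₂ ge with m≤n⇒∃[o]m+o≡n (≤-trans (m≤m+n (2 * a) 4) ge)
... | r , refl = ≤-trans (*-monoʳ-≤ (N ^ a) small) (≤-trans (≤-reflexive (trans (sym (^-distribˡ-+-* N a (a + r))) (cong (N ^_) reassoc)))
    (m≤n*m (N ^ N) K {{m*n≢0 (D ^ a) (2 ^ D) {{m^n≢0 D a {{D≢0}}}} {{m^n≢0 2 D}}}}))
  where
  D K : ℕ
  D = 2 * a + 4
  K = D ^ a * 2 ^ D
  D≢0 : NonZero D
  D≢0 = >-nonZero (≤-trans z<s (m≤n+m 4 (2 * a)))
  reassoc : a + (a + r) ≡ 2 * a + r
  reassoc = trans (sym (+-assoc a a r)) (cong (λ x → a + x + r) (sym (+-identityʳ a)))
  -- N = 2a + r ≤ 2 (a + r) gives 2^N ≤ 4^(a + r), and N is at least 4.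
  small : 2 ^ N ≤ N ^ (a + r)
  small = ≤-trans (^-monoʳ-≤ 2 (≤-trans (≤-reflexive (sym reassoc)) (≤-trans (+-monoˡ-≤ (a + r) (m≤m+n a r)) (≤-reflexive (cong ((a + r) +_) (sym (+-identityʳ (a + r))))))))
    (≤-trans (≤-reflexive (sym (^-*-assoc 2 2 (a + r)))) (^-monoˡ-≤ (a + r) (≤-trans (m≤n+m 4 (2 * a)) ge)))

-- `factor` is the constant of `growth`; the summand 2 pays for the two steps of the case k ≥ m.
degree factor constant : ℕ
degree   = degN programBound
factor   = (2 * degree + 4) ^ degree * 2 ^ (2 * degree + 4)
constant = coef programBound * factor + 2

module _ (n m k : ℕ) {{_ : NonZero n}} {{_ : NonZero m}} {{_ : NonZero k}} where
  open Timing n m k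
  open Monomials (n * k) m (m ^ k) (n ^ (n * k)) (suc k ^ (n * k))

  -- From n (k + 1) ≤ 2 n k the guesses number at most 2^N N^N. The second factor N^N of the bound
  -- absorbs 2^N and the polynomial overhead by `growth`.
  time-bound : ∀ {T} → T ≼ programBound → T ≤ (n * k) ^ (2 * (n * k)) * (constant * m ^ (k + 1))
  time-bound {T} (≼-intro le) = begin
    T
      ≤⟨ le ⟩
    c * (N ^ degree * (m ^ degm programBound * ((m ^ k) ^ degR programBound *
      ((n ^ N) ^ degL programBound * (suc k ^ N) ^ degJ programBound))))
      ≤⟨ *-monoʳ-≤ c (monomial-mono {a = degree} ≤-refl (proj₁ degrees) (proj₁ (proj₂ degrees))
           (proj₁ (proj₂ (proj₂ degrees))) (proj₂ (proj₂ (proj₂ degrees)))) ⟩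
    c * (N ^ degree * (m ^ 1 * ((m ^ k) ^ 1 * ((n ^ N) ^ 1 * (suc k ^ N) ^ 1))))
      ≡⟨ solve 6 (λ c a m r l j → c :* (a :* (m :* con 1 :* (r :* con 1 :* (l :* con 1 :* (j :* con 1))))) :=
           c :* ((m :* r) :* (a :* (l :* j)))) refl c (N ^ degree) m (m ^ k) (n ^ N) (suc k ^ N) ⟩
    c * (m ^ suc k * (N ^ degree * (n ^ N * suc k ^ N)))
      ≤⟨ *-monoʳ-≤ c (*-monoʳ-≤ (m ^ suc k) (*-monoʳ-≤ (N ^ degree) guesses)) ⟩
    c * (m ^ suc k * (N ^ degree * (2 ^ N * N ^ N)))
      ≡⟨ cong (λ x → c * (m ^ suc k * x)) (sym (*-assoc (N ^ degree) (2 ^ N) (N ^ N))) ⟩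
    c * (m ^ suc k * (N ^ degree * 2 ^ N * N ^ N))
      ≤⟨ *-monoʳ-≤ c (*-monoʳ-≤ (m ^ suc k) (*-monoˡ-≤ (N ^ N) (growth degree N))) ⟩
    c * (m ^ suc k * (factor * N ^ N * N ^ N))
      ≡⟨ solve 4 (λ c x f y → c :* (x :* (f :* y :* y)) := y :* y :* (c :* f :* x)) refl c (m ^ suc k) factor (N ^ N) ⟩
    N ^ N * N ^ N * (c * factor * m ^ suc k)
      ≡⟨ cong₂ (λ x y → x * (c * factor * m ^ y)) square (+-comm 1 k) ⟩
    N ^ (2 * N) * (c * factor * m ^ (k + 1))
      ≤⟨ *-monoʳ-≤ (N ^ (2 * N)) (*-monoˡ-≤ (m ^ (k + 1)) (m≤m+n (c * factor) 2)) ⟩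
    N ^ (2 * N) * (constant * m ^ (k + 1)) ∎
    where
    open ≤-Reasoning
    open +-*-Solver
    c N : ℕ
    c = coef programBound
    N = n * k
    square : N ^ N * N ^ N ≡ N ^ (2 * N)
    square = trans (sym (^-distribˡ-+-* N N N)) (cong (λ x → N ^ (N + x)) (sym (+-identityʳ N)))
    guesses : n ^ N * suc k ^ N ≤ 2 ^ N * N ^ N
    guesses = ≤-trans (≤-reflexive (sym (^-distribʳ-* N n (suc k)))) (≤-trans
      (^-monoˡ-≤ N (≤-trans (*-monoʳ-≤ n (≤-trans (+-monoˡ-≤ k (>-nonZero⁻¹ k)) (≤-reflexive (cong (k +_) (sym (+-identityʳ k))))))
        (≤-reflexive (solve 2 (λ n k → n :* (k :+ (k :+ con 0)) := con 2 :* (n :* k)) refl n k))))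
      (≤-reflexive (^-distribʳ-* N 2 (n * k))))

  two-steps : 2 ≤ (n * k) ^ (2 * (n * k)) * (constant * m ^ (k + 1))
  two-steps = *-mono-≤ (m^n>0 (n * k) (2 * (n * k))) (≤-trans (m≤n+m 2 (coef programBound * factor))
    (m≤m*n constant (m ^ (k + 1)) {{m^n≢0 m (k + 1)}}))

-- Correctness and running time of the whole program

Answers : ∀ {n m} → ℕ → Instance n m → Memory → Set
Answers k I μ = μ 0 ≢ 0 ⇔ SwapBribery I k

all-win : ∀ {n m} k (I : Instance n m) → m ≤ k → SwapBribery I k
all-win {n} {m} k I m≤k = (λ _ → [] , []) , votes , (λ _ → [] , ↭-refl , done) ,
  ≤-trans (≤-reflexive (∑-zero n)) z≤n ,
  λ c → ≤-reflexive (∑-cong λ i → trans (point i c) (sym (point i p)))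
  where
  open Instance I
  point : ∀ i c → points k c (votes i) ≡ 1
  point i c = points-1 k c (votes i) (<-≤-trans (Fin.toℕ<n _) m≤k)

program-ok : ∀ k n m {{_ : NonZero n}} {{_ : NonZero k}} (I : Instance n m) →
  Exec program (load (encode k I)) ((n * k) ^ (2 * (n * k)) * (constant * m ^ (k + 1))) (Answers k I)
program-ok k n zero I with Instance.p I
... | ()
program-ok k n m@(suc _) I with k <? m
... | no ≮ = exec-mono (two-steps n m k) (λ _ → id)
  (exec-if0 (m≤n⇒m∸n≡0 (≮⇒≥ ≮)) (exec-assign (mk⇔ (λ _ → all-win k I (≮⇒≥ ≮)) (λ _ ()))))
... | yes k<m = exec-mono (time-bound n m k (Timing.program≼ n m k X base base>0 X-outside)) answer
  (exec-if1 (∸-unfold k<m) (exec-seq setup-ok λ _ ready → Core.core-ok n m k X base base>0 X-outside ready))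
  where
  open Encoded k n m I
  open Setup k n m I k<m
  answer : ∀ μ → μ 0 ≡ Sem.⟦_⟧ X (size n m k) mainT [] → Answers k I μ
  answer μ eq = mk⇔
    (λ ne → to (main⇔bribery (<⇒≤ k<m)) (subst Tr eq (pos⇒Tr (n≢0⇒n>0 ne))))
    (λ sb z → subst Tr (trans (sym eq) z) (from (main⇔bribery (<⇒≤ k<m)) sb))

module Outcome {P : Program} (det : Deterministic P) {μ : Memory} {T : ℕ} {Q : Memory → Set} (ex : Exec P μ T Q) where
  open Exec ex

  private
    det′ : All Deterministic (P ∷ [])
    det′ = det ∷ []

  halts : ∀ {t} → time ≤ t → (cs : Vec Bool t) → run cs (P ∷ [] , μ) ≡ ([] , final)
  halts le cs with m≤n⇒∃[o]m+o≡n le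
  ... | o , refl = trans (run-walk cs _ _ det′) (trans (walk-+ time o _) (trans (cong (walk o) (runs [])) (walk-halted o final)))

  -- A halted machine stays as it is, so a run found halted before `time` already shows the final
  -- memory.
  halted-final : ∀ {t} (cs : Vec Bool t) → Halted (run cs (P ∷ [] , μ)) → run cs (P ∷ [] , μ) ≡ ([] , final)
  halted-final {t} cs h with ≤-total time t
  ... | inj₁ le = halts le cs
  ... | inj₂ ge with m≤n⇒∃[o]m+o≡n ge | run cs (P ∷ [] , μ) | run-walk cs (P ∷ []) μ det′
  ... | o , e | K , ν | eq rewrite h =
    trans (sym (walk-halted o ν)) (trans (cong (walk o) eq) (trans (sym (walk-+ t o _)) (trans (cong (λ u → walk u (P ∷ [] , μ)) e) (runs []))))

  steps≤ : ∀ {t} (cs : Vec Bool t) → steps cs (P ∷ [] , μ) ≤ T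
  steps≤ cs = ≤-trans (walk-steps cs _ _ time final det′ (runs [])) bound

∑coins-≤ : ∀ t {B} (f : Vec Bool t → ℕ) → (∀ cs → f cs ≤ B) → ∑coins t f ≤ B * 2 ^ t
∑coins-≤ zero    {B} f le = ≤-trans (le []) (≤-reflexive (sym (*-identityʳ B)))
∑coins-≤ (suc t) {B} f le = ≤-trans
  (+-mono-≤ (∑coins-≤ t (f ∘ (true ∷_)) (le ∘ (true ∷_))) (∑coins-≤ t (f ∘ (false ∷_)) (le ∘ (false ∷_))))
  (≤-reflexive (trans (sym (*-distribˡ-+ B (2 ^ t) (2 ^ t))) (cong (λ x → B * (2 ^ t + x)) (sym (+-identityʳ (2 ^ t))))))

relevant : ∀ n → .{{_ : NonZero n}} → NonZero n
relevant n = ≢-nonZero (≢-nonZero⁻¹ n)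

theorem6 : (∃ λ (P : Program) → ∃ λ (C : ℕ) →
    ∀ (k n m : ℕ) .{{_ : NonZero k}} .{{_ : NonZero n}} (I : Instance n m) →
    Correct P k I ×
    ExpectedTime≤ P k I
    ((2^[log n +log k ]· (2 * (n * k))) * (C * m ^ (k + 1))))
    ×
    (∃ λ (P : Program) → Deterministic P × (∃ λ (c : ℕ) → ∃ λ (C : ℕ) →
    ∀ (k n m : ℕ) .{{_ : NonZero k}} .{{_ : NonZero n}} (I : Instance n m) →
    Correct P k I ×
    (∃ λ (t : ℕ) → HaltsWithin P k I t ×
    (2 ≤ m →
    t ≤ (2^[log n +log k ]· (c * (n * k))) * (C * (m ^ (k + 1) * ⌊log₂ m ⌋))))))
theorem6 =
  (program , constant , λ k n m I → correct k n m I , λ t → ∑coins-≤ t _ (λ cs → Outcome.steps≤ program-det (solved k n m I) cs)) ,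
  program , program-det , 2 , constant , λ k n m I → correct k n m I ,
    _ , (λ cs → cong proj₁ (Outcome.halts program-det (solved k n m I) (Exec.bound (solved k n m I)) cs)) ,
    -- For m ≥ 2 the logarithmic factor is at least 1, so the bound without it suffices.
    λ 2≤m → *-monoʳ-≤ ((n * k) ^ (2 * (n * k))) (*-monoʳ-≤ constant
      (m≤m*n (m ^ (k + 1)) ⌊log₂ m ⌋ {{>-nonZero (≤-trans (≤-reflexive (sym (⌊log₂[2^n]⌋≡n 1))) (⌊log₂⌋-mono-≤ 2≤m))}}))
  where
  solved : ∀ k n m .{{_ : NonZero k}} .{{_ : NonZero n}} (I : Instance n m) →
    Exec program (load (encode k I)) ((n * k) ^ (2 * (n * k)) * (constant * m ^ (k + 1))) (Answers k I)
  solved k n m I = program-ok k n m {{relevant n}} {{relevant k}} I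
  correct : ∀ k n m .{{_ : NonZero k}} .{{_ : NonZero n}} (I : Instance n m) → Correct program k I
  correct k n m I cs h = subst (λ s → Accepting s ⇔ SwapBribery I k)
    (sym (Outcome.halted-final program-det (solved k n m I) cs h)) (Exec.post (solved k n m I))
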